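{- Let $q$ be a prime power and $k\geq 3$ an integer. Under a uniformly random ring homomorphism $\Lambda\to\mathbb{F}_q$, $P(s_{\delta_k}\mapsto 0\mid s_{\delta_{k-2}}\mapsto 0)=1/q$.
   Context: $\Lambda$ is the ring of symmetric functions over $\mathbb{Z}$, $h_k$ the complete homogeneous symmetric functions, $s_\lambda$ the Schur functions. A uniformly random ring homomorphism $\Lambda\to\mathbb{F}_q$ is obtained by sending $h_1,h_2,\dots$ to independent uniformly random elements of $\mathbb{F}_q$. $\delta_k$ denotes the staircase partition $(k,k-1,\dots,2,1)$. -}

module Defs where

open import Level using (Level; _⊔_) renaming (suc to lsuc)
open import Data.Nat using (ℕ; zero; suc; _∸_; _<_; _<?_)
open import Data.Fin using (Fin; zero; suc; toℕ; fromℕ<; punchIn)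
open import Data.List using (List; []; _∷_; foldr; map; concatMap; length; filter)
open import Data.Integer using (ℤ; +_; -[1+_]) renaming (_+_ to _+ℤ_; _-_ to _-ℤ_)
open import Data.Vec using (Vec; []; _∷_; lookup; tabulate)
open import Data.Product using (∃; _×_; _,_; proj₁; proj₂)
open import Relation.Nullary using (¬_; Dec; yes; no)
open import Relation.Unary using (Pred; Decidable)
open import Relation.Binary.PropositionalEquality as ≡ using (_≡_)
open import Algebra.Bundles using (CommutativeRing)
open import Function.Bundles using (Inverse)

-- Finite fields: a commutative ring with decidable equality, 0 ≠ 1,
-- inverses of nonzero elements, and an explicit bijection with Fin q.
-- (Every finite field has prime-power order and for each prime power q
-- the field with q elements is unique up to isomorphism, so "for every
-- finite field with q elements" is the same as "for F_q, q a prime power".)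

record FiniteField (c ℓ : Level) (q : ℕ) : Set (lsuc (c ⊔ ℓ)) where
  field
    commRing : CommutativeRing c ℓ
  open CommutativeRing commRing public
    using (Carrier; _≈_; _+_; _*_; -_; 0#; 1#; setoid)
  field
    _≟_      : (x y : Carrier) → Dec (x ≈ y)
    0≉1      : ¬ (0# ≈ 1#)
    inverse  : (x : Carrier) → ¬ (x ≈ 0#) → ∃ λ y → x * y ≈ 1#
    enum     : Inverse (≡.setoid (Fin q)) setoid

module Det {c ℓ} (R : CommutativeRing c ℓ) where
  open CommutativeRing R using (Carrier; _+_; _*_; -_; 0#; 1#)

  alt : ℕ → Carrier
  alt zero    = 1#
  alt (suc n) = - alt n

  allFin : (n : ℕ) → List (Fin n)
  allFin zero    = []
  allFin (suc n) = zero ∷ map suc (allFin n)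

  Σ : ∀ {n} → (Fin n → Carrier) → Carrier
  Σ {n} f = foldr (λ j acc → f j + acc) 0# (allFin n)

  det : (n : ℕ) → (Fin n → Fin n → Carrier) → Carrier
  det zero    M = 1#
  det (suc n) M =
    Σ (λ j → (alt (toℕ j) * M zero j) * det n (λ a b → M (suc a) (punchIn j b)))

  -- Images of the h's under a ring homomorphism Λ → R determined by the
  -- values of h_1, …, h_N (v m = image of h_{m+1}); h_0 = 1, h_r = 0 for r < 0.
  -- Indices > N are never used below (we choose N large enough).

  hval : ∀ {N} → (Fin N → Carrier) → ℤ → Carrier
  hval v -[1+ _ ]     = 0#
  hval v (+ zero)     = 1#
  hval {N} v (+ suc m) with m <? N
  ... | yes m<N = v (fromℕ< m<N)
  ... | no  _   = 0#

  -- Image of the Schur function s_λ (λ a partition with n parts, given as a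
  -- weakly decreasing vector) via the Jacobi–Trudi identity
  -- s_λ = det (h_{λ_i - i + j})_{1≤i,j≤n}.
  schur : ∀ {N n} → (Fin N → Carrier) → Vec ℕ n → Carrier
  schur {n = n} v λ' =
    det n (λ i j → hval v ((+ lookup λ' i -ℤ + toℕ i) +ℤ + toℕ j))

staircase : (k : ℕ) → Vec ℕ k
staircase k = tabulate (λ i → k ∸ toℕ i)

allFin : (n : ℕ) → List (Fin n)
allFin zero    = []
allFin (suc n) = zero ∷ map suc (allFin n)

allVecs : (q N : ℕ) → List (Fin N → Fin q)
allVecs q zero    = (λ ()) ∷ []
allVecs q (suc N) =
  concatMap (λ x → map (λ f → λ { zero → x ; (suc i) → f i }) (allVecs q N)) (allFin q)

count : ∀ {p} {A : Set} (P : Pred A p) → Decidable P → List A → ℕ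
count P P? xs = length (filter P? xs)

module Events {c ℓ q} (F : FiniteField c ℓ q) where
  open FiniteField F
  open Det commRing public
  open Inverse enum using (to)

  -- the ring homomorphism Λ → F sending h_{m+1} ↦ to (x m)
  vals : ∀ {N} → (Fin N → Fin q) → Fin N → Carrier
  vals x m = to (x m)

  Vanish : (N k : ℕ) → Pred (Fin N → Fin q) ℓ
  Vanish N k x = schur (vals x) (staircase k) ≈ 0#

  Vanish? : (N k : ℕ) → Decidable (Vanish N k)
  Vanish? N k x = schur (vals x) (staircase k) ≟ 0#

  Both : (N k : ℕ) → Pred (Fin N → Fin q) ℓ
  Both N k x = Vanish N k x × Vanish N (k ∸ 2) x

  Both? : (N k : ℕ) → Decidable (Both N k)
  Both? N k x with Vanish? N k x | Vanish? N (k ∸ 2) x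
  ... | yes a | yes b = yes (a , b)
  ... | no ¬a | _     = no (λ p → ¬a (proj₁ p))
  ... | yes _ | no ¬b = no (λ p → ¬b (proj₂ p))

-- Expanding the Jacobi–Trudi determinant of s_{δ_k} along its first row shows that h_{2k-1}
-- occurs only in the corner entry, whose cofactor is ± s_{δ_{k-2}}; so
-- s_{δ_k} = c ± h_{2k-1} s_{δ_{k-2}} with c, s_{δ_{k-2}} independent of h_{2k-1}.  Given the
-- other h's, s_{δ_k} therefore vanishes for exactly one value of h_{2k-1} when s_{δ_{k-2}} ≠ 0,
-- and for all or none of them when s_{δ_{k-2}} = 0.  Hence
--   #{s_{δ_k} = 0} = #{s_{δ_{k-2}} ≠ 0} / q + #{s_{δ_k} = s_{δ_{k-2}} = 0},
-- and the proposition follows from the unconditional counts P(s_{δ_k} = 0) = P(s_{δ_{k-2}} = 0) = 1/q.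
--
-- For the latter, reverse rows and columns of the Jacobi–Trudi matrix: it becomes the
-- coefficient matrix of the linear conditions X E + Y O ≡ 0 (mod z^k) on polynomials
-- E, O with deg E < ⌈k/2⌉, deg O < ⌊k/2⌋, where X = Σ h_{2e+1} z^e and Y = Σ h_{2e} z^e
-- (so Y(0) = h_0 = 1).  Thus s_{δ_k} = 0 iff such a nonzero (E, O) exists.
-- A Euclid-type step (subtract a multiple of the series with unit constant term from the other
-- and divide by z) preserves existence and is a translation of the coefficient space, so it
-- preserves the proportion of pairs (X, Y) with a relation; by induction this proportion is 1/q.
{-# OPTIONS --safe #-}
module Submission where

open import Algebra.Bundles using (CommutativeRing)
import Defs

module Determinant {c ℓ} (R : CommutativeRing c ℓ) where

  open import Defs using (module Det)
  open import Data.Nat as ℕ using (ℕ; zero; suc)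
  open import Data.Fin as F using (Fin; zero; suc; toℕ; punchIn; punchOut; fromℕ; inject₁)
  import Data.Nat.Properties as NP
  import Data.Fin.Properties as FP
  open import Data.List using (List; []; _∷_; foldr; map)
  open import Relation.Binary.PropositionalEquality as ≡ using (_≡_; _≢_)
  open import Relation.Nullary using (yes; no)
  open import Relation.Binary.Definitions using (tri<; tri≈; tri>)
  open import Data.Empty using (⊥-elim)
  open import Function using (_∘_)

  open CommutativeRing R hiding (zero)
  open Det R
  open import Relation.Binary.Reasoning.Setoid setoid
  open import Algebra.Properties.Ring ring using (-‿distribˡ-*; -‿distribʳ-*; -‿involutive; -0#≈0#; +-inverseʳ-unique)
  open import Algebra.Solver.Ring.NaturalCoefficients.Default commutativeSemiring

  Matrix : ℕ → Set c
  Matrix n = Fin n → Fin n → Carrier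

  -x*-y≈x*y : ∀ x y → (- x) * (- y) ≈ x * y
  -x*-y≈x*y x y = begin
    (- x) * (- y)   ≈⟨ -‿distribˡ-* x (- y) ⟨
    - (x * - y)     ≈⟨ -‿cong (-‿distribʳ-* x y) ⟨
    - (- (x * y))   ≈⟨ -‿involutive _ ⟩
    x * y           ∎

  alt*alt≈1 : ∀ m → alt m * alt m ≈ 1#
  alt*alt≈1 zero = *-identityˡ 1#
  alt*alt≈1 (suc m) = trans (-x*-y≈x*y (alt m) (alt m)) (alt*alt≈1 m)

  foldr-map-suc : ∀ {n} (f : Fin (suc n) → Carrier) (xs : List (Fin n)) →
    foldr (λ j acc → f j + acc) 0# (map suc xs) ≡ foldr (λ j acc → f (suc j) + acc) 0# xs
  foldr-map-suc f [] = ≡.refl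
  foldr-map-suc f (x ∷ xs) = ≡.cong (f (suc x) +_) (foldr-map-suc f xs)

  Σ-suc : ∀ {n} (f : Fin (suc n) → Carrier) → Σ f ≈ f zero + Σ (f ∘ suc)
  Σ-suc {n} f = reflexive (≡.cong (f zero +_) (foldr-map-suc f (allFin n)))

  Σ-cong : ∀ {n} {f g : Fin n → Carrier} → (∀ j → f j ≈ g j) → Σ f ≈ Σ g
  Σ-cong {zero} eq = refl
  Σ-cong {suc n} {f} {g} eq = begin
    Σ f                   ≈⟨ Σ-suc f ⟩
    f zero + Σ (f ∘ suc)  ≈⟨ +-cong (eq zero) (Σ-cong (eq ∘ suc)) ⟩
    g zero + Σ (g ∘ suc)  ≈⟨ Σ-suc g ⟨
    Σ g                   ∎

  Σ-≈0 : ∀ {n} {f : Fin n → Carrier} → (∀ j → f j ≈ 0#) → Σ f ≈ 0#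
  Σ-≈0 {zero} eq = refl
  Σ-≈0 {suc n} {f} eq = begin
    Σ f                   ≈⟨ Σ-suc f ⟩
    f zero + Σ (f ∘ suc)  ≈⟨ +-cong (eq zero) (Σ-≈0 (eq ∘ suc)) ⟩
    0# + 0#               ≈⟨ +-identityˡ 0# ⟩
    0#                    ∎

  Σ-distrib-+ : ∀ {n} (f g : Fin n → Carrier) → Σ (λ j → f j + g j) ≈ Σ f + Σ g
  Σ-distrib-+ {zero} f g = sym (+-identityˡ 0#)
  Σ-distrib-+ {suc n} f g = begin
    Σ (λ j → f j + g j)                                   ≈⟨ Σ-suc (λ j → f j + g j) ⟩
    (f zero + g zero) + Σ (λ j → f (suc j) + g (suc j))   ≈⟨ +-congˡ (Σ-distrib-+ (f ∘ suc) (g ∘ suc)) ⟩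
    (f zero + g zero) + (Σ (f ∘ suc) + Σ (g ∘ suc))       ≈⟨ interchange _ _ _ _ ⟩
    (f zero + Σ (f ∘ suc)) + (g zero + Σ (g ∘ suc))       ≈⟨ +-cong (Σ-suc f) (Σ-suc g) ⟨
    Σ f + Σ g                                             ∎
    where
    interchange : ∀ a b c d → (a + b) + (c + d) ≈ (a + c) + (b + d)
    interchange = solve 4 (λ a b c d → (a :+ b) :+ (c :+ d) := (a :+ c) :+ (b :+ d)) refl

  Σ-factorˡ : ∀ {n} (x : Carrier) (f : Fin n → Carrier) → Σ (λ j → x * f j) ≈ x * Σ f
  Σ-factorˡ {zero} x f = sym (zeroʳ x)
  Σ-factorˡ {suc n} x f = begin
    Σ (λ j → x * f j)                     ≈⟨ Σ-suc (λ j → x * f j) ⟩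
    x * f zero + Σ (λ j → x * f (suc j))  ≈⟨ +-congˡ (Σ-factorˡ x (f ∘ suc)) ⟩
    x * f zero + x * Σ (f ∘ suc)          ≈⟨ distribˡ x _ _ ⟨
    x * (f zero + Σ (f ∘ suc))            ≈⟨ *-congˡ (Σ-suc f) ⟨
    x * Σ f                               ∎

  Σ-punchIn : ∀ {n} (f : Fin (suc n) → Carrier) (a : Fin (suc n)) →
    Σ f ≈ f a + Σ (λ p → f (punchIn a p))
  Σ-punchIn f zero = Σ-suc f
  Σ-punchIn {suc n} f (suc a) = begin
    Σ f                                                       ≈⟨ Σ-suc f ⟩
    f zero + Σ (f ∘ suc)                                      ≈⟨ +-congˡ (Σ-punchIn (f ∘ suc) a) ⟩
    f zero + (f (suc a) + Σ (λ p → f (suc (punchIn a p))))    ≈⟨ x+[y+z]≈y+[x+z] _ _ _ ⟩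
    f (suc a) + (f zero + Σ (λ p → f (suc (punchIn a p))))    ≈⟨ +-congˡ (Σ-suc (λ p → f (punchIn (suc a) p))) ⟨
    f (suc a) + Σ (λ p → f (punchIn (suc a) p))               ∎
    where
    x+[y+z]≈y+[x+z] : ∀ x y z → x + (y + z) ≈ y + (x + z)
    x+[y+z]≈y+[x+z] = solve 3 (λ x y z → x :+ (y :+ z) := y :+ (x :+ z)) refl

  Σ-single : ∀ {n} (f : Fin n → Carrier) (j₀ : Fin n) → (∀ j → j ≢ j₀ → f j ≈ 0#) → Σ f ≈ f j₀
  Σ-single {suc n} f j₀ off = begin
    Σ f                                   ≈⟨ Σ-punchIn f j₀ ⟩
    f j₀ + Σ (λ p → f (punchIn j₀ p))     ≈⟨ +-congˡ (Σ-≈0 (λ p → off _ (FP.punchInᵢ≢i j₀ p))) ⟩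
    f j₀ + 0#                             ≈⟨ +-identityʳ _ ⟩
    f j₀                                  ∎

  Σ²-antisym : ∀ {n} (G : Fin n → Fin n → Carrier) →
    (∀ a b → G a b + G b a ≈ 0#) → (∀ a → G a a ≈ 0#) →
    Σ (λ a → Σ (λ b → G a b)) ≈ 0#
  Σ²-antisym {zero} G anti diag = refl
  Σ²-antisym {suc n} G anti diag = begin
    Σ (λ a → Σ (λ b → G a b))
      ≈⟨ Σ-suc (λ a → Σ (λ b → G a b)) ⟩
    Σ (λ b → G zero b) + Σ (λ a → Σ (λ b → G (suc a) b))
      ≈⟨ +-cong (Σ-suc (G zero)) (Σ-cong (λ a → Σ-suc (G (suc a)))) ⟩
    (G zero zero + Σ (λ b → G zero (suc b))) + Σ (λ a → G (suc a) zero + Σ (λ b → G (suc a) (suc b)))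
      ≈⟨ +-cong (+-congʳ (diag zero)) (Σ-distrib-+ (λ a → G (suc a) zero) (λ a → Σ (λ b → G (suc a) (suc b)))) ⟩
    (0# + Σ (λ b → G zero (suc b))) + (Σ (λ a → G (suc a) zero) + Σ (λ a → Σ (λ b → G (suc a) (suc b))))
      ≈⟨ +-congˡ (+-congˡ (Σ²-antisym (λ a b → G (suc a) (suc b)) (λ a b → anti (suc a) (suc b)) (diag ∘ suc))) ⟩
    (0# + Σ (λ b → G zero (suc b))) + (Σ (λ a → G (suc a) zero) + 0#)
      ≈⟨ drop-zeros _ _ ⟩
    Σ (λ b → G zero (suc b)) + Σ (λ a → G (suc a) zero)
      ≈⟨ Σ-distrib-+ (λ b → G zero (suc b)) (λ a → G (suc a) zero) ⟨
    Σ (λ b → G zero (suc b) + G (suc b) zero)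
      ≈⟨ Σ-≈0 (λ b → anti zero (suc b)) ⟩
    0# ∎
    where
    drop-zeros : ∀ x y → (0# + x) + (y + 0#) ≈ x + y
    drop-zeros = solve 2 (λ x y → (con 0 :+ x) :+ (y :+ con 0) := x :+ y) refl

  minor : ∀ {n} → Matrix (suc n) → Fin (suc n) → Matrix n
  minor M j a b = M (suc a) (punchIn j b)

  expansion-term : ∀ {n} → Matrix (suc n) → Fin (suc n) → Carrier
  expansion-term {n} M j = (alt (toℕ j) * M zero j) * det n (minor M j)

  det-cong : ∀ n {M N : Matrix n} → (∀ i j → M i j ≈ N i j) → det n M ≈ det n N
  det-cong zero eq = refl
  det-cong (suc n) eq =
    Σ-cong (λ j → *-cong (*-congˡ (eq zero j)) (det-cong n (λ a b → eq (suc a) (punchIn j b))))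

  det-zero-row : ∀ n (M : Matrix n) (r : Fin n) → (∀ j → M r j ≈ 0#) → det n M ≈ 0#
  det-zero-row (suc n) M zero row0 = Σ-≈0 (λ j → begin
    (alt (toℕ j) * M zero j) * det n (minor M j)  ≈⟨ *-congʳ (*-congˡ (row0 j)) ⟩
    (alt (toℕ j) * 0#) * det n (minor M j)        ≈⟨ *-congʳ (zeroʳ _) ⟩
    0# * det n (minor M j)                        ≈⟨ zeroˡ _ ⟩
    0#                                            ∎)
  det-zero-row (suc n) M (suc r) row0 = Σ-≈0 (λ j → begin
    (alt (toℕ j) * M zero j) * det n (minor M j)  ≈⟨ *-congˡ (det-zero-row n (minor M j) r (λ b → row0 (punchIn j b))) ⟩
    (alt (toℕ j) * M zero j) * 0#                 ≈⟨ zeroʳ _ ⟩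
    0#                                            ∎)

  det-zero-col : ∀ n (M : Matrix n) (c : Fin n) → (∀ i → M i c ≈ 0#) → det n M ≈ 0#
  det-zero-col (suc n) M c col0 = Σ-≈0 term≈0
    where
    term≈0 : ∀ j → expansion-term M j ≈ 0#
    term≈0 j with j F.≟ c
    ... | yes ≡.refl = begin
      (alt (toℕ j) * M zero j) * det n (minor M j)  ≈⟨ *-congʳ (*-congˡ (col0 zero)) ⟩
      (alt (toℕ j) * 0#) * det n (minor M j)        ≈⟨ *-congʳ (zeroʳ _) ⟩
      0# * det n (minor M j)                        ≈⟨ zeroˡ _ ⟩
      0#                                            ∎
    ... | no j≢c = begin
      (alt (toℕ j) * M zero j) * det n (minor M j)
        ≈⟨ *-congˡ (det-zero-col n (minor M j) (punchOut j≢c)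
             (λ a → trans (reflexive (≡.cong (M (suc a)) (FP.punchIn-punchOut j≢c))) (col0 (suc a)))) ⟩
      (alt (toℕ j) * M zero j) * 0#                 ≈⟨ zeroʳ _ ⟩
      0#                                            ∎

  det-linear-row : ∀ n (M A B : Matrix n) (r : Fin n) (x : Carrier) →
    (∀ i j → i ≢ r → M i j ≈ A i j) → (∀ i j → i ≢ r → M i j ≈ B i j) →
    (∀ j → M r j ≈ x * A r j + B r j) → det n M ≈ x * det n A + det n B
  det-linear-row (suc n) M A B zero x M≈A M≈B row = begin
    Σ (expansion-term M)
      ≈⟨ Σ-cong (λ j → *-cong (*-congˡ (row j)) (det-cong n (λ a b → M≈B (suc a) (punchIn j b) (λ ())))) ⟩
    Σ (λ j → (alt (toℕ j) * (x * A zero j + B zero j)) * det n (minor B j))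
      ≈⟨ Σ-cong (λ j → trans (expand _ _ _ _ _) (+-congʳ (*-congˡ (*-congˡ
           (det-cong n (λ a b → trans (sym (M≈B (suc a) (punchIn j b) (λ ()))) (M≈A (suc a) (punchIn j b) (λ ())))))))) ⟩
    Σ (λ j → x * expansion-term A j + expansion-term B j)
      ≈⟨ Σ-distrib-+ (λ j → x * expansion-term A j) (expansion-term B) ⟩
    Σ (λ j → x * expansion-term A j) + det (suc n) B
      ≈⟨ +-congʳ (Σ-factorˡ x (expansion-term A)) ⟩
    x * det (suc n) A + det (suc n) B ∎
    where
    expand : ∀ s x a b d → (s * (x * a + b)) * d ≈ x * ((s * a) * d) + (s * b) * d
    expand = solve 5 (λ s x a b d → (s :* (x :* a :+ b)) :* d := x :* ((s :* a) :* d) :+ (s :* b) :* d) refl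
  det-linear-row (suc n) M A B (suc r) x M≈A M≈B row = begin
    Σ (expansion-term M)
      ≈⟨ Σ-cong (λ j → *-congˡ (det-linear-row n (minor M j) (minor A j) (minor B j) r x
            (λ a b ne → M≈A (suc a) (punchIn j b) (ne ∘ FP.suc-injective))
            (λ a b ne → M≈B (suc a) (punchIn j b) (ne ∘ FP.suc-injective))
            (λ b → row (punchIn j b)))) ⟩
    Σ (λ j → (alt (toℕ j) * M zero j) * (x * det n (minor A j) + det n (minor B j)))
      ≈⟨ Σ-cong (λ j → trans (expand _ _ _ _ _) (+-cong (*-congˡ (*-congʳ (*-congˡ (M≈A zero j (λ ())))))
                                                          (*-congʳ (*-congˡ (M≈B zero j (λ ())))))) ⟩
    Σ (λ j → x * expansion-term A j + expansion-term B j)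
      ≈⟨ Σ-distrib-+ (λ j → x * expansion-term A j) (expansion-term B) ⟩
    Σ (λ j → x * expansion-term A j) + det (suc n) B
      ≈⟨ +-congʳ (Σ-factorˡ x (expansion-term A)) ⟩
    x * det (suc n) A + det (suc n) B ∎
    where
    expand : ∀ s m x da db → (s * m) * (x * da + db) ≈ x * ((s * m) * da) + (s * m) * db
    expand = solve 5 (λ s m x da db → (s :* m) :* (x :* da :+ db) := x :* ((s :* m) :* da) :+ (s :* m) :* db) refl

  punchOut-punchIn′ : ∀ {n} (a : Fin (suc n)) (p : Fin n) (a≢ : a ≢ punchIn a p) → punchOut a≢ ≡ p
  punchOut-punchIn′ a p a≢ = ≡.trans (FP.punchOut-cong a ≡.refl) (FP.punchOut-punchIn a)

  alt-punchOut-antisym : ∀ {n} (a b : Fin (suc n)) (a≢b : a ≢ b) (b≢a : b ≢ a) →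
    alt (toℕ a) * alt (toℕ (punchOut a≢b)) + alt (toℕ b) * alt (toℕ (punchOut b≢a)) ≈ 0#
  alt-punchOut-antisym zero zero a≢b b≢a = ⊥-elim (a≢b ≡.refl)
  alt-punchOut-antisym {suc n} zero (suc b) a≢b b≢a = begin
    1# * alt (toℕ b) + (- alt (toℕ b)) * 1#  ≈⟨ +-cong (*-identityˡ _) (*-identityʳ _) ⟩
    alt (toℕ b) + - alt (toℕ b)              ≈⟨ -‿inverseʳ _ ⟩
    0#                                       ∎
  alt-punchOut-antisym {suc n} (suc a) zero a≢b b≢a = begin
    (- alt (toℕ a)) * 1# + 1# * alt (toℕ a)  ≈⟨ +-cong (*-identityʳ _) (*-identityˡ _) ⟩
    - alt (toℕ a) + alt (toℕ a)              ≈⟨ -‿inverseˡ _ ⟩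
    0#                                       ∎
  alt-punchOut-antisym {suc n} (suc a) (suc b) a≢b b≢a = begin
    (- alt (toℕ a)) * (- alt (toℕ (punchOut a≢b′))) + (- alt (toℕ b)) * (- alt (toℕ (punchOut b≢a′)))
      ≈⟨ +-cong (-x*-y≈x*y _ _) (-x*-y≈x*y _ _) ⟩
    alt (toℕ a) * alt (toℕ (punchOut a≢b′)) + alt (toℕ b) * alt (toℕ (punchOut b≢a′))
      ≈⟨ alt-punchOut-antisym a b a≢b′ b≢a′ ⟩
    0# ∎
    where
    a≢b′ : a ≢ b
    a≢b′ = a≢b ∘ ≡.cong suc
    b≢a′ : b ≢ a
    b≢a′ = b≢a ∘ ≡.cong suc

  punchIn-punchOut-swap : ∀ {n} (a b : Fin (suc (suc n))) (a≢b : a ≢ b) (b≢a : b ≢ a) (y : Fin n) →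
    punchIn a (punchIn (punchOut a≢b) y) ≡ punchIn b (punchIn (punchOut b≢a) y)
  punchIn-punchOut-swap zero zero a≢b b≢a y = ⊥-elim (a≢b ≡.refl)
  punchIn-punchOut-swap zero (suc b) a≢b b≢a y = ≡.refl
  punchIn-punchOut-swap (suc a) zero a≢b b≢a y = ≡.refl
  punchIn-punchOut-swap {suc n} (suc a) (suc b) a≢b b≢a zero = ≡.refl
  punchIn-punchOut-swap {suc n} (suc a) (suc b) a≢b b≢a (suc y) =
    ≡.cong suc (punchIn-punchOut-swap a b (a≢b ∘ ≡.cong suc) (b≢a ∘ ≡.cong suc) y)

  -- Expanding along rows 0 and 1 at once: pairTerm M a b is the part of det M that uses
  -- the entries M 0 a and M 1 b.
  twoRowMinor : ∀ {n} → Matrix (suc (suc n)) → Fin (suc (suc n)) → Fin (suc n) → Carrier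
  twoRowMinor {n} M a p = det n (λ x y → M (suc (suc x)) (punchIn a (punchIn p y)))

  pairTerm : ∀ {n} → Matrix (suc (suc n)) → Fin (suc (suc n)) → Fin (suc (suc n)) → Carrier
  pairTerm M a b with a F.≟ b
  ... | yes _   = 0#
  ... | no a≢b  =
    (alt (toℕ a) * alt (toℕ (punchOut a≢b))) * (M zero a * M (suc zero) b) * twoRowMinor M a (punchOut a≢b)

  pairTerm-diag : ∀ {n} (M : Matrix (suc (suc n))) a → pairTerm M a a ≈ 0#
  pairTerm-diag M a with a F.≟ a
  ... | yes _   = refl
  ... | no a≢a  = ⊥-elim (a≢a ≡.refl)

  pairTerm-punchIn : ∀ {n} (M : Matrix (suc (suc n))) a p →
    (alt (toℕ a) * M zero a) * ((alt (toℕ p) * M (suc zero) (punchIn a p)) * twoRowMinor M a p)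
      ≈ pairTerm M a (punchIn a p)
  pairTerm-punchIn M a p with a F.≟ punchIn a p
  ... | yes eq = ⊥-elim (FP.punchInᵢ≢i a p (≡.sym eq))
  ... | no a≢  = begin
    (alt (toℕ a) * M zero a) * ((alt (toℕ p) * M (suc zero) (punchIn a p)) * twoRowMinor M a p)
      ≈⟨ regroup _ _ _ _ _ ⟩
    (alt (toℕ a) * alt (toℕ p)) * (M zero a * M (suc zero) (punchIn a p)) * twoRowMinor M a p
      ≈⟨ reflexive (≡.cong (λ p′ → (alt (toℕ a) * alt (toℕ p′)) * (M zero a * M (suc zero) (punchIn a p)) * twoRowMinor M a p′)
                           (≡.sym (punchOut-punchIn′ a p a≢))) ⟩
    (alt (toℕ a) * alt (toℕ (punchOut a≢))) * (M zero a * M (suc zero) (punchIn a p)) * twoRowMinor M a (punchOut a≢) ∎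
    where
    regroup : ∀ s m₀ t m₁ d → (s * m₀) * ((t * m₁) * d) ≈ (s * t) * (m₀ * m₁) * d
    regroup = solve 5 (λ s m₀ t m₁ d → (s :* m₀) :* ((t :* m₁) :* d) := (s :* t) :* (m₀ :* m₁) :* d) refl

  det-expand-two-rows : ∀ {n} (M : Matrix (suc (suc n))) → det (suc (suc n)) M ≈ Σ (λ a → Σ (λ b → pairTerm M a b))
  det-expand-two-rows {n} M = Σ-cong (λ a → begin
    (alt (toℕ a) * M zero a) * Σ (λ p → (alt (toℕ p) * M (suc zero) (punchIn a p)) * twoRowMinor M a p)
      ≈⟨ Σ-factorˡ _ (λ p → (alt (toℕ p) * M (suc zero) (punchIn a p)) * twoRowMinor M a p) ⟨
    Σ (λ p → (alt (toℕ a) * M zero a) * ((alt (toℕ p) * M (suc zero) (punchIn a p)) * twoRowMinor M a p))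
      ≈⟨ Σ-cong (pairTerm-punchIn M a) ⟩
    Σ (λ p → pairTerm M a (punchIn a p))                    ≈⟨ +-identityˡ _ ⟨
    0# + Σ (λ p → pairTerm M a (punchIn a p))               ≈⟨ +-congʳ (pairTerm-diag M a) ⟨
    pairTerm M a a + Σ (λ p → pairTerm M a (punchIn a p))   ≈⟨ Σ-punchIn (pairTerm M a) a ⟨
    Σ (λ b → pairTerm M a b)                                ∎)

  twoRowMinor-swap : ∀ {n} (M : Matrix (suc (suc n))) (a b : Fin (suc (suc n))) (a≢b : a ≢ b) (b≢a : b ≢ a) →
    twoRowMinor M b (punchOut b≢a) ≈ twoRowMinor M a (punchOut a≢b)
  twoRowMinor-swap {n} M a b a≢b b≢a =
    det-cong n (λ x y → reflexive (≡.cong (M (suc (suc x))) (≡.sym (punchIn-punchOut-swap a b a≢b b≢a y))))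

  swap01 : ∀ {n} → Fin (suc (suc n)) → Fin (suc (suc n))
  swap01 zero = suc zero
  swap01 (suc zero) = zero
  swap01 (suc (suc x)) = suc (suc x)

  swapRows01 : ∀ {n} → Matrix (suc (suc n)) → Matrix (suc (suc n))
  swapRows01 M i = M (swap01 i)

  pairTerm-swapRows01-antisym : ∀ {n} (M : Matrix (suc (suc n))) a b →
    (pairTerm (swapRows01 M) a b + pairTerm M a b) + (pairTerm (swapRows01 M) b a + pairTerm M b a) ≈ 0#
  pairTerm-swapRows01-antisym M a b with a F.≟ b | b F.≟ a
  ... | yes _   | yes _   = trans (+-cong (+-identityˡ 0#) (+-identityˡ 0#)) (+-identityˡ 0#)
  ... | yes a≡b | no b≢a  = ⊥-elim (b≢a (≡.sym a≡b))
  ... | no a≢b  | yes b≡a = ⊥-elim (a≢b (≡.sym b≡a))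
  ... | no a≢b  | no b≢a  = begin
    s * (M (suc zero) a * M zero b) * d + s * (M zero a * M (suc zero) b) * d
      + (s′ * (M (suc zero) b * M zero a) * d′ + s′ * (M zero b * M (suc zero) a) * d′)
      ≈⟨ +-congˡ (+-cong (*-congˡ (twoRowMinor-swap M a b a≢b b≢a)) (*-congˡ (twoRowMinor-swap M a b a≢b b≢a))) ⟩
    s * (M (suc zero) a * M zero b) * d + s * (M zero a * M (suc zero) b) * d
      + (s′ * (M (suc zero) b * M zero a) * d + s′ * (M zero b * M (suc zero) a) * d)
      ≈⟨ collect _ _ _ _ _ _ _ ⟩
    (s + s′) * ((M (suc zero) a * M zero b + M zero a * M (suc zero) b) * d)
      ≈⟨ *-congʳ (alt-punchOut-antisym a b a≢b b≢a) ⟩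
    0# * ((M (suc zero) a * M zero b + M zero a * M (suc zero) b) * d)
      ≈⟨ zeroˡ _ ⟩
    0# ∎
    where
    s s′ d d′ : Carrier
    s  = alt (toℕ a) * alt (toℕ (punchOut a≢b))
    s′ = alt (toℕ b) * alt (toℕ (punchOut b≢a))
    d  = twoRowMinor M a (punchOut a≢b)
    d′ = twoRowMinor M b (punchOut b≢a)
    collect : ∀ s s′ m₀a m₁a m₀b m₁b d →
      s * (m₁a * m₀b) * d + s * (m₀a * m₁b) * d + (s′ * (m₁b * m₀a) * d + s′ * (m₀b * m₁a) * d)
        ≈ (s + s′) * ((m₁a * m₀b + m₀a * m₁b) * d)
    collect = solve 7 (λ s s′ m₀a m₁a m₀b m₁b d →
      s :* (m₁a :* m₀b) :* d :+ s :* (m₀a :* m₁b) :* d :+ (s′ :* (m₁b :* m₀a) :* d :+ s′ :* (m₀b :* m₁a) :* d)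
        := (s :+ s′) :* ((m₁a :* m₀b :+ m₀a :* m₁b) :* d)) refl

  det-swapRows01 : ∀ {n} (M : Matrix (suc (suc n))) → det (suc (suc n)) (swapRows01 M) + det (suc (suc n)) M ≈ 0#
  det-swapRows01 {n} M = begin
    det (suc (suc n)) (swapRows01 M) + det (suc (suc n)) M
      ≈⟨ +-cong (det-expand-two-rows (swapRows01 M)) (det-expand-two-rows M) ⟩
    Σ (λ a → Σ (λ b → pairTerm (swapRows01 M) a b)) + Σ (λ a → Σ (λ b → pairTerm M a b))
      ≈⟨ Σ-distrib-+ (λ a → Σ (λ b → pairTerm (swapRows01 M) a b)) (λ a → Σ (λ b → pairTerm M a b)) ⟨
    Σ (λ a → Σ (λ b → pairTerm (swapRows01 M) a b) + Σ (λ b → pairTerm M a b))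
      ≈⟨ Σ-cong (λ a → sym (Σ-distrib-+ (pairTerm (swapRows01 M) a) (pairTerm M a))) ⟩
    Σ (λ a → Σ (λ b → pairTerm (swapRows01 M) a b + pairTerm M a b))
      ≈⟨ Σ²-antisym (λ a b → pairTerm (swapRows01 M) a b + pairTerm M a b) (pairTerm-swapRows01-antisym M) diag ⟩
    0# ∎
    where
    diag : ∀ a → pairTerm (swapRows01 M) a a + pairTerm M a a ≈ 0#
    diag a = trans (+-cong (pairTerm-diag (swapRows01 M) a) (pairTerm-diag M a)) (+-identityˡ 0#)

  det-equalRows01 : ∀ {n} (M : Matrix (suc (suc n))) → (∀ j → M zero j ≈ M (suc zero) j) → det (suc (suc n)) M ≈ 0#
  det-equalRows01 {n} M rows≈ = trans (det-expand-two-rows M) (Σ²-antisym (pairTerm M) anti (pairTerm-diag M))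
    where
    collect : ∀ s s′ x y d → s * (x * y) * d + s′ * (y * x) * d ≈ (s + s′) * (x * y * d)
    collect = solve 5 (λ s s′ x y d → s :* (x :* y) :* d :+ s′ :* (y :* x) :* d := (s :+ s′) :* (x :* y :* d)) refl
    anti : ∀ a b → pairTerm M a b + pairTerm M b a ≈ 0#
    anti a b with a F.≟ b | b F.≟ a
    ... | yes _   | yes _   = +-identityˡ 0#
    ... | yes a≡b | no b≢a  = ⊥-elim (b≢a (≡.sym a≡b))
    ... | no a≢b  | yes b≡a = ⊥-elim (a≢b (≡.sym b≡a))
    ... | no a≢b  | no b≢a  = begin
      s * (M zero a * M (suc zero) b) * d + s′ * (M zero b * M (suc zero) a) * d′
        ≈⟨ +-cong (*-congʳ (*-congˡ (*-congˡ (sym (rows≈ b))))) (*-cong (*-congˡ (*-congˡ (sym (rows≈ a)))) (twoRowMinor-swap M a b a≢b b≢a)) ⟩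
      s * (M zero a * M zero b) * d + s′ * (M zero b * M zero a) * d
        ≈⟨ collect _ _ _ _ _ ⟩
      (s + s′) * (M zero a * M zero b * d)
        ≈⟨ *-congʳ (alt-punchOut-antisym a b a≢b b≢a) ⟩
      0# * (M zero a * M zero b * d)
        ≈⟨ zeroˡ _ ⟩
      0# ∎
      where
      s s′ d d′ : Carrier
      s  = alt (toℕ a) * alt (toℕ (punchOut a≢b))
      s′ = alt (toℕ b) * alt (toℕ (punchOut b≢a))
      d  = twoRowMinor M a (punchOut a≢b)
      d′ = twoRowMinor M b (punchOut b≢a)

  det-equalRows< : ∀ n (M : Matrix n) (r s : Fin n) → toℕ r ℕ.< toℕ s → (∀ j → M r j ≈ M s j) → det n M ≈ 0#
  det-equalRows< (suc n) M zero (suc zero) _ rows≈ = det-equalRows01 M rows≈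
  det-equalRows< (suc n) M zero (suc (suc s)) _ rows≈ = begin
    det (suc n) M                   ≈⟨ +-inverseʳ-unique _ _ (det-swapRows01 M) ⟩
    - det (suc n) (swapRows01 M)    ≈⟨ -‿cong (equalRowsBelow (swapRows01 M) zero (suc s) (ℕ.s≤s ℕ.z≤n) rows≈) ⟩
    - 0#                            ≈⟨ -0#≈0# ⟩
    0#                              ∎
    where
    equalRowsBelow : ∀ (M : Matrix (suc n)) (r s : Fin n) → toℕ r ℕ.< toℕ s →
      (∀ j → M (suc r) j ≈ M (suc s) j) → det (suc n) M ≈ 0#
    equalRowsBelow M r s r<s rows≈ =
      Σ-≈0 (λ j → trans (*-congˡ (det-equalRows< n (minor M j) r s r<s (λ b → rows≈ (punchIn j b)))) (zeroʳ _))
  det-equalRows< (suc n) M (suc r) (suc s) r<s rows≈ =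
    Σ-≈0 (λ j → trans (*-congˡ (det-equalRows< n (minor M j) r s (ℕ.s≤s⁻¹ r<s) (λ b → rows≈ (punchIn j b)))) (zeroʳ _))

  det-equalRows : ∀ n (M : Matrix n) (r s : Fin n) → r ≢ s → (∀ j → M r j ≈ M s j) → det n M ≈ 0#
  det-equalRows n M r s r≢s rows≈ with ℕ.<-cmp (toℕ r) (toℕ s)
  ... | tri< r<s _ _ = det-equalRows< n M r s r<s rows≈
  ... | tri≈ _ r≡s _ = ⊥-elim (r≢s (FP.toℕ-injective r≡s))
  ... | tri> _ _ s<r = det-equalRows< n M s r s<r (λ j → sym (rows≈ j))

  replaceRow : ∀ {n} → Matrix n → Fin n → Fin n → Matrix n
  replaceRow M r s i with i F.≟ r
  ... | yes _ = M s
  ... | no _  = M i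

  replaceRow-≡ : ∀ {n} (M : Matrix n) r s j → replaceRow M r s r j ≡ M s j
  replaceRow-≡ M r s j with r F.≟ r
  ... | yes _  = ≡.refl
  ... | no r≢r = ⊥-elim (r≢r ≡.refl)

  replaceRow-≢ : ∀ {n} (M : Matrix n) r s i j → i ≢ r → replaceRow M r s i j ≡ M i j
  replaceRow-≢ M r s i j i≢r with i F.≟ r
  ... | yes i≡r = ⊥-elim (i≢r i≡r)
  ... | no _    = ≡.refl

  det-addRowMultiple : ∀ n (M M′ : Matrix n) (r s : Fin n) (x : Carrier) → r ≢ s →
    (∀ i j → i ≢ r → M′ i j ≈ M i j) → (∀ j → M′ r j ≈ M r j + x * M s j) → det n M′ ≈ det n M
  det-addRowMultiple n M M′ r s x r≢s others row = begin
    det n M′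
      ≈⟨ det-linear-row n M′ (replaceRow M r s) M r x
           (λ i j i≢r → trans (others i j i≢r) (reflexive (≡.sym (replaceRow-≢ M r s i j i≢r))))
           others
           (λ j → trans (row j) (trans (+-comm _ _) (+-congʳ (*-congˡ (reflexive (≡.sym (replaceRow-≡ M r s j))))))) ⟩
    x * det n (replaceRow M r s) + det n M
      ≈⟨ +-congʳ (*-congˡ (det-equalRows n (replaceRow M r s) r s r≢s
           (λ j → reflexive (≡.trans (replaceRow-≡ M r s j) (≡.sym (replaceRow-≢ M r s s j (r≢s ∘ ≡.sym))))))) ⟩
    x * 0# + det n M   ≈⟨ +-congʳ (zeroʳ x) ⟩
    0# + det n M       ≈⟨ +-identityˡ _ ⟩
    det n M            ∎

  punchIn-fromℕ : ∀ {m} (b : Fin m) → punchIn (fromℕ m) b ≡ inject₁ b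
  punchIn-fromℕ {suc m} zero = ≡.refl
  punchIn-fromℕ {suc m} (suc b) = ≡.cong suc (punchIn-fromℕ b)

  punchIn-inject₁-fromℕ : ∀ {m} (j : Fin (suc m)) → punchIn (inject₁ j) (fromℕ m) ≡ fromℕ (suc m)
  punchIn-inject₁-fromℕ zero = ≡.refl
  punchIn-inject₁-fromℕ {suc m} (suc j) = ≡.cong suc (punchIn-inject₁-fromℕ j)

  punchIn-inject₁ : ∀ {m} (j : Fin (suc m)) (b : Fin m) → punchIn (inject₁ j) (inject₁ b) ≡ inject₁ (punchIn j b)
  punchIn-inject₁ zero b = ≡.refl
  punchIn-inject₁ (suc j) zero = ≡.refl
  punchIn-inject₁ (suc j) (suc b) = ≡.cong suc (punchIn-inject₁ j b)

  toℕ-punchIn-≤ : ∀ {m} (i : Fin (suc m)) (b : Fin m) → toℕ (punchIn i b) ℕ.≤ suc (toℕ b)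
  toℕ-punchIn-≤ zero b = NP.≤-refl
  toℕ-punchIn-≤ (suc i) zero = ℕ.z≤n
  toℕ-punchIn-≤ (suc i) (suc b) = ℕ.s≤s (toℕ-punchIn-≤ i b)

  Σ-init-last : ∀ {m} (f : Fin (suc m) → Carrier) → Σ f ≈ Σ (f ∘ inject₁) + f (fromℕ m)
  Σ-init-last {zero} f = trans (Σ-suc f) (trans (+-identityʳ _) (sym (+-identityˡ _)))
  Σ-init-last {suc m} f = begin
    Σ f                                                    ≈⟨ Σ-suc f ⟩
    f zero + Σ (f ∘ suc)                                   ≈⟨ +-congˡ (Σ-init-last (f ∘ suc)) ⟩
    f zero + (Σ (f ∘ suc ∘ inject₁) + f (fromℕ (suc m)))   ≈⟨ +-assoc _ _ _ ⟨
    (f zero + Σ (f ∘ suc ∘ inject₁)) + f (fromℕ (suc m))   ≈⟨ +-congʳ (Σ-suc (f ∘ inject₁)) ⟨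
    Σ (f ∘ inject₁) + f (fromℕ (suc m))                    ∎

  topLeft : ∀ {n} → Matrix (suc n) → Matrix n
  topLeft M a b = M (inject₁ a) (inject₁ b)

  det-unitLastRow : ∀ n (M : Matrix (suc n)) → M (fromℕ n) (fromℕ n) ≈ 1# →
    (∀ j → toℕ j ℕ.< n → M (fromℕ n) j ≈ 0#) → det (suc n) M ≈ det n (topLeft M)
  det-unitLastRow zero M corner _ = begin
    (1# * M zero zero) * 1# + 0#   ≈⟨ +-identityʳ _ ⟩
    (1# * M zero zero) * 1#        ≈⟨ trans (*-identityʳ _) (*-identityˡ _) ⟩
    M zero zero                    ≈⟨ corner ⟩
    1#                             ∎
  det-unitLastRow (suc n) M corner row0 = begin
    det (suc (suc n)) M
      ≈⟨ Σ-init-last (expansion-term M) ⟩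
    Σ (expansion-term M ∘ inject₁) + expansion-term M (fromℕ (suc n))
      ≈⟨ +-cong (Σ-cong term) (trans (*-congˡ lastMinor≈0) (zeroʳ _)) ⟩
    Σ (expansion-term (topLeft M)) + 0#
      ≈⟨ +-identityʳ _ ⟩
    det (suc n) (topLeft M) ∎
    where
    lastMinor≈0 : det (suc n) (minor M (fromℕ (suc n))) ≈ 0#
    lastMinor≈0 = det-zero-row (suc n) (minor M (fromℕ (suc n))) (fromℕ n)
      (λ b → trans (reflexive (≡.cong (M (fromℕ (suc n))) (punchIn-fromℕ b)))
               (row0 (inject₁ b) (≡.subst (ℕ._< suc n) (≡.sym (FP.toℕ-inject₁ b)) (FP.toℕ<n b))))
    term : ∀ j → expansion-term M (inject₁ j) ≈ expansion-term (topLeft M) j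
    term j = *-cong (*-congʳ (reflexive (≡.cong alt (FP.toℕ-inject₁ j))))
      (trans (det-unitLastRow n (minor M (inject₁ j))
                (trans (reflexive (≡.cong (M (fromℕ (suc n))) (punchIn-inject₁-fromℕ j))) corner)
                (λ b b<n → row0 (punchIn (inject₁ j) b) (ℕ.s≤s (NP.≤-trans (toℕ-punchIn-≤ (inject₁ j) b) b<n))))
             (det-cong n (λ a b → reflexive (≡.cong (M (suc (inject₁ a))) (punchIn-inject₁ j b)))))

  det-linear-corner : ∀ m (M M′ : Matrix (suc m)) →
    (∀ j → M zero (inject₁ j) ≈ M′ zero (inject₁ j)) → (∀ a b → M (suc a) b ≈ M′ (suc a) b) →
    M′ zero (fromℕ m) ≈ 0# →
    det (suc m) M ≈ det (suc m) M′ + (alt m * M zero (fromℕ m)) * det m (minor M (fromℕ m))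
  det-linear-corner m M M′ row0≈ rows≈ corner′≈0 = begin
    det (suc m) M
      ≈⟨ Σ-init-last (expansion-term M) ⟩
    Σ (expansion-term M ∘ inject₁) + expansion-term M (fromℕ m)
      ≈⟨ +-congʳ (Σ-cong (λ j → *-cong (*-congˡ (row0≈ j)) (det-cong m (λ a b → rows≈ a _)))) ⟩
    Σ (expansion-term M′ ∘ inject₁) + expansion-term M (fromℕ m)
      ≈⟨ +-congʳ (+-identityʳ _) ⟨
    (Σ (expansion-term M′ ∘ inject₁) + 0#) + expansion-term M (fromℕ m)
      ≈⟨ +-congʳ (+-congˡ lastTerm′≈0) ⟨
    (Σ (expansion-term M′ ∘ inject₁) + expansion-term M′ (fromℕ m)) + expansion-term M (fromℕ m)
      ≈⟨ +-cong (sym (Σ-init-last (expansion-term M′))) (*-congʳ (*-congʳ (reflexive (≡.cong alt (FP.toℕ-fromℕ m))))) ⟩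
    det (suc m) M′ + (alt m * M zero (fromℕ m)) * det m (minor M (fromℕ m)) ∎
    where
    lastTerm′≈0 : expansion-term M′ (fromℕ m) ≈ 0#
    lastTerm′≈0 = trans (*-congʳ (trans (*-congˡ corner′≈0) (zeroʳ _))) (zeroˡ _)


module FieldLemmas {c ℓ q} (F : Defs.FiniteField c ℓ q) where

  open import Data.Product using (_,_; proj₁; proj₂)
  open import Data.Nat using (ℕ)
  open import Data.Bool using (Bool)
  open import Relation.Nullary using (¬_; yes; no; does)
  open import Data.Empty using (⊥-elim)

  open Defs.FiniteField F using (commRing; _≟_; 0≉1; inverse)
  open CommutativeRing commRing hiding (zero)
  open import Relation.Binary.Reasoning.Setoid setoid
  open import Algebra.Solver.Ring.NaturalCoefficients.Default commutativeSemiring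

  1≉0 : ¬ (1# ≈ 0#)
  1≉0 1≈0 = 0≉1 (sym 1≈0)

  *-cancelˡ-≈0 : ∀ p x → ¬ (p ≈ 0#) → p * x ≈ 0# → x ≈ 0#
  *-cancelˡ-≈0 p x p≉0 px≈0 with inverse p p≉0
  ... | y , py≈1 = begin
    x              ≈⟨ *-identityˡ x ⟨
    1# * x         ≈⟨ *-congʳ py≈1 ⟨
    (p * y) * x    ≈⟨ solve 3 (λ p y x → (p :* y) :* x := y :* (p :* x)) refl p y x ⟩
    y * (p * x)    ≈⟨ *-congˡ px≈0 ⟩
    y * 0#         ≈⟨ zeroʳ y ⟩
    0#             ∎

  *-≈0ˡ : ∀ {a} x → a ≈ 0# → a * x ≈ 0#
  *-≈0ˡ x a≈0 = trans (*-congʳ a≈0) (zeroˡ x)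

  *-≈0ʳ : ∀ {a} x → a ≈ 0# → x * a ≈ 0#
  *-≈0ʳ x a≈0 = trans (*-congˡ a≈0) (zeroʳ x)

  +-≈0 : ∀ {a b} → a ≈ 0# → b ≈ 0# → a + b ≈ 0#
  +-≈0 a≈0 b≈0 = trans (+-cong a≈0 b≈0) (+-identityˡ 0#)

  -- Opaque: otherwise the with-abstractions over X 0 ≟ 0# in PadeRelations.hasRelation also
  -- rewrite the copy of that test hidden inside (X 0) ⁻¹.
  opaque
    _⁻¹ : Carrier → Carrier
    x ⁻¹ with x ≟ 0#
    ... | yes _   = 0#
    ... | no x≉0  = proj₁ (inverse x x≉0)

    x*x⁻¹≈1 : ∀ x → ¬ (x ≈ 0#) → x * x ⁻¹ ≈ 1#
    x*x⁻¹≈1 x x≉0 with x ≟ 0#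
    ... | yes x≈0  = ⊥-elim (x≉0 x≈0)
    ... | no x≉0′  = proj₂ (inverse x x≉0′)

  x⁻¹*x≈1 : ∀ x → ¬ (x ≈ 0#) → x ⁻¹ * x ≈ 1#
  x⁻¹*x≈1 x x≉0 = trans (*-comm _ _) (x*x⁻¹≈1 x x≉0)

  ⁻¹-≉0 : ∀ x → ¬ (x ≈ 0#) → ¬ (x ⁻¹ ≈ 0#)
  ⁻¹-≉0 x x≉0 x⁻¹≈0 = 1≉0 (trans (sym (x*x⁻¹≈1 x x≉0)) (*-≈0ʳ x x⁻¹≈0))

  r+a[a⁻¹[u-r]]≈u : ∀ r a → ¬ (a ≈ 0#) → ∀ u → r + a * (a ⁻¹ * (u + (- r))) ≈ u
  r+a[a⁻¹[u-r]]≈u r a a≉0 u = begin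
    r + a * (a ⁻¹ * (u + (- r)))  ≈⟨ +-congˡ (sym (*-assoc _ _ _)) ⟩
    r + (a * a ⁻¹) * (u + (- r))  ≈⟨ +-congˡ (*-congʳ (x*x⁻¹≈1 a a≉0)) ⟩
    r + 1# * (u + (- r))          ≈⟨ +-congˡ (*-identityˡ _) ⟩
    r + (u + (- r))               ≈⟨ +-congˡ (+-comm _ _) ⟩
    r + ((- r) + u)               ≈⟨ sym (+-assoc _ _ _) ⟩
    (r + (- r)) + u               ≈⟨ +-congʳ (-‿inverseʳ r) ⟩
    0# + u                        ≈⟨ +-identityˡ u ⟩
    u                             ∎

  a⁻¹[[r+at]-r]≈t : ∀ r a → ¬ (a ≈ 0#) → ∀ t → a ⁻¹ * ((r + a * t) + (- r)) ≈ t
  a⁻¹[[r+at]-r]≈t r a a≉0 t = begin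
    a ⁻¹ * ((r + a * t) + (- r))  ≈⟨ *-congˡ (+-congʳ (+-comm _ _)) ⟩
    a ⁻¹ * ((a * t + r) + (- r))  ≈⟨ *-congˡ (+-assoc _ _ _) ⟩
    a ⁻¹ * (a * t + (r + (- r)))  ≈⟨ *-congˡ (+-congˡ (-‿inverseʳ r)) ⟩
    a ⁻¹ * (a * t + 0#)           ≈⟨ *-congˡ (+-identityʳ _) ⟩
    a ⁻¹ * (a * t)                ≈⟨ sym (*-assoc _ _ _) ⟩
    (a ⁻¹ * a) * t                ≈⟨ *-congʳ (x⁻¹*x≈1 a a≉0) ⟩
    1# * t                        ≈⟨ *-identityˡ t ⟩
    t                             ∎

  Series : Set c
  Series = ℕ → Carrier

  isZero : Carrier → Bool
  isZero x = does (x ≟ 0#)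


module Kernel {c ℓ q} (F : Defs.FiniteField c ℓ q) where

  open import Level using (_⊔_)
  open import Data.Nat as ℕ using (ℕ; zero; suc)
  open import Data.Fin using (Fin; zero; suc; toℕ; fromℕ<)
  import Data.Fin.Properties as FP
  import Data.Nat.Properties as NP
  open import Data.Product using (∃; _×_; _,_)
  open import Relation.Binary.PropositionalEquality as ≡ using (_≡_; _≢_)
  open import Relation.Nullary using (¬_; yes; no)
  open import Data.Empty using (⊥-elim; ⊥)
  open import Function using (_∘_)

  open Defs.FiniteField F using (commRing; _≟_)
  open CommutativeRing commRing hiding (zero)
  open Defs.Det commRing
  open Determinant commRing
  open FieldLemmas F
  open import Relation.Binary.Reasoning.Setoid setoid
  open import Algebra.Solver.Ring.NaturalCoefficients.Default commutativeSemiring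
  open import Algebra.Properties.Ring ring using (-‿distribˡ-*; -‿distribʳ-*)

  NonzeroVec : ∀ {n} → (Fin n → Carrier) → Set ℓ
  NonzeroVec v = ∃ λ j → ¬ (v j ≈ 0#)

  Annihilates : ∀ {n} → Matrix n → (Fin n → Carrier) → Set ℓ
  Annihilates M v = ∀ i → Σ (λ j → M i j * v j) ≈ 0#

  Σ-rowCombination : ∀ {n} (A B v : Fin n → Carrier) (x : Carrier) →
    Σ (λ j → (A j + x * B j) * v j) ≈ Σ (λ j → A j * v j) + x * Σ (λ j → B j * v j)
  Σ-rowCombination A B v x = begin
    Σ (λ j → (A j + x * B j) * v j)                    ≈⟨ Σ-cong (λ j → expand (A j) x (B j) (v j)) ⟩
    Σ (λ j → A j * v j + x * (B j * v j))              ≈⟨ Σ-distrib-+ (λ j → A j * v j) (λ j → x * (B j * v j)) ⟩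
    Σ (λ j → A j * v j) + Σ (λ j → x * (B j * v j))    ≈⟨ +-congˡ (Σ-factorˡ x (λ j → B j * v j)) ⟩
    Σ (λ j → A j * v j) + x * Σ (λ j → B j * v j)      ∎
    where
    expand : ∀ a x b v → (a + x * b) * v ≈ a * v + x * (b * v)
    expand = solve 4 (λ a x b v → (a :+ x :* b) :* v := a :* v :+ x :* (b :* v)) refl

  -- allRows adds coef a times row 0 to row a+1 for every a; firstRows k does this only for
  -- a < k, so that det allRows ≈ det M follows one row operation at a time.
  module AddToLowerRows {n : ℕ} (M : Matrix (suc n)) (coef : Fin n → Carrier) where

    firstRows : ℕ → Matrix (suc n)
    firstRows k zero j = M zero j
    firstRows k (suc a) j with toℕ a ℕ.<? k
    ... | yes _ = M (suc a) j + coef a * M zero j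
    ... | no _  = M (suc a) j

    allRows : Matrix (suc n)
    allRows zero j = M zero j
    allRows (suc a) j = M (suc a) j + coef a * M zero j

    firstRows-0 : ∀ i j → firstRows 0 i j ≈ M i j
    firstRows-0 zero j = refl
    firstRows-0 (suc a) j with toℕ a ℕ.<? 0
    ... | yes ()
    ... | no _ = refl

    firstRows-all : ∀ k → n ℕ.≤ k → ∀ i j → firstRows k i j ≈ allRows i j
    firstRows-all k n≤k zero j = refl
    firstRows-all k n≤k (suc a) j with toℕ a ℕ.<? k
    ... | yes _  = refl
    ... | no a≮k = ⊥-elim (a≮k (NP.<-≤-trans (FP.toℕ<n a) n≤k))

    det-firstRows-step : ∀ k → det (suc n) (firstRows (suc k)) ≈ det (suc n) (firstRows k)
    det-firstRows-step k with k ℕ.<? n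
    ... | yes k<n = det-addRowMultiple (suc n) (firstRows k) (firstRows (suc k)) (suc a) zero (coef a) (λ ()) others row
      where
      a = fromℕ< k<n
      toℕa≡k : toℕ a ≡ k
      toℕa≡k = FP.toℕ-fromℕ< k<n
      others : ∀ i j → i ≢ suc a → firstRows (suc k) i j ≈ firstRows k i j
      others zero j _ = refl
      others (suc a′) j a′≢a with toℕ a′ ℕ.<? suc k | toℕ a′ ℕ.<? k
      ... | yes _    | yes _    = refl
      ... | no _     | no _     = refl
      ... | no a′≮k+1 | yes a′<k = ⊥-elim (a′≮k+1 (NP.m<n⇒m<1+n a′<k))
      ... | yes a′<k+1 | no a′≮k = ⊥-elim (a′≢a (≡.cong suc (FP.toℕ-injective (≡.trans a′≡k (≡.sym toℕa≡k)))))
        where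
        a′≡k : toℕ a′ ≡ k
        a′≡k = NP.≤-antisym (ℕ.s≤s⁻¹ a′<k+1) (NP.≮⇒≥ a′≮k)
      row : ∀ j → firstRows (suc k) (suc a) j ≈ firstRows k (suc a) j + coef a * firstRows k zero j
      row j with toℕ a ℕ.<? suc k | toℕ a ℕ.<? k
      ... | yes _     | no _  = refl
      ... | no a≮k+1  | _     = ⊥-elim (a≮k+1 (NP.≤-reflexive (≡.cong suc toℕa≡k)))
      ... | yes _     | yes a<k = ⊥-elim (NP.<-irrefl toℕa≡k a<k)
    ... | no k≮n = det-cong (suc n) (λ i j → trans (firstRows-all (suc k) (NP.m≤n⇒m≤1+n (NP.≮⇒≥ k≮n)) i j)
                                                   (sym (firstRows-all k (NP.≮⇒≥ k≮n) i j)))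

    det-firstRows : ∀ k → det (suc n) (firstRows k) ≈ det (suc n) M
    det-firstRows zero = det-cong (suc n) firstRows-0
    det-firstRows (suc k) = trans (det-firstRows-step k) (det-firstRows k)

    det-allRows : det (suc n) allRows ≈ det (suc n) M
    det-allRows = trans (det-cong (suc n) (λ i j → sym (firstRows-all n NP.≤-refl i j))) (det-firstRows n)

  det-minor-zeroColumn : ∀ {n} (M : Matrix (suc n)) (j : Fin n) → (∀ a → M (suc a) zero ≈ 0#) →
    det n (minor M (suc j)) ≈ 0#
  det-minor-zeroColumn {suc n} M j col≈0 = det-zero-col (suc n) (minor M (suc j)) zero col≈0

  module Pivot {n : ℕ} (M : Matrix (suc n)) (pivot≉0 : ¬ (M zero zero ≈ 0#)) where

    pivot : Carrier
    pivot = M zero zero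

    coef : Fin n → Carrier
    coef a = - (M (suc a) zero * pivot ⁻¹)

    open AddToLowerRows M coef public

    reduced : Matrix n
    reduced a b = allRows (suc a) (suc b)

    column0-cleared : ∀ a → allRows (suc a) zero ≈ 0#
    column0-cleared a = begin
      M (suc a) zero + - (M (suc a) zero * pivot ⁻¹) * pivot  ≈⟨ +-congˡ (*-congʳ (-‿distribˡ-* _ _)) ⟩
      M (suc a) zero + (- M (suc a) zero * pivot ⁻¹) * pivot  ≈⟨ +-congˡ (regroup _ _ _) ⟩
      M (suc a) zero + (- M (suc a) zero) * (pivot * pivot ⁻¹) ≈⟨ +-congˡ (*-congˡ (x*x⁻¹≈1 pivot pivot≉0)) ⟩
      M (suc a) zero + (- M (suc a) zero) * 1#                ≈⟨ +-congˡ (*-identityʳ _) ⟩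
      M (suc a) zero + - M (suc a) zero                       ≈⟨ -‿inverseʳ _ ⟩
      0#                                                      ∎
      where
      regroup : ∀ x y z → (x * y) * z ≈ x * (z * y)
      regroup = solve 3 (λ x y z → (x :* y) :* z := x :* (z :* y)) refl

    det≈pivot*det-reduced : det (suc n) M ≈ pivot * det n reduced
    det≈pivot*det-reduced = begin
      det (suc n) M                ≈⟨ det-allRows ⟨
      det (suc n) allRows          ≈⟨ Σ-single (expansion-term allRows) zero offPivot ⟩
      (1# * pivot) * det n reduced ≈⟨ *-congʳ (*-identityˡ pivot) ⟩
      pivot * det n reduced        ∎
      where
      offPivot : ∀ j → j ≢ zero → expansion-term allRows j ≈ 0#
      offPivot zero j≢0 = ⊥-elim (j≢0 ≡.refl)
      offPivot (suc j) _ = *-≈0ʳ _ (det-minor-zeroColumn allRows j column0-cleared)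

    annihilates-allRows : ∀ v → Annihilates M v → Annihilates allRows v
    annihilates-allRows v Mv≈0 zero = Mv≈0 zero
    annihilates-allRows v Mv≈0 (suc a) = begin
      Σ (λ j → (M (suc a) j + coef a * M zero j) * v j)                ≈⟨ Σ-rowCombination (M (suc a)) (M zero) v (coef a) ⟩
      Σ (λ j → M (suc a) j * v j) + coef a * Σ (λ j → M zero j * v j)  ≈⟨ +-cong (Mv≈0 (suc a)) (*-congˡ (Mv≈0 zero)) ⟩
      0# + coef a * 0#                                                 ≈⟨ +-≈0 refl (zeroʳ _) ⟩
      0#                                                               ∎

    annihilates-M : ∀ v → Annihilates allRows v → Annihilates M v
    annihilates-M v Av≈0 zero = Av≈0 zero
    annihilates-M v Av≈0 (suc a) = begin
      Σ (λ j → M (suc a) j * v j)                                      ≈⟨ +-identityʳ _ ⟨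
      Σ (λ j → M (suc a) j * v j) + 0#                                 ≈⟨ +-congˡ (*-≈0ʳ _ (Av≈0 zero)) ⟨
      Σ (λ j → M (suc a) j * v j) + coef a * Σ (λ j → M zero j * v j)  ≈⟨ Σ-rowCombination (M (suc a)) (M zero) v (coef a) ⟨
      Σ (λ j → allRows (suc a) j * v j)                                ≈⟨ Av≈0 (suc a) ⟩
      0#                                                               ∎

    annihilates-reduced : ∀ v → Annihilates allRows v → Annihilates reduced (v ∘ suc)
    annihilates-reduced v Av≈0 a = begin
      Σ (λ j → reduced a j * v (suc j))                                 ≈⟨ +-identityˡ _ ⟨
      0# + Σ (λ j → reduced a j * v (suc j))                            ≈⟨ +-congʳ (*-≈0ˡ _ (column0-cleared a)) ⟨
      allRows (suc a) zero * v zero + Σ (λ j → reduced a j * v (suc j)) ≈⟨ Σ-suc (λ j → allRows (suc a) j * v j) ⟨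
      Σ (λ j → allRows (suc a) j * v j)                                 ≈⟨ Av≈0 (suc a) ⟩
      0#                                                                ∎

    extend : (Fin n → Carrier) → Fin (suc n) → Carrier
    extend w zero = - (pivot ⁻¹ * Σ (λ j → M zero (suc j) * w j))
    extend w (suc j) = w j

    annihilates-extend : ∀ w → Annihilates reduced w → Annihilates M (extend w)
    annihilates-extend w Rw≈0 = annihilates-M (extend w) Av≈0
      where
      S : Carrier
      S = Σ (λ j → M zero (suc j) * w j)
      Av≈0 : Annihilates allRows (extend w)
      Av≈0 zero = begin
        Σ (λ j → M zero j * extend w j)   ≈⟨ Σ-suc (λ j → M zero j * extend w j) ⟩
        pivot * - (pivot ⁻¹ * S) + S      ≈⟨ +-congʳ (-‿distribʳ-* _ _) ⟨
        - (pivot * (pivot ⁻¹ * S)) + S    ≈⟨ +-congʳ (-‿cong (sym (*-assoc _ _ _))) ⟩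
        - ((pivot * pivot ⁻¹) * S) + S    ≈⟨ +-congʳ (-‿cong (*-congʳ (x*x⁻¹≈1 pivot pivot≉0))) ⟩
        - (1# * S) + S                    ≈⟨ +-congʳ (-‿cong (*-identityˡ S)) ⟩
        - S + S                           ≈⟨ -‿inverseˡ S ⟩
        0#                                ∎
      Av≈0 (suc a) = begin
        Σ (λ j → allRows (suc a) j * extend w j)                    ≈⟨ Σ-suc (λ j → allRows (suc a) j * extend w j) ⟩
        allRows (suc a) zero * extend w zero + Σ (λ j → reduced a j * w j) ≈⟨ +-≈0 (*-≈0ˡ _ (column0-cleared a)) (Rw≈0 a) ⟩
        0#                                                          ∎

    kernel-first≈0 : ∀ v → Annihilates M v → (∀ j → v (suc j) ≈ 0#) → v zero ≈ 0#
    kernel-first≈0 v Mv≈0 tail≈0 = *-cancelˡ-≈0 pivot (v zero) pivot≉0 (begin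
      pivot * v zero                                        ≈⟨ +-identityʳ _ ⟨
      pivot * v zero + 0#                                   ≈⟨ +-congˡ (Σ-≈0 (λ j → *-≈0ʳ _ (tail≈0 j))) ⟨
      pivot * v zero + Σ (λ j → M zero (suc j) * v (suc j)) ≈⟨ Σ-suc (λ j → M zero j * v j) ⟨
      Σ (λ j → M zero j * v j)                              ≈⟨ Mv≈0 zero ⟩
      0#                                                    ∎)

  module MakePivot {n : ℕ} (M : Matrix (suc n)) (r : Fin (suc n)) (Mr0≉0 : ¬ (M r zero ≈ 0#))
                   (M00≈0 : M zero zero ≈ 0#) where

    r≢0 : r ≢ zero
    r≢0 ≡.refl = Mr0≉0 M00≈0

    addRow : Matrix (suc n)
    addRow zero j = M zero j + 1# * M r j
    addRow (suc a) j = M (suc a) j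

    det-addRow : det (suc n) addRow ≈ det (suc n) M
    det-addRow = det-addRowMultiple (suc n) M addRow zero r 1# (r≢0 ∘ ≡.sym) others (λ j → refl)
      where
      others : ∀ i j → i ≢ zero → addRow i j ≈ M i j
      others zero j i≢0 = ⊥-elim (i≢0 ≡.refl)
      others (suc a) j _ = refl

    pivot≉0 : ¬ (addRow zero zero ≈ 0#)
    pivot≉0 pivot≈0 = Mr0≉0 (begin
      M r zero                     ≈⟨ *-identityˡ _ ⟨
      1# * M r zero                ≈⟨ +-identityˡ _ ⟨
      0# + 1# * M r zero           ≈⟨ +-congʳ M00≈0 ⟨
      M zero zero + 1# * M r zero  ≈⟨ pivot≈0 ⟩
      0#                           ∎)

    annihilates-addRow : ∀ v → Annihilates M v → Annihilates addRow v
    annihilates-addRow v Mv≈0 zero = begin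
      Σ (λ j → (M zero j + 1# * M r j) * v j)                      ≈⟨ Σ-rowCombination (M zero) (M r) v 1# ⟩
      Σ (λ j → M zero j * v j) + 1# * Σ (λ j → M r j * v j)        ≈⟨ +-cong (Mv≈0 zero) (*-congˡ (Mv≈0 r)) ⟩
      0# + 1# * 0#                                                 ≈⟨ +-≈0 refl (zeroʳ _) ⟩
      0#                                                           ∎
    annihilates-addRow v Mv≈0 (suc a) = Mv≈0 (suc a)

    annihilates-M : ∀ v → Annihilates addRow v → Annihilates M v
    annihilates-M v Av≈0 zero = begin
      Σ (λ j → M zero j * v j)                                     ≈⟨ +-identityʳ _ ⟨
      Σ (λ j → M zero j * v j) + 0#                                ≈⟨ +-congˡ (*-≈0ʳ _ (row-r r r≢0)) ⟨
      Σ (λ j → M zero j * v j) + 1# * Σ (λ j → M r j * v j)        ≈⟨ Σ-rowCombination (M zero) (M r) v 1# ⟨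
      Σ (λ j → addRow zero j * v j)                                ≈⟨ Av≈0 zero ⟩
      0#                                                           ∎
      where
      row-r : ∀ r → r ≢ zero → Σ (λ j → M r j * v j) ≈ 0#
      row-r zero r≢0 = ⊥-elim (r≢0 ≡.refl)
      row-r (suc a) _ = Av≈0 (suc a)
    annihilates-M v Av≈0 (suc a) = Av≈0 (suc a)

  record PivotForm {n : ℕ} (M : Matrix (suc n)) : Set (c ⊔ ℓ) where
    field
      M′                : Matrix (suc n)
      pivot≉0           : ¬ (M′ zero zero ≈ 0#)
      det-M′            : det (suc n) M′ ≈ det (suc n) M
      annihilates-M⇒M′  : ∀ v → Annihilates M v → Annihilates M′ v
      annihilates-M′⇒M  : ∀ v → Annihilates M′ v → Annihilates M v

  toPivotForm : ∀ {n} (M : Matrix (suc n)) → ¬ (∀ i → M i zero ≈ 0#) → PivotForm M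
  toPivotForm {n} M col≉0 with M zero zero ≟ 0#
  ... | no M00≉0 = record
    { M′ = M ; pivot≉0 = M00≉0 ; det-M′ = refl ; annihilates-M⇒M′ = λ _ Mv≈0 → Mv≈0 ; annihilates-M′⇒M = λ _ Mv≈0 → Mv≈0 }
  ... | yes M00≈0 with FP.¬∀⟶∃¬ (suc n) _ (λ i → M i zero ≟ 0#) col≉0
  ...   | r , Mr0≉0 = record
    { M′ = addRow ; pivot≉0 = pivot≉0 ; det-M′ = det-addRow
    ; annihilates-M⇒M′ = annihilates-addRow ; annihilates-M′⇒M = annihilates-M }
    where open MakePivot M r Mr0≉0 M00≈0

  e₀ : ∀ {n} → Fin (suc n) → Carrier
  e₀ zero = 1#
  e₀ (suc _) = 0#

  zeroColumn⇒annihilates-e₀ : ∀ {n} (M : Matrix (suc n)) → (∀ i → M i zero ≈ 0#) → Annihilates M e₀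
  zeroColumn⇒annihilates-e₀ {n} M col≈0 i = begin
    Σ (λ j → M i j * e₀ j)                          ≈⟨ Σ-suc (λ j → M i j * e₀ j) ⟩
    M i zero * 1# + Σ (λ j → M i (suc j) * 0#)      ≈⟨ +-≈0 (*-≈0ˡ _ (col≈0 i)) (Σ-≈0 {n} (λ j → zeroʳ (M i (suc j)))) ⟩
    0#                                              ∎

  det≈0⇒kernel : ∀ n (M : Matrix n) → det n M ≈ 0# → ∃ λ v → NonzeroVec v × Annihilates M v
  det≈0⇒kernel zero M det≈0 = ⊥-elim (1≉0 det≈0)
  det≈0⇒kernel (suc n) M det≈0 with FP.all? (λ i → M i zero ≟ 0#)
  ... | yes col≈0 = e₀ , (zero , 1≉0) , zeroColumn⇒annihilates-e₀ M col≈0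
  ... | no col≉0 with det≈0⇒kernel n reduced
                        (*-cancelˡ-≈0 pivot (det n reduced) pivot≉0
                          (trans (sym det≈pivot*det-reduced) (trans det-M′ det≈0)))
    where open PivotForm (toPivotForm M col≉0)
          open Pivot M′ pivot≉0
  ...   | w , (j , wj≉0) , Rw≈0 = extend w , (suc j , wj≉0) , annihilates-M′⇒M (extend w) (annihilates-extend w Rw≈0)
    where open PivotForm (toPivotForm M col≉0)
          open Pivot M′ pivot≉0

  kernel⇒det≈0 : ∀ n (M : Matrix n) (v : Fin n → Carrier) → NonzeroVec v → Annihilates M v → det n M ≈ 0#
  kernel⇒det≈0 zero M v (() , _) Mv≈0
  kernel⇒det≈0 (suc n) M v v≉0 Mv≈0 with FP.all? (λ i → M i zero ≟ 0#)
  ... | yes col≈0 = det-zero-col (suc n) M zero col≈0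
  ... | no col≉0 with FP.all? (λ j → v (suc j) ≟ 0#)
  ...   | yes tail≈0 = ⊥-elim (nonzero-entry v≉0)
    where
    open PivotForm (toPivotForm M col≉0)
    open Pivot M′ pivot≉0
    nonzero-entry : NonzeroVec v → ⊥
    nonzero-entry (zero , v0≉0) = v0≉0 (kernel-first≈0 v (annihilates-M⇒M′ v Mv≈0) tail≈0)
    nonzero-entry (suc j , vj≉0) = vj≉0 (tail≈0 j)
  ...   | no tail≉0 = begin
    det (suc n) M              ≈⟨ det-M′ ⟨
    det (suc n) M′             ≈⟨ det≈pivot*det-reduced ⟩
    pivot * det n reduced      ≈⟨ *-≈0ʳ pivot (kernel⇒det≈0 n reduced (v ∘ suc)
                                     (FP.¬∀⟶∃¬ n _ (λ j → v (suc j) ≟ 0#) tail≉0)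
                                     (annihilates-reduced v (annihilates-allRows v (annihilates-M⇒M′ v Mv≈0)))) ⟩
    0#                         ∎
    where
    open PivotForm (toPivotForm M col≉0)
    open Pivot M′ pivot≉0


module PadeRelations {c ℓ q} (F : Defs.FiniteField c ℓ q) where

  open import Level using (_⊔_)
  open import Data.Nat as ℕ using (ℕ; zero; suc; _≤_; _<_; z≤n; s≤s)
  import Data.Nat.Properties as NP
  open import Data.Product using (∃; _×_; _,_)
  open import Data.Sum as Sum using (_⊎_; inj₁; inj₂; [_,_]′)
  open import Data.Bool using (Bool; true; false)
  open import Data.Bool.Properties using (⇔→≡)
  open import Relation.Binary.PropositionalEquality as ≡ using (_≡_; _≢_)
  open import Relation.Nullary using (¬_; yes; no)
  open import Relation.Binary.Definitions using (tri<; tri≈; tri>)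
  open import Data.Empty using (⊥-elim; ⊥)
  open import Function using (_∘_)
  open import Function.Bundles using (_⇔_; mk⇔; Equivalence)
  open import Function.Properties.Equivalence using () renaming (trans to ⇔-trans)

  open Defs.FiniteField F using (commRing; _≟_)
  open CommutativeRing commRing hiding (zero)
  open FieldLemmas F
  open import Relation.Binary.Reasoning.Setoid setoid
  open import Algebra.Solver.Ring.NaturalCoefficients.Default commutativeSemiring
  open import Algebra.Properties.Ring ring using (-‿distribˡ-*; -‿distribʳ-*; -0#≈0#)

  sumBelow : ℕ → (ℕ → Carrier) → Carrier
  sumBelow zero f = 0#
  sumBelow (suc n) f = f 0 + sumBelow n (f ∘ suc)

  sumBelow-cong : ∀ n {f g : ℕ → Carrier} → (∀ e → e < n → f e ≈ g e) → sumBelow n f ≈ sumBelow n g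
  sumBelow-cong zero f≈g = refl
  sumBelow-cong (suc n) f≈g = +-cong (f≈g 0 (s≤s z≤n)) (sumBelow-cong n (λ e e<n → f≈g (suc e) (s≤s e<n)))

  sumBelow-≈0 : ∀ n {f : ℕ → Carrier} → (∀ e → e < n → f e ≈ 0#) → sumBelow n f ≈ 0#
  sumBelow-≈0 zero f≈0 = refl
  sumBelow-≈0 (suc n) f≈0 = +-≈0 (f≈0 0 (s≤s z≤n)) (sumBelow-≈0 n (λ e e<n → f≈0 (suc e) (s≤s e<n)))

  sumBelow-distrib-+ : ∀ n (f g : ℕ → Carrier) → sumBelow n (λ e → f e + g e) ≈ sumBelow n f + sumBelow n g
  sumBelow-distrib-+ zero f g = sym (+-identityˡ 0#)
  sumBelow-distrib-+ (suc n) f g = trans (+-congˡ (sumBelow-distrib-+ n (f ∘ suc) (g ∘ suc))) (interchange _ _ _ _)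
    where
    interchange : ∀ a b c d → (a + b) + (c + d) ≈ (a + c) + (b + d)
    interchange = solve 4 (λ a b c d → (a :+ b) :+ (c :+ d) := (a :+ c) :+ (b :+ d)) refl

  sumBelow-factorˡ : ∀ n x (f : ℕ → Carrier) → sumBelow n (λ e → x * f e) ≈ x * sumBelow n f
  sumBelow-factorˡ zero x f = sym (zeroʳ x)
  sumBelow-factorˡ (suc n) x f = trans (+-congˡ (sumBelow-factorˡ n x (f ∘ suc))) (sym (distribˡ x _ _))

  sumBelow-single : ∀ n (f : ℕ → Carrier) e₀ → e₀ < n → (∀ e → e ≢ e₀ → f e ≈ 0#) → sumBelow n f ≈ f e₀
  sumBelow-single (suc n) f zero _ off =
    trans (+-congˡ (sumBelow-≈0 n (λ e _ → off (suc e) (λ ())))) (+-identityʳ _)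
  sumBelow-single (suc n) f (suc e₀) (s≤s e₀<n) off =
    trans (+-congʳ (off 0 (λ ()))) (trans (+-identityˡ _)
      (sumBelow-single n (f ∘ suc) e₀ e₀<n (λ e e≢e₀ → off (suc e) (e≢e₀ ∘ NP.suc-injective))))

  sumBelow-extend : ∀ L d (f : ℕ → Carrier) → (∀ e → L ≤ e → f e ≈ 0#) → sumBelow (L ℕ.+ d) f ≈ sumBelow L f
  sumBelow-extend zero d f f≈0 = sumBelow-≈0 d (λ e _ → f≈0 e z≤n)
  sumBelow-extend (suc L) d f f≈0 = +-congˡ (sumBelow-extend L d (f ∘ suc) (λ e L≤e → f≈0 (suc e) (s≤s L≤e)))

  sumBelow-mono : ∀ L L′ (f : ℕ → Carrier) → L ≤ L′ → (∀ e → L ≤ e → f e ≈ 0#) → sumBelow L′ f ≈ sumBelow L f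
  sumBelow-mono L L′ f L≤L′ f≈0 with NP.m≤n⇒∃[o]m+o≡n L≤L′
  ... | d , ≡.refl = sumBelow-extend L d f f≈0

  -- coeffOfShift X s e is the coefficient of z^s in z^e X(z), and productCoeff L s X E is the
  -- coefficient of z^s in X(z) E(z) when deg E < L.
  coeffOfShift : Series → ℕ → ℕ → Carrier
  coeffOfShift X s zero = X s
  coeffOfShift X zero (suc e) = 0#
  coeffOfShift X (suc s) (suc e) = coeffOfShift X s e

  productCoeff : ℕ → ℕ → Series → Series → Carrier
  productCoeff L s X E = sumBelow L (λ e → coeffOfShift X s e * E e)

  coeffOfShift-cong : ∀ s e {X X′} → (∀ i → i ≤ s → X i ≈ X′ i) → coeffOfShift X s e ≈ coeffOfShift X′ s e
  coeffOfShift-cong s zero X≈X′ = X≈X′ s NP.≤-refl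
  coeffOfShift-cong zero (suc e) X≈X′ = refl
  coeffOfShift-cong (suc s) (suc e) X≈X′ = coeffOfShift-cong s e (λ i i≤s → X≈X′ i (NP.m≤n⇒m≤1+n i≤s))

  coeffOfShift-linear : ∀ s e (X Y : Series) x →
    coeffOfShift (λ i → X i + x * Y i) s e ≈ coeffOfShift X s e + x * coeffOfShift Y s e
  coeffOfShift-linear s zero X Y x = refl
  coeffOfShift-linear zero (suc e) X Y x = sym (+-≈0 refl (zeroʳ x))
  coeffOfShift-linear (suc s) (suc e) X Y x = coeffOfShift-linear s e X Y x

  coeffOfShift-scale : ∀ s e (X : Series) x → coeffOfShift (λ i → x * X i) s e ≈ x * coeffOfShift X s e
  coeffOfShift-scale s zero X x = refl
  coeffOfShift-scale zero (suc e) X x = sym (zeroʳ x)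
  coeffOfShift-scale (suc s) (suc e) X x = coeffOfShift-scale s e X x

  coeffOfShift-tail : ∀ s e (X : Series) → X 0 ≈ 0# → coeffOfShift X (suc s) e ≈ coeffOfShift (X ∘ suc) s e
  coeffOfShift-tail s zero X X₀≈0 = refl
  coeffOfShift-tail zero (suc zero) X X₀≈0 = X₀≈0
  coeffOfShift-tail zero (suc (suc e)) X X₀≈0 = refl
  coeffOfShift-tail (suc s) (suc e) X X₀≈0 = coeffOfShift-tail s e X X₀≈0

  coeffOfShift-diag : ∀ s (X : Series) → coeffOfShift X s s ≡ X 0
  coeffOfShift-diag zero X = ≡.refl
  coeffOfShift-diag (suc s) X = coeffOfShift-diag s X

  coeffOfShift-> : ∀ s e (X : Series) → s < e → coeffOfShift X s e ≡ 0#
  coeffOfShift-> zero (suc e) X _ = ≡.refl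
  coeffOfShift-> (suc s) (suc e) X (s≤s s<e) = coeffOfShift-> s e X s<e

  coeffOfShift-0 : ∀ e (X : Series) → X 0 ≈ 0# → coeffOfShift X 0 e ≈ 0#
  coeffOfShift-0 zero X X₀≈0 = X₀≈0
  coeffOfShift-0 (suc e) X X₀≈0 = refl

  productCoeff-cong : ∀ L s {X X′ E E′} → (∀ i → i ≤ s → X i ≈ X′ i) → (∀ e → e < L → E e ≈ E′ e) →
    productCoeff L s X E ≈ productCoeff L s X′ E′
  productCoeff-cong L s X≈X′ E≈E′ = sumBelow-cong L (λ e e<L → *-cong (coeffOfShift-cong s e X≈X′) (E≈E′ e e<L))

  productCoeff-linearˡ : ∀ L s (X Y E : Series) x →
    productCoeff L s (λ i → X i + x * Y i) E ≈ productCoeff L s X E + x * productCoeff L s Y E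
  productCoeff-linearˡ L s X Y E x = begin
    sumBelow L (λ e → coeffOfShift (λ i → X i + x * Y i) s e * E e)
      ≈⟨ sumBelow-cong L (λ e _ → trans (*-congʳ (coeffOfShift-linear s e X Y x)) (expand _ _ _ _)) ⟩
    sumBelow L (λ e → coeffOfShift X s e * E e + x * (coeffOfShift Y s e * E e))
      ≈⟨ sumBelow-distrib-+ L _ _ ⟩
    productCoeff L s X E + sumBelow L (λ e → x * (coeffOfShift Y s e * E e))
      ≈⟨ +-congˡ (sumBelow-factorˡ L x _) ⟩
    productCoeff L s X E + x * productCoeff L s Y E ∎
    where
    expand : ∀ a x b v → (a + x * b) * v ≈ a * v + x * (b * v)
    expand = solve 4 (λ a x b v → (a :+ x :* b) :* v := a :* v :+ x :* (b :* v)) refl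

  productCoeff-linearʳ : ∀ L s (X E O : Series) x →
    productCoeff L s X (λ e → E e + x * O e) ≈ productCoeff L s X E + x * productCoeff L s X O
  productCoeff-linearʳ L s X E O x = begin
    sumBelow L (λ e → coeffOfShift X s e * (E e + x * O e))
      ≈⟨ sumBelow-cong L (λ e _ → expand _ _ _ _) ⟩
    sumBelow L (λ e → coeffOfShift X s e * E e + x * (coeffOfShift X s e * O e))
      ≈⟨ sumBelow-distrib-+ L _ _ ⟩
    productCoeff L s X E + sumBelow L (λ e → x * (coeffOfShift X s e * O e))
      ≈⟨ +-congˡ (sumBelow-factorˡ L x _) ⟩
    productCoeff L s X E + x * productCoeff L s X O ∎
    where
    expand : ∀ a e x o → a * (e + x * o) ≈ a * e + x * (a * o)
    expand = solve 4 (λ a e x o → a :* (e :+ x :* o) := a :* e :+ x :* (a :* o)) refl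

  productCoeff-scale : ∀ L s (X E : Series) x → productCoeff L s (λ i → x * X i) E ≈ x * productCoeff L s X E
  productCoeff-scale L s X E x =
    trans (sumBelow-cong L (λ e _ → trans (*-congʳ (coeffOfShift-scale s e X x)) (*-assoc _ _ _))) (sumBelow-factorˡ L x _)

  productCoeff-tail : ∀ L s (X E : Series) → X 0 ≈ 0# → productCoeff L (suc s) X E ≈ productCoeff L s (X ∘ suc) E
  productCoeff-tail L s X E X₀≈0 = sumBelow-cong L (λ e _ → *-congʳ (coeffOfShift-tail s e X X₀≈0))

  productCoeff-0 : ∀ L (X E : Series) → X 0 ≈ 0# → productCoeff L 0 X E ≈ 0#
  productCoeff-0 L X E X₀≈0 = sumBelow-≈0 L (λ e _ → *-≈0ˡ (E e) (coeffOfShift-0 e X X₀≈0))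

  productCoeff-constant : ∀ L (X E : Series) → productCoeff (suc L) 0 X E ≈ X 0 * E 0
  productCoeff-constant L X E = trans (+-congˡ (sumBelow-≈0 L (λ e _ → zeroˡ _))) (+-identityʳ _)

  productCoeff-lowest : ∀ L s (X E : Series) → s < L → (∀ e → e < s → E e ≈ 0#) → productCoeff L s X E ≈ X 0 * E s
  productCoeff-lowest L s X E s<L E≈0 =
    trans (sumBelow-single L _ s s<L off) (reflexive (≡.cong (_* E s) (coeffOfShift-diag s X)))
    where
    off : ∀ e → e ≢ s → coeffOfShift X s e * E e ≈ 0#
    off e e≢s with NP.<-cmp e s
    ... | tri< e<s _ _ = *-≈0ʳ _ (E≈0 e e<s)
    ... | tri≈ _ e≡s _ = ⊥-elim (e≢s e≡s)
    ... | tri> _ _ s<e = *-≈0ˡ (E e) (reflexive (coeffOfShift-> s e X s<e))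

  NonzeroBelow : ℕ → Series → Set ℓ
  NonzeroBelow L E = ∃ λ e → e < L × ¬ (E e ≈ 0#)

  nonzeroBelow? : ∀ L (E : Series) → NonzeroBelow L E ⊎ (∀ e → e < L → E e ≈ 0#)
  nonzeroBelow? zero E = inj₂ (λ e ())
  nonzeroBelow? (suc L) E with E 0 ≟ 0#
  ... | no E₀≉0 = inj₁ (0 , s≤s z≤n , E₀≉0)
  ... | yes E₀≈0 with nonzeroBelow? L (E ∘ suc)
  ...   | inj₁ (e , e<L , Ee≉0) = inj₁ (suc e , s≤s e<L , Ee≉0)
  ...   | inj₂ E≈0 = inj₂ λ { zero _ → E₀≈0 ; (suc e) (s≤s e<L) → E≈0 e e<L }

  vanishing-by-degree : ∀ {α} (E : Series) → (∀ e → e < α → E e ≈ 0#) → (∀ e → α ≤ e → E e ≈ 0#) → ∀ e → E e ≈ 0#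
  vanishing-by-degree {α} E low high e with e ℕ.<? α
  ... | yes e<α = low e e<α
  ... | no e≮α  = high e (NP.≮⇒≥ e≮α)

  record PadeRelation (α β : ℕ) (X Y : Series) : Set (c ⊔ ℓ) where
    field
      E O         : Series
      E-degree    : ∀ e → α ≤ e → E e ≈ 0#
      O-degree    : ∀ e → β ≤ e → O e ≈ 0#
      nontrivial  : NonzeroBelow α E ⊎ NonzeroBelow β O
      vanishes    : ∀ s → s < α ℕ.+ β → productCoeff α s X E + productCoeff β s Y O ≈ 0#

  relation-swap : ∀ {α β X Y} → PadeRelation α β X Y → PadeRelation β α Y X
  relation-swap {α} {β} rel = record
    { E = O ; O = E ; E-degree = O-degree ; O-degree = E-degree
    ; nontrivial = Sum.swap nontrivial
    ; vanishes = λ s s<β+α → trans (+-comm _ _) (vanishes s (≡.subst (s <_) (NP.+-comm β α) s<β+α)) }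
    where open PadeRelation rel

  relation-scale⇒ : ∀ {α β X Y} x → PadeRelation α β X Y → PadeRelation α β (λ i → x * X i) (λ i → x * Y i)
  relation-scale⇒ {α} {β} {X} {Y} x rel = record
    { E = E ; O = O ; E-degree = E-degree ; O-degree = O-degree ; nontrivial = nontrivial
    ; vanishes = λ s s< → trans (+-cong (productCoeff-scale α s X E x) (productCoeff-scale β s Y O x))
                                  (trans (sym (distribˡ x _ _)) (*-≈0ʳ x (vanishes s s<))) }
    where open PadeRelation rel

  relation-scale⇐ : ∀ {α β X Y} x → ¬ (x ≈ 0#) → PadeRelation α β (λ i → x * X i) (λ i → x * Y i) → PadeRelation α β X Y
  relation-scale⇐ {α} {β} {X} {Y} x x≉0 rel = record
    { E = E ; O = O ; E-degree = E-degree ; O-degree = O-degree ; nontrivial = nontrivial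
    ; vanishes = λ s s< → *-cancelˡ-≈0 x _ x≉0 (trans (distribˡ x _ _)
        (trans (sym (+-cong (productCoeff-scale α s X E x) (productCoeff-scale β s Y O x))) (vanishes s s<))) }
    where open PadeRelation rel

  relation-cong : ∀ {α β X Y X′ Y′} → (∀ i → i < α ℕ.+ β → X i ≈ X′ i) → (∀ i → i < α ℕ.+ β → Y i ≈ Y′ i) →
    PadeRelation α β X Y → PadeRelation α β X′ Y′
  relation-cong {α} {β} X≈X′ Y≈Y′ rel = record
    { E = E ; O = O ; E-degree = E-degree ; O-degree = O-degree ; nontrivial = nontrivial
    ; vanishes = λ s s< → trans (sym (+-cong (productCoeff-cong α s (λ i i≤s → X≈X′ i (NP.≤-<-trans i≤s s<)) (λ e _ → refl))
                                               (productCoeff-cong β s (λ i i≤s → Y≈Y′ i (NP.≤-<-trans i≤s s<)) (λ e _ → refl))))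
                                (vanishes s s<) }
    where open PadeRelation rel

  relation₀⇒X₀≈0 : ∀ {a X Y} → PadeRelation (suc a) 0 X Y → X 0 ≈ 0#
  relation₀⇒X₀≈0 {a} {X} {Y} rel with X 0 ≟ 0#
  ... | yes X₀≈0 = X₀≈0
  ... | no X₀≉0 = ⊥-elim (trivial nontrivial)
    where
    open PadeRelation rel
    -- With X(0) ≠ 0, the equations X E ≡ 0 (mod z^(a+1)) force E = 0 coefficient by coefficient.
    next≈0 : ∀ e → e < suc a → (∀ e′ → e′ < e → E e′ ≈ 0#) → E e ≈ 0#
    next≈0 e e<a+1 below≈0 = *-cancelˡ-≈0 (X 0) (E e) X₀≉0 (begin
      X 0 * E e                                  ≈⟨ productCoeff-lowest (suc a) e X E e<a+1 below≈0 ⟨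
      productCoeff (suc a) e X E                 ≈⟨ +-identityʳ _ ⟨
      productCoeff (suc a) e X E + 0#            ≈⟨ vanishes e (≡.subst (e <_) (≡.sym (NP.+-identityʳ (suc a))) e<a+1) ⟩
      0#                                         ∎)
    below≈0 : ∀ e → e ≤ suc a → ∀ e′ → e′ < e → E e′ ≈ 0#
    below≈0 zero _ e′ ()
    below≈0 (suc e) e<a+1 e′ e′<e+1 with NP.m<1+n⇒m<n∨m≡n e′<e+1
    ... | inj₁ e′<e = below≈0 e (NP.<⇒≤ e<a+1) e′ e′<e
    ... | inj₂ ≡.refl = next≈0 e′ e<a+1 (below≈0 e′ (NP.<⇒≤ e<a+1))
    trivial : NonzeroBelow (suc a) E ⊎ NonzeroBelow 0 O → ⊥
    trivial (inj₁ (e , e<a+1 , Ee≉0)) = Ee≉0 (below≈0 (suc e) e<a+1 e (NP.n<1+n e))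
    trivial (inj₂ (e , () , _))

  δ : ℕ → Series
  δ a e with e ℕ.≟ a
  ... | yes _ = 1#
  ... | no _  = 0#

  δ-same : ∀ a → δ a a ≈ 1#
  δ-same a with a ℕ.≟ a
  ... | yes _  = refl
  ... | no a≢a = ⊥-elim (a≢a ≡.refl)

  δ-other : ∀ a e → e ≢ a → δ a e ≈ 0#
  δ-other a e e≢a with e ℕ.≟ a
  ... | yes e≡a = ⊥-elim (e≢a e≡a)
  ... | no _    = refl

  X₀≈0⇒relation₀ : ∀ {a X Y} → X 0 ≈ 0# → PadeRelation (suc a) 0 X Y
  X₀≈0⇒relation₀ {a} {X} {Y} X₀≈0 = record
    { E = δ a ; O = λ _ → 0#
    ; E-degree = λ e a<e → δ-other a e (λ { ≡.refl → NP.<-irrefl ≡.refl a<e })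
    ; O-degree = λ _ _ → refl
    ; nontrivial = inj₁ (a , NP.n<1+n a , λ δa≈0 → 1≉0 (trans (sym (δ-same a)) δa≈0))
    ; vanishes = λ s s< → trans (+-identityʳ _) (trans
        (productCoeff-lowest (suc a) s X (δ a) (s<a+1 s s<)
           (λ e e<s → δ-other a e (λ { ≡.refl → NP.<-irrefl ≡.refl (NP.<-≤-trans e<s (NP.≤-pred (s<a+1 s s<))) })))
        (*-≈0ˡ _ X₀≈0)) }
    where
    s<a+1 : ∀ s → s < suc a ℕ.+ 0 → s < suc a
    s<a+1 s = ≡.subst (s <_) (NP.+-identityʳ (suc a))

  -*-≈0 : ∀ l x → l * x ≈ 0# → (- l) * x ≈ 0#
  -*-≈0 l x lx≈0 = trans (sym (-‿distribˡ-* l x)) (trans (-‿cong lx≈0) -0#≈0#)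

  euclidReduce : Series → Series → Series
  euclidReduce X Y i = X (suc i) + (- (X 0 * Y 0 ⁻¹)) * Y (suc i)

  -- X ↦ X - (X(0)/Y(0)) Y kills the constant term of X; the multiple of E it adds to O keeps
  -- deg O < β + 1 because either deg E < α ≤ β + 1 or the multiple is 0.
  module EuclidStep {α b : ℕ} {X Y : Series} (Y₀≉0 : ¬ (Y 0 ≈ 0#)) (α≤b+1⊎X₀≈0 : α ≤ suc b ⊎ X 0 ≈ 0#) where

    ratio : Carrier
    ratio = X 0 * Y 0 ⁻¹

    X′ : Series
    X′ i = X i + (- ratio) * Y i

    X′₀≈0 : X′ 0 ≈ 0#
    X′₀≈0 = begin
      X 0 + (- (X 0 * Y 0 ⁻¹)) * Y 0    ≈⟨ +-congˡ (*-congʳ (-‿distribʳ-* _ _)) ⟩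
      X 0 + (X 0 * - Y 0 ⁻¹) * Y 0      ≈⟨ +-congˡ (*-assoc _ _ _) ⟩
      X 0 + X 0 * (- Y 0 ⁻¹ * Y 0)      ≈⟨ +-congˡ (*-congˡ (*-comm _ _)) ⟩
      X 0 + X 0 * (Y 0 * - Y 0 ⁻¹)      ≈⟨ +-congˡ (*-congˡ (-‿distribʳ-* _ _)) ⟨
      X 0 + X 0 * - (Y 0 * Y 0 ⁻¹)      ≈⟨ +-congˡ (*-congˡ (-‿cong (x*x⁻¹≈1 (Y 0) Y₀≉0))) ⟩
      X 0 + X 0 * - 1#                  ≈⟨ +-congˡ (-‿distribʳ-* _ _) ⟨
      X 0 + - (X 0 * 1#)                ≈⟨ +-congˡ (-‿cong (*-identityʳ _)) ⟩
      X 0 + - X 0                       ≈⟨ -‿inverseʳ _ ⟩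
      0#                                ∎

    ratio*E≈0 : ∀ (E : Series) → (∀ e → α ≤ e → E e ≈ 0#) → ∀ e → suc b ≤ e → ratio * E e ≈ 0#
    ratio*E≈0 E E-degree e b<e =
      [ (λ α≤b+1 → *-≈0ʳ ratio (E-degree e (NP.≤-trans α≤b+1 b<e))) , (λ X₀≈0 → *-≈0ˡ (E e) (*-≈0ˡ _ X₀≈0)) ]′ α≤b+1⊎X₀≈0

    X≈X′+ratio*Y : ∀ i → X i ≈ X′ i + ratio * Y i
    X≈X′+ratio*Y i = sym (begin
      (X i + (- ratio) * Y i) + ratio * Y i    ≈⟨ +-assoc _ _ _ ⟩
      X i + ((- ratio) * Y i + ratio * Y i)    ≈⟨ +-congˡ (+-congʳ (sym (-‿distribˡ-* _ _))) ⟩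
      X i + (- (ratio * Y i) + ratio * Y i)    ≈⟨ +-congˡ (-‿inverseˡ _) ⟩
      X i + 0#                                 ≈⟨ +-identityʳ _ ⟩
      X i                                      ∎)

    ratio*productCoeff : ∀ (E : Series) → (∀ e → α ≤ e → E e ≈ 0#) → ∀ s →
      ratio * productCoeff α s Y E ≈ ratio * productCoeff (suc b) s Y E
    ratio*productCoeff E E-degree s =
      [ (λ α≤b+1 → *-congˡ (sym (sumBelow-mono α (suc b) _ α≤b+1 (λ e α≤e → *-≈0ʳ _ (E-degree e α≤e)))))
      , (λ X₀≈0 → trans (*-≈0ˡ _ (*-≈0ˡ _ X₀≈0)) (sym (*-≈0ˡ _ (*-≈0ˡ _ X₀≈0)))) ]′ α≤b+1⊎X₀≈0

    equations-invariant : ∀ (E O O′ : Series) → (∀ e → α ≤ e → E e ≈ 0#) → (∀ e → O′ e ≈ O e + ratio * E e) → ∀ s →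
      productCoeff α s X E + productCoeff (suc b) s Y O ≈ productCoeff α s X′ E + productCoeff (suc b) s Y O′
    equations-invariant E O O′ E-degree O′≈ s = begin
      productCoeff α s X E + productCoeff (suc b) s Y O
        ≈⟨ +-congʳ (productCoeff-cong α s (λ i _ → X≈X′+ratio*Y i) (λ e _ → refl)) ⟩
      productCoeff α s (λ i → X′ i + ratio * Y i) E + productCoeff (suc b) s Y O
        ≈⟨ +-congʳ (productCoeff-linearˡ α s X′ Y E ratio) ⟩
      (productCoeff α s X′ E + ratio * productCoeff α s Y E) + productCoeff (suc b) s Y O
        ≈⟨ +-congʳ (+-congˡ (ratio*productCoeff E E-degree s)) ⟩
      (productCoeff α s X′ E + ratio * productCoeff (suc b) s Y E) + productCoeff (suc b) s Y O
        ≈⟨ rearrange _ _ _ ⟩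
      productCoeff α s X′ E + (productCoeff (suc b) s Y O + ratio * productCoeff (suc b) s Y E)
        ≈⟨ +-congˡ (productCoeff-linearʳ (suc b) s Y O E ratio) ⟨
      productCoeff α s X′ E + productCoeff (suc b) s Y (λ e → O e + ratio * E e)
        ≈⟨ +-congˡ (productCoeff-cong (suc b) s (λ i _ → refl) (λ e _ → sym (O′≈ e))) ⟩
      productCoeff α s X′ E + productCoeff (suc b) s Y O′ ∎
      where
      rearrange : ∀ a l o → (a + l) + o ≈ a + (o + l)
      rearrange = solve 3 (λ a l o → (a :+ l) :+ o := a :+ (o :+ l)) refl

    s<α+b⇒ : ∀ s → s < α ℕ.+ b → suc s < α ℕ.+ suc b
    s<α+b⇒ s s< = ≡.subst (suc s <_) (≡.sym (NP.+-suc α b)) (s≤s s<)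

    s<α+b⇐ : ∀ s → suc s < α ℕ.+ suc b → s < α ℕ.+ b
    s<α+b⇐ s s< = NP.≤-pred (≡.subst (suc s <_) (NP.+-suc α b) s<)

    step⇒ : PadeRelation α (suc b) X Y → PadeRelation α b (X′ ∘ suc) Y
    step⇒ rel = record
      { E = E ; O = O′ ∘ suc ; E-degree = E-degree
      ; O-degree = λ e b≤e → +-≈0 (O-degree (suc e) (s≤s b≤e)) (ratio*E≈0 E E-degree (suc e) (s≤s b≤e))
      ; nontrivial = nontrivial′
      ; vanishes = λ s s< → begin
          productCoeff α s (X′ ∘ suc) E + productCoeff b s Y (O′ ∘ suc)
            ≈⟨ +-cong (sym (productCoeff-tail α s X′ E X′₀≈0)) (sym (+-identityˡ _)) ⟩
          productCoeff α (suc s) X′ E + (0# + productCoeff b s Y (O′ ∘ suc))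
            ≈⟨ +-congˡ (+-congʳ (sym (*-≈0ʳ _ O′₀≈0))) ⟩
          productCoeff α (suc s) X′ E + productCoeff (suc b) (suc s) Y O′
            ≈⟨ vanishes′ (suc s) (s<α+b⇒ s s<) ⟩
          0# ∎ }
      where
      open PadeRelation rel
      O′ : Series
      O′ e = O e + ratio * E e
      vanishes′ : ∀ s → s < α ℕ.+ suc b → productCoeff α s X′ E + productCoeff (suc b) s Y O′ ≈ 0#
      vanishes′ s s< = trans (sym (equations-invariant E O O′ E-degree (λ e → refl) s)) (vanishes s s<)
      O′₀≈0 : O′ 0 ≈ 0#
      O′₀≈0 = *-cancelˡ-≈0 (Y 0) (O′ 0) Y₀≉0 (begin
        Y 0 * O′ 0                                              ≈⟨ productCoeff-constant b Y O′ ⟨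
        productCoeff (suc b) 0 Y O′                             ≈⟨ +-identityˡ _ ⟨
        0# + productCoeff (suc b) 0 Y O′                        ≈⟨ +-congʳ (productCoeff-0 α X′ E X′₀≈0) ⟨
        productCoeff α 0 X′ E + productCoeff (suc b) 0 Y O′     ≈⟨ vanishes′ 0 (≡.subst (0 <_) (≡.sym (NP.+-suc α b)) (s≤s z≤n)) ⟩
        0#                                                      ∎)
      O′≈O : (∀ e → e < α → E e ≈ 0#) → ∀ e → O′ e ≈ O e
      O′≈O E≈0 e = trans (+-congˡ (*-≈0ʳ ratio (vanishing-by-degree E E≈0 E-degree e))) (+-identityʳ _)
      nontrivial′ : NonzeroBelow α E ⊎ NonzeroBelow b (O′ ∘ suc)
      nontrivial′ with nontrivial
      ... | inj₁ E≉0 = inj₁ E≉0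
      ... | inj₂ (e , e<b+1 , Oe≉0) with nonzeroBelow? α E
      ...   | inj₁ E≉0 = inj₁ E≉0
      ...   | inj₂ E≈0 with e
      ...     | zero    = ⊥-elim (Oe≉0 (trans (sym (O′≈O E≈0 0)) O′₀≈0))
      ...     | suc e′  = inj₂ (e′ , NP.≤-pred e<b+1 , λ O′e≈0 → Oe≉0 (trans (sym (O′≈O E≈0 (suc e′))) O′e≈0))

    step⇐ : PadeRelation α b (X′ ∘ suc) Y → PadeRelation α (suc b) X Y
    step⇐ rel = record
      { E = E ; O = O ; E-degree = E-degree ; O-degree = O-degree′ ; nontrivial = nontrivial′ ; vanishes = vanishes′ }
      where
      open PadeRelation rel renaming (O to Õ; O-degree to Õ-degree; vanishes to Õ-vanishes)
      zÕ : Series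
      zÕ zero = 0#
      zÕ (suc e) = Õ e
      O : Series
      O e = zÕ e + (- ratio) * E e
      zÕ≈O+ratio*E : ∀ e → zÕ e ≈ O e + ratio * E e
      zÕ≈O+ratio*E e = sym (begin
        (zÕ e + (- ratio) * E e) + ratio * E e  ≈⟨ +-assoc _ _ _ ⟩
        zÕ e + ((- ratio) * E e + ratio * E e)  ≈⟨ +-congˡ (+-congʳ (sym (-‿distribˡ-* _ _))) ⟩
        zÕ e + (- (ratio * E e) + ratio * E e)  ≈⟨ +-congˡ (-‿inverseˡ _) ⟩
        zÕ e + 0#                               ≈⟨ +-identityʳ _ ⟩
        zÕ e                                    ∎)
      O-degree′ : ∀ e → suc b ≤ e → O e ≈ 0#
      O-degree′ (suc e) (s≤s b≤e) =
        +-≈0 (Õ-degree e b≤e) (-*-≈0 ratio (E (suc e)) (ratio*E≈0 E E-degree (suc e) (s≤s b≤e)))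
      vanishes′ : ∀ s → s < α ℕ.+ suc b → productCoeff α s X E + productCoeff (suc b) s Y O ≈ 0#
      vanishes′ zero s< = begin
        productCoeff α 0 X E + productCoeff (suc b) 0 Y O      ≈⟨ equations-invariant E O zÕ E-degree zÕ≈O+ratio*E 0 ⟩
        productCoeff α 0 X′ E + productCoeff (suc b) 0 Y zÕ    ≈⟨ +-cong (productCoeff-0 α X′ E X′₀≈0) (productCoeff-constant b Y zÕ) ⟩
        0# + Y 0 * 0#                                          ≈⟨ +-≈0 refl (zeroʳ _) ⟩
        0#                                                     ∎
      vanishes′ (suc s) s< = begin
        productCoeff α (suc s) X E + productCoeff (suc b) (suc s) Y O
          ≈⟨ equations-invariant E O zÕ E-degree zÕ≈O+ratio*E (suc s) ⟩
        productCoeff α (suc s) X′ E + (Y (suc s) * 0# + productCoeff b s Y Õ)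
          ≈⟨ +-cong (productCoeff-tail α s X′ E X′₀≈0) (trans (+-congʳ (zeroʳ _)) (+-identityˡ _)) ⟩
        productCoeff α s (X′ ∘ suc) E + productCoeff b s Y Õ
          ≈⟨ Õ-vanishes s (s<α+b⇐ s s<) ⟩
        0# ∎
      nontrivial′ : NonzeroBelow α E ⊎ NonzeroBelow (suc b) O
      nontrivial′ with nontrivial
      ... | inj₁ E≉0 = inj₁ E≉0
      ... | inj₂ (e , e<b , Õe≉0) with nonzeroBelow? α E
      ...   | inj₁ E≉0 = inj₁ E≉0
      ...   | inj₂ E≈0 = inj₂ (suc e , s≤s e<b , λ Oe≈0 → Õe≉0 (trans (sym (trans (+-congˡ
                 (-*-≈0 ratio _ (*-≈0ʳ ratio (vanishing-by-degree E E≈0 E-degree (suc e))))) (+-identityʳ _))) Oe≈0))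

  -- Decides PadeRelation (fuel n = α + β) when Y(0) ≠ 0, swapping the roles of X and Y
  -- whenever the Euclid step would not preserve the degree bound.
  hasRelation : ℕ → ℕ → ℕ → Series → Series → Bool
  hasRelation n α zero X Y = isZero (X 0)
  hasRelation zero α (suc β) X Y = false
  hasRelation (suc n) α (suc β) X Y with α ℕ.≤? suc β | X 0 ≟ 0#
  ... | yes _ | _     = hasRelation n α β (euclidReduce X Y) Y
  ... | no _  | yes _ = hasRelation n α β (euclidReduce X Y) Y
  ... | no _  | no _  = hasRelation n (suc β) (ℕ.pred α) (euclidReduce Y X) X

  isZero-true : ∀ x → x ≈ 0# → isZero x ≡ true
  isZero-true x x≈0 with x ≟ 0#
  ... | yes _  = ≡.refl
  ... | no x≉0 = ⊥-elim (x≉0 x≈0)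

  isZero-true⁻¹ : ∀ x → isZero x ≡ true → x ≈ 0#
  isZero-true⁻¹ x eq with x ≟ 0#
  ... | yes x≈0 = x≈0
  ... | no _ with eq
  ...   | ()

  euclidStep-correct : ∀ α b X Y → ¬ (Y 0 ≈ 0#) → α ≤ suc b ⊎ X 0 ≈ 0# →
    PadeRelation α (suc b) X Y ⇔ PadeRelation α b (euclidReduce X Y) Y
  euclidStep-correct α b X Y Y₀≉0 cond = mk⇔ step⇒ step⇐
    where open EuclidStep {α} {b} {X} {Y} Y₀≉0 cond

  +-suc-injective : ∀ a b n → a ℕ.+ suc b ≡ suc n → a ℕ.+ b ≡ n
  +-suc-injective a b n eq = NP.suc-injective (≡.trans (≡.sym (NP.+-suc a b)) eq)

  hasRelation-correct : ∀ n a β X Y → suc a ℕ.+ β ≡ n → ¬ (Y 0 ≈ 0#) →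
    PadeRelation (suc a) β X Y ⇔ (hasRelation n (suc a) β X Y ≡ true)
  hasRelation-correct n a zero X Y _ Y₀≉0 =
    mk⇔ (λ rel → isZero-true (X 0) (relation₀⇒X₀≈0 rel)) (λ eq → X₀≈0⇒relation₀ (isZero-true⁻¹ (X 0) eq))
  hasRelation-correct zero a (suc b) X Y () Y₀≉0
  hasRelation-correct (suc n) a (suc b) X Y a+b+2≡n+1 Y₀≉0 with suc a ℕ.≤? suc b | X 0 ≟ 0#
  ... | yes a≤b | _        =
    ⇔-trans (euclidStep-correct (suc a) b X Y Y₀≉0 (inj₁ a≤b))
            (hasRelation-correct n a b (euclidReduce X Y) Y (+-suc-injective (suc a) b n a+b+2≡n+1) Y₀≉0)
  ... | no _    | yes X₀≈0 =
    ⇔-trans (euclidStep-correct (suc a) b X Y Y₀≉0 (inj₂ X₀≈0))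
            (hasRelation-correct n a b (euclidReduce X Y) Y (+-suc-injective (suc a) b n a+b+2≡n+1) Y₀≉0)
  ... | no a≰b  | no X₀≉0  =
    ⇔-trans (mk⇔ relation-swap relation-swap)
      (⇔-trans (euclidStep-correct (suc b) a Y X X₀≉0 (inj₁ (NP.<⇒≤ (NP.≰⇒> a≰b))))
               (hasRelation-correct n b a (euclidReduce Y X) X b+a+1≡n X₀≉0))
    where
    b+a+1≡n : suc b ℕ.+ a ≡ n
    b+a+1≡n = ≡.trans (NP.+-comm (suc b) a) (NP.suc-injective a+b+2≡n+1)

  hasRelation-cong : ∀ n a β {X Y X′ Y′} → suc a ℕ.+ β ≡ n → ¬ (Y 0 ≈ 0#) →
    (∀ i → i < n → X i ≈ X′ i) → (∀ i → i < n → Y i ≈ Y′ i) →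
    hasRelation n (suc a) β X Y ≡ hasRelation n (suc a) β X′ Y′
  hasRelation-cong n a β {X} {Y} {X′} {Y′} a+β+1≡n Y₀≉0 X≈X′ Y≈Y′ = ⇔→≡ (mk⇔
    (λ eq → Equivalence.to decides′ (relation-cong X≈X′ₙ Y≈Y′ₙ (Equivalence.from decides eq)))
    (λ eq → Equivalence.to decides (relation-cong (λ i i< → sym (X≈X′ₙ i i<)) (λ i i< → sym (Y≈Y′ₙ i i<)) (Equivalence.from decides′ eq))))
    where
    X≈X′ₙ : ∀ i → i < suc a ℕ.+ β → X i ≈ X′ i
    X≈X′ₙ i i< = X≈X′ i (≡.subst (i <_) a+β+1≡n i<)
    Y≈Y′ₙ : ∀ i → i < suc a ℕ.+ β → Y i ≈ Y′ i
    Y≈Y′ₙ i i< = Y≈Y′ i (≡.subst (i <_) a+β+1≡n i<)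
    decides : PadeRelation (suc a) β X Y ⇔ (hasRelation n (suc a) β X Y ≡ true)
    decides = hasRelation-correct n a β X Y a+β+1≡n Y₀≉0
    decides′ : PadeRelation (suc a) β X′ Y′ ⇔ (hasRelation n (suc a) β X′ Y′ ≡ true)
    decides′ = hasRelation-correct n a β X′ Y′ a+β+1≡n (λ Y′₀≈0 → Y₀≉0 (trans (Y≈Y′ₙ 0 (s≤s z≤n)) Y′₀≈0))

  hasRelation-scale : ∀ n a β x {X Y} → suc a ℕ.+ β ≡ n → ¬ (Y 0 ≈ 0#) → ¬ (x ≈ 0#) →
    hasRelation n (suc a) β (λ i → x * X i) (λ i → x * Y i) ≡ hasRelation n (suc a) β X Y
  hasRelation-scale n a β x {X} {Y} a+β+1≡n Y₀≉0 x≉0 = ⇔→≡ (mk⇔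
    (λ eq → Equivalence.to decides (relation-scale⇐ x x≉0 (Equivalence.from decidesₓ eq)))
    (λ eq → Equivalence.to decidesₓ (relation-scale⇒ x (Equivalence.from decides eq))))
    where
    decides : PadeRelation (suc a) β X Y ⇔ (hasRelation n (suc a) β X Y ≡ true)
    decides = hasRelation-correct n a β X Y a+β+1≡n Y₀≉0
    decidesₓ : PadeRelation (suc a) β (λ i → x * X i) (λ i → x * Y i) ⇔
               (hasRelation n (suc a) β (λ i → x * X i) (λ i → x * Y i) ≡ true)
    decidesₓ = hasRelation-correct n a β _ _ a+β+1≡n (λ xY₀≈0 → Y₀≉0 (*-cancelˡ-≈0 x (Y 0) x≉0 xY₀≈0))

  hasRelation-step : ∀ m α b X Y → (α ≤ suc b ⊎ X 0 ≈ 0#) →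
    hasRelation (suc m) α (suc b) X Y ≡ hasRelation m α b (euclidReduce X Y) Y
  hasRelation-step m α b X Y cond with α ℕ.≤? suc b | X 0 ≟ 0#
  ... | yes _   | _         = ≡.refl
  ... | no _    | yes _     = ≡.refl
  ... | no α≰b  | no X₀≉0   = ⊥-elim ([ α≰b , X₀≉0 ]′ cond)

  hasRelation-swapStep : ∀ m α b X Y → ¬ (α ≤ suc b) → ¬ (X 0 ≈ 0#) →
    hasRelation (suc m) α (suc b) X Y ≡ hasRelation m (suc b) (ℕ.pred α) (euclidReduce Y X) X
  hasRelation-swapStep m α b X Y α≰b X₀≉0 with α ℕ.≤? suc b | X 0 ≟ 0#
  ... | yes α≤b | _         = ⊥-elim (α≰b α≤b)
  ... | no _    | yes X₀≈0  = ⊥-elim (X₀≉0 X₀≈0)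
  ... | no _    | no _      = ≡.refl


module Counting {c ℓ q} (F : Defs.FiniteField c ℓ q) where

  open import Level using (_⊔_)
  open import Data.Nat as ℕ using (ℕ; zero; suc; _<_; s≤s; _+_; _*_; _^_)
  import Data.Nat.Properties as NP
  open import Data.Fin as Fin using (Fin)
  import Data.Fin.Properties as FinP
  open import Data.Product using (_,_)
  open import Data.Bool using (Bool; true; false; if_then_else_)
  open import Relation.Binary.PropositionalEquality as ≡ using (_≡_; _≢_; cong; trans; sym)
  open import Relation.Nullary using (¬_; yes; no)
  open import Data.Empty using (⊥-elim)
  open import Function using (_∘_)
  open import Function.Bundles using (Inverse)
  open import Data.Fin.Permutation using (Permutation; permutation)
  import Function.Consequences.Setoid as Consequences

  open Defs.FiniteField F using (commRing; setoid; _≟_; 0≉1; enum)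
  open Inverse enum using (to; from; from-cong; strictlyInverseˡ; strictlyInverseʳ)
  private module R = CommutativeRing commRing
  open R using (Carrier; _≈_; 0#; 1#; -_) renaming (_+_ to _+F_; _*_ to _*F_)
  open FieldLemmas F using (Series; isZero; _⁻¹; x*x⁻¹≈1; x⁻¹*x≈1; r+a[a⁻¹[u-r]]≈u; a⁻¹[[r+at]-r]≈t)
  open import Algebra.Properties.Semiring.Sum NP.+-*-semiring using (sum; sum-permute; ∑-comm; ∑-distrib-+; sum-cong-≗)
  open ≡.≡-Reasoning

  Respects≈ : (Carrier → ℕ) → Set (c ⊔ ℓ)
  Respects≈ g = ∀ {x y} → x ≈ y → g x ≡ g y

  sum-factorˡ : ∀ {n} k (f : Fin n → ℕ) → sum (λ a → k * f a) ≡ k * sum f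
  sum-factorˡ {zero} k f = sym (NP.*-zeroʳ k)
  sum-factorˡ {suc n} k f = trans (cong (k * f Fin.zero +_) (sum-factorˡ k (f ∘ Fin.suc))) (sym (NP.*-distribˡ-+ k _ _))

  sum-const : ∀ n k → sum {n} (λ _ → k) ≡ n * k
  sum-const zero k = ≡.refl
  sum-const (suc n) k = cong (k +_) (sum-const n k)

  sum-≡0 : ∀ {n} (f : Fin n → ℕ) → (∀ a → f a ≡ 0) → sum f ≡ 0
  sum-≡0 {n} f f≡0 = trans (sum-cong-≗ {n} {f} {λ _ → 0} f≡0) (trans (sum-const n 0) (NP.*-zeroʳ n))

  sum-single : ∀ {n} (f : Fin n → ℕ) i → (∀ a → a ≢ i → f a ≡ 0) → sum f ≡ f i
  sum-single {suc n} f Fin.zero off = trans (cong (f Fin.zero +_) (sum-≡0 (f ∘ Fin.suc) (λ a → off (Fin.suc a) (λ ())))) (NP.+-identityʳ _)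
  sum-single {suc n} f (Fin.suc i) off = trans (cong (_+ sum (f ∘ Fin.suc)) (off Fin.zero (λ ())))
    (sum-single (f ∘ Fin.suc) i (λ a a≢i → off (Fin.suc a) (a≢i ∘ FinP.suc-injective)))

  ΣF : (Carrier → ℕ) → ℕ
  ΣF g = sum (λ a → g (to a))

  ΣF-cong : ∀ {g h : Carrier → ℕ} → (∀ x → g x ≡ h x) → ΣF g ≡ ΣF h
  ΣF-cong {g} {h} g≡h = sum-cong-≗ {q} {λ a → g (to a)} {λ a → h (to a)} (λ a → g≡h (to a))

  ΣF-distrib-+ : ∀ (g h : Carrier → ℕ) → ΣF (λ x → g x + h x) ≡ ΣF g + ΣF h
  ΣF-distrib-+ g h = ∑-distrib-+ (λ a → g (to a)) (λ a → h (to a))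

  ΣF-factorˡ : ∀ k (g : Carrier → ℕ) → ΣF (λ x → k * g x) ≡ k * ΣF g
  ΣF-factorˡ k g = sum-factorˡ k (λ a → g (to a))

  ΣF-const : ∀ k → ΣF (λ _ → k) ≡ q * k
  ΣF-const k = sum-const q k

  ΣF-comm : ∀ (g : Carrier → Carrier → ℕ) → ΣF (λ x → ΣF (λ y → g x y)) ≡ ΣF (λ y → ΣF (λ x → g x y))
  ΣF-comm g = ∑-comm (λ a b → g (to a) (to b))

  mkFieldPermutation : (σ σ⁻¹ : Carrier → Carrier) →
    (∀ {x y} → x ≈ y → σ x ≈ σ y) → (∀ {x y} → x ≈ y → σ⁻¹ x ≈ σ⁻¹ y) →
    (∀ x → σ (σ⁻¹ x) ≈ x) → (∀ x → σ⁻¹ (σ x) ≈ x) → Inverse setoid setoid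
  mkFieldPermutation σ σ⁻¹ σ-cong σ⁻¹-cong σσ⁻¹ σ⁻¹σ = record
    { to = σ ; from = σ⁻¹ ; to-cong = σ-cong ; from-cong = σ⁻¹-cong
    ; inverse = Consequences.strictlyInverseˡ⇒inverseˡ setoid setoid σ-cong σσ⁻¹
              , Consequences.strictlyInverseʳ⇒inverseʳ setoid setoid σ⁻¹-cong σ⁻¹σ }

  ΣF-permute : ∀ (π : Inverse setoid setoid) (g : Carrier → ℕ) → Respects≈ g → ΣF (λ x → g (Inverse.to π x)) ≡ ΣF g
  ΣF-permute π g g-resp = sym (begin
    sum (λ a → g (to a))                          ≡⟨ sum-permute (λ a → g (to a)) πFin ⟩
    sum (λ a → g (to (from (σ (to a)))))          ≡⟨ sum-cong-≗ (λ a → g-resp (strictlyInverseˡ (σ (to a)))) ⟩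
    sum (λ a → g (σ (to a)))                      ∎)
    where
    open Inverse π using () renaming (to to σ; from to σ⁻¹; to-cong to σ-cong; from-cong to σ⁻¹-cong)
    πFin : Permutation q q
    πFin = permutation (λ a → from (σ (to a))) (λ b → from (σ⁻¹ (to b)))
      (λ b → trans (from-cong (R.trans (σ-cong (strictlyInverseˡ (σ⁻¹ (to b)))) (Inverse.strictlyInverseˡ π (to b)))) (strictlyInverseʳ b))
      (λ a → trans (from-cong (R.trans (σ⁻¹-cong (strictlyInverseˡ (σ (to a)))) (Inverse.strictlyInverseʳ π (to a)))) (strictlyInverseʳ a))

  ifZero ifNonzero : Carrier → ℕ → ℕ
  ifZero x k = if isZero x then k else 0
  ifNonzero x k = if isZero x then 0 else k

  bool→ℕ : Bool → ℕ
  bool→ℕ true = 1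
  bool→ℕ false = 0

  isZero-cong : ∀ {x y} → x ≈ y → isZero x ≡ isZero y
  isZero-cong {x} {y} x≈y with x ≟ 0# | y ≟ 0#
  ... | yes _    | yes _    = ≡.refl
  ... | no _     | no _     = ≡.refl
  ... | yes x≈0  | no y≉0   = ⊥-elim (y≉0 (R.trans (R.sym x≈y) x≈0))
  ... | no x≉0   | yes y≈0  = ⊥-elim (x≉0 (R.trans x≈y y≈0))

  ifZero+ifNonzero : ∀ x k → ifZero x k + ifNonzero x k ≡ k
  ifZero+ifNonzero x k with isZero x
  ... | true  = NP.+-identityʳ k
  ... | false = ≡.refl

  ΣF-ifZero : ∀ (g : Carrier → ℕ) → Respects≈ g → ΣF (λ x → ifZero x (g x)) ≡ g 0#
  ΣF-ifZero g g-resp = trans (sum-single (λ a → ifZero (to a) (g (to a))) (from 0#) off) at0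
    where
    off : ∀ a → a ≢ from 0# → ifZero (to a) (g (to a)) ≡ 0
    off a a≢ with to a ≟ 0#
    ... | no _     = ≡.refl
    ... | yes a≈0  = ⊥-elim (a≢ (trans (sym (strictlyInverseʳ a)) (from-cong a≈0)))
    at0 : ifZero (to (from 0#)) (g (to (from 0#))) ≡ g 0#
    at0 with to (from 0#) ≟ 0#
    ... | yes _   = g-resp (strictlyInverseˡ 0#)
    ... | no ≉0   = ⊥-elim (≉0 (strictlyInverseˡ 0#))

  ΣF-split0 : ∀ (g : Carrier → ℕ) → Respects≈ g → ΣF g ≡ g 0# + ΣF (λ x → ifNonzero x (g x))
  ΣF-split0 g g-resp = begin
    ΣF g                                                          ≡⟨ ΣF-cong (λ x → sym (ifZero+ifNonzero x (g x))) ⟩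
    ΣF (λ x → ifZero x (g x) + ifNonzero x (g x))                 ≡⟨ ΣF-distrib-+ (λ x → ifZero x (g x)) (λ x → ifNonzero x (g x)) ⟩
    ΣF (λ x → ifZero x (g x)) + ΣF (λ x → ifNonzero x (g x))      ≡⟨ cong (_+ ΣF (λ x → ifNonzero x (g x))) (ΣF-ifZero g g-resp) ⟩
    g 0# + ΣF (λ x → ifNonzero x (g x))                           ∎

  ΣF-ifNonzero+k : ∀ k → ΣF (λ x → ifNonzero x k) + k ≡ q * k
  ΣF-ifNonzero+k k = trans (NP.+-comm _ k) (sym (trans (sym (ΣF-const k)) (ΣF-split0 (λ _ → k) (λ _ → ≡.refl))))

  _∷ₛ_ : Carrier → Series → Series
  (a ∷ₛ X) zero = a
  (a ∷ₛ X) (suc i) = X i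

  0ₛ : Series
  0ₛ _ = 0#

  -- ΣFⁿ n g sums g over the series whose coefficients vanish from index n on, i.e. over Fⁿ.
  ΣFⁿ : ℕ → (Series → ℕ) → ℕ
  ΣFⁿ zero g = g 0ₛ
  ΣFⁿ (suc n) g = ΣF (λ a → ΣFⁿ n (λ X → g (a ∷ₛ X)))

  DependsOnFirst : ℕ → (Series → ℕ) → Set (c ⊔ ℓ)
  DependsOnFirst n g = ∀ {X Y} → (∀ i → i < n → X i ≈ Y i) → g X ≡ g Y

  DependsOnFirst-∷ : ∀ n (g : Series → ℕ) → DependsOnFirst (suc n) g → ∀ a → DependsOnFirst n (λ X → g (a ∷ₛ X))
  DependsOnFirst-∷ n g g-dep a X≈Y = g-dep λ { zero _ → R.refl ; (suc i) (s≤s i<n) → X≈Y i i<n }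

  ΣFⁿ-cong : ∀ n {g h : Series → ℕ} → (∀ X → g X ≡ h X) → ΣFⁿ n g ≡ ΣFⁿ n h
  ΣFⁿ-cong zero g≡h = g≡h 0ₛ
  ΣFⁿ-cong (suc n) g≡h = ΣF-cong (λ a → ΣFⁿ-cong n (λ X → g≡h (a ∷ₛ X)))

  ΣFⁿ-respects-head : ∀ n (g : Series → ℕ) → DependsOnFirst (suc n) g → Respects≈ (λ a → ΣFⁿ n (λ X → g (a ∷ₛ X)))
  ΣFⁿ-respects-head n g g-dep {a} {b} a≈b =
    ΣFⁿ-cong n (λ X → g-dep {a ∷ₛ X} {b ∷ₛ X} λ { zero _ → a≈b ; (suc i) _ → R.refl })

  ΣFⁿ-distrib-+ : ∀ n (g h : Series → ℕ) → ΣFⁿ n (λ X → g X + h X) ≡ ΣFⁿ n g + ΣFⁿ n h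
  ΣFⁿ-distrib-+ zero g h = ≡.refl
  ΣFⁿ-distrib-+ (suc n) g h = trans (ΣF-cong (λ a → ΣFⁿ-distrib-+ n (λ X → g (a ∷ₛ X)) (λ X → h (a ∷ₛ X))))
    (ΣF-distrib-+ (λ a → ΣFⁿ n (λ X → g (a ∷ₛ X))) (λ a → ΣFⁿ n (λ X → h (a ∷ₛ X))))

  ΣFⁿ-factorˡ : ∀ n k (g : Series → ℕ) → ΣFⁿ n (λ X → k * g X) ≡ k * ΣFⁿ n g
  ΣFⁿ-factorˡ zero k g = ≡.refl
  ΣFⁿ-factorˡ (suc n) k g =
    trans (ΣF-cong (λ a → ΣFⁿ-factorˡ n k (λ X → g (a ∷ₛ X)))) (ΣF-factorˡ k (λ a → ΣFⁿ n (λ X → g (a ∷ₛ X))))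

  ΣFⁿ-const : ∀ n k → ΣFⁿ n (λ _ → k) ≡ q ^ n * k
  ΣFⁿ-const zero k = sym (NP.+-identityʳ k)
  ΣFⁿ-const (suc n) k = trans (ΣF-cong (λ a → ΣFⁿ-const n k)) (trans (ΣF-const _) (sym (NP.*-assoc q (q ^ n) k)))

  ΣF-ΣFⁿ-comm : ∀ m (h : Carrier → Series → ℕ) → ΣF (λ a → ΣFⁿ m (λ Y → h a Y)) ≡ ΣFⁿ m (λ Y → ΣF (λ a → h a Y))
  ΣF-ΣFⁿ-comm zero h = ≡.refl
  ΣF-ΣFⁿ-comm (suc m) h = trans (ΣF-comm (λ a b → ΣFⁿ m (λ Y → h a (b ∷ₛ Y))))
    (ΣF-cong {λ b → ΣF (λ a → ΣFⁿ m (λ Y → h a (b ∷ₛ Y)))} {λ b → ΣFⁿ m (λ Y → ΣF (λ a → h a (b ∷ₛ Y)))}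
      (λ b → ΣF-ΣFⁿ-comm m (λ a Y → h a (b ∷ₛ Y))))

  ΣFⁿ-comm : ∀ n m (g : Series → Series → ℕ) →
    ΣFⁿ n (λ X → ΣFⁿ m (λ Y → g X Y)) ≡ ΣFⁿ m (λ Y → ΣFⁿ n (λ X → g X Y))
  ΣFⁿ-comm zero m g = ≡.refl
  ΣFⁿ-comm (suc n) m g = trans (ΣF-cong (λ a → ΣFⁿ-comm n m (λ X Y → g (a ∷ₛ X) Y)))
    (ΣF-ΣFⁿ-comm m (λ a Y → ΣFⁿ n (λ X → g (a ∷ₛ X) Y)))

  ΣFⁿ-unusedCoordinate : ∀ n (g : Series → ℕ) → DependsOnFirst n g → ΣFⁿ (suc n) g ≡ q * ΣFⁿ n g
  ΣFⁿ-unusedCoordinate zero g g-dep =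
    trans (ΣF-cong {λ a → g (a ∷ₛ 0ₛ)} {λ _ → g 0ₛ} (λ a → g-dep {a ∷ₛ 0ₛ} {0ₛ} (λ i ()))) (ΣF-const _)
  ΣFⁿ-unusedCoordinate (suc n) g g-dep = begin
    ΣF (λ a → ΣFⁿ (suc n) (λ X → g (a ∷ₛ X)))
      ≡⟨ ΣF-cong (λ a → ΣFⁿ-unusedCoordinate n (λ X → g (a ∷ₛ X)) (DependsOnFirst-∷ n g g-dep a)) ⟩
    ΣF (λ a → q * ΣFⁿ n (λ X → g (a ∷ₛ X)))
      ≡⟨ ΣF-factorˡ q (λ a → ΣFⁿ n (λ X → g (a ∷ₛ X))) ⟩
    q * ΣFⁿ (suc n) g ∎

  ΣFⁿ-unusedCoordinates : ∀ M d (g : Series → ℕ) → DependsOnFirst M g → ΣFⁿ (M + d) g ≡ q ^ d * ΣFⁿ M g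
  ΣFⁿ-unusedCoordinates M zero g g-dep = trans (cong (λ n → ΣFⁿ n g) (NP.+-identityʳ M)) (sym (NP.+-identityʳ _))
  ΣFⁿ-unusedCoordinates M (suc d) g g-dep = begin
    ΣFⁿ (M + suc d) g      ≡⟨ cong (λ n → ΣFⁿ n g) (NP.+-suc M d) ⟩
    ΣFⁿ (suc (M + d)) g    ≡⟨ ΣFⁿ-unusedCoordinate (M + d) g (λ X≈Y → g-dep (λ i i<M → X≈Y i (NP.<-≤-trans i<M (NP.m≤m+n M d)))) ⟩
    q * ΣFⁿ (M + d) g      ≡⟨ cong (q *_) (ΣFⁿ-unusedCoordinates M d g g-dep) ⟩
    q * (q ^ d * ΣFⁿ M g)  ≡⟨ sym (NP.*-assoc q (q ^ d) _) ⟩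
    q ^ suc d * ΣFⁿ M g    ∎

  ΣFⁿ-permute : ∀ n (π : ℕ → Inverse setoid setoid) (g : Series → ℕ) → DependsOnFirst n g →
    ΣFⁿ n (λ X → g (λ i → Inverse.to (π i) (X i))) ≡ ΣFⁿ n g
  ΣFⁿ-permute zero π g g-dep = g-dep (λ i ())
  ΣFⁿ-permute (suc n) π g g-dep = begin
    ΣF (λ a → ΣFⁿ n (λ X → g (λ i → σ i ((a ∷ₛ X) i))))
      ≡⟨ ΣF-cong (λ a → ΣFⁿ-cong n (λ X → g-dep {λ i → σ i ((a ∷ₛ X) i)} {σ 0 a ∷ₛ (λ i → σ (suc i) (X i))}
                                                 λ { zero _ → R.refl ; (suc i) _ → R.refl })) ⟩
    ΣF (λ a → ΣFⁿ n (λ X → g (σ 0 a ∷ₛ (λ i → σ (suc i) (X i)))))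
      ≡⟨ ΣF-cong (λ a → ΣFⁿ-permute n (π ∘ suc) (λ X → g (σ 0 a ∷ₛ X)) (DependsOnFirst-∷ n g g-dep _)) ⟩
    ΣF (λ a → ΣFⁿ n (λ X → g (σ 0 a ∷ₛ X)))
      ≡⟨ ΣF-permute (π 0) (λ b → ΣFⁿ n (λ X → g (b ∷ₛ X))) (ΣFⁿ-respects-head n g g-dep) ⟩
    ΣF (λ b → ΣFⁿ n (λ X → g (b ∷ₛ X))) ∎
    where
    σ : ℕ → Carrier → Carrier
    σ i = Inverse.to (π i)

  ΣFⁿ-ifNonzero : ∀ n x (g : Series → ℕ) → ΣFⁿ n (λ X → ifNonzero x (g X)) ≡ ifNonzero x (ΣFⁿ n g)
  ΣFⁿ-ifNonzero n x g with isZero x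
  ... | true  = trans (ΣFⁿ-const n 0) (NP.*-zeroʳ (q ^ n))
  ... | false = ≡.refl

  ifNonzero-+ : ∀ x a b → ifNonzero x a + ifNonzero x b ≡ ifNonzero x (a + b)
  ifNonzero-+ x a b with isZero x
  ... | true  = ≡.refl
  ... | false = ≡.refl

  ifNonzero-* : ∀ x k a → ifNonzero x (k * a) ≡ k * ifNonzero x a
  ifNonzero-* x k a with isZero x
  ... | true  = sym (NP.*-zeroʳ k)
  ... | false = ≡.refl

  bool→ℕ-isZero : ∀ x → bool→ℕ (isZero x) ≡ ifZero x 1
  bool→ℕ-isZero x with isZero x
  ... | true  = ≡.refl
  ... | false = ≡.refl

  setCoeff : Series → ℕ → Carrier → Series
  setCoeff X zero t zero = t
  setCoeff X zero t (suc i) = X (suc i)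
  setCoeff X (suc n) t zero = X 0
  setCoeff X (suc n) t (suc i) = setCoeff (X ∘ suc) n t i

  setCoeff-≢ : ∀ X n t i → i ≢ n → setCoeff X n t i ≡ X i
  setCoeff-≢ X zero t zero i≢n = ⊥-elim (i≢n ≡.refl)
  setCoeff-≢ X zero t (suc i) _ = ≡.refl
  setCoeff-≢ X (suc n) t zero _ = ≡.refl
  setCoeff-≢ X (suc n) t (suc i) i≢n = setCoeff-≢ (X ∘ suc) n t i (i≢n ∘ cong suc)

  setCoeff-≡ : ∀ X n t → setCoeff X n t n ≡ t
  setCoeff-≡ X zero t = ≡.refl
  setCoeff-≡ X (suc n) t = setCoeff-≡ (X ∘ suc) n t

  ΣFⁿ-split-last : ∀ n (g : Series → ℕ) → DependsOnFirst (suc n) g →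
    ΣFⁿ (suc n) g ≡ ΣFⁿ n (λ X → ΣF (λ t → g (setCoeff X n t)))
  ΣFⁿ-split-last zero g g-dep = ΣF-cong (λ a → g-dep {a ∷ₛ 0ₛ} {setCoeff 0ₛ 0 a} (λ { zero _ → R.refl ; (suc i) (s≤s ()) }))
  ΣFⁿ-split-last (suc n) g g-dep = begin
    ΣF (λ a → ΣFⁿ (suc n) (λ X → g (a ∷ₛ X)))
      ≡⟨ ΣF-cong (λ a → ΣFⁿ-split-last n (λ X → g (a ∷ₛ X)) (DependsOnFirst-∷ (suc n) g g-dep a)) ⟩
    ΣF (λ a → ΣFⁿ n (λ X → ΣF (λ t → g (a ∷ₛ setCoeff X n t))))
      ≡⟨ ΣF-cong (λ a → ΣFⁿ-cong n (λ X → ΣF-cong (λ t →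
           g-dep {a ∷ₛ setCoeff X n t} {setCoeff (a ∷ₛ X) (suc n) t} (λ { zero _ → R.refl ; (suc i) _ → R.refl })))) ⟩
    ΣFⁿ (suc n) (λ X → ΣF (λ t → g (setCoeff X (suc n) t))) ∎

  translation : Carrier → Inverse setoid setoid
  translation t = mkFieldPermutation (λ x → x +F t) (λ x → x +F (- t)) R.+-congʳ R.+-congʳ
    (λ x → R.trans (R.+-assoc _ _ _) (R.trans (R.+-congˡ (R.-‿inverseˡ t)) (R.+-identityʳ x)))
    (λ x → R.trans (R.+-assoc _ _ _) (R.trans (R.+-congˡ (R.-‿inverseʳ t)) (R.+-identityʳ x)))

  scaling : ∀ x → ¬ (x ≈ 0#) → Inverse setoid setoid
  scaling x x≉0 = mkFieldPermutation (x *F_) (x ⁻¹ *F_) R.*-congˡ R.*-congˡ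
    (λ y → R.trans (R.sym (R.*-assoc _ _ _)) (R.trans (R.*-congʳ (x*x⁻¹≈1 x x≉0)) (R.*-identityˡ y)))
    (λ y → R.trans (R.sym (R.*-assoc _ _ _)) (R.trans (R.*-congʳ (x⁻¹*x≈1 x x≉0)) (R.*-identityˡ y)))

  ΣFⁿ-translate : ∀ n (g : Series → ℕ) → DependsOnFirst n g → ∀ (T : Series) →
    ΣFⁿ n (λ X → g (λ i → X i +F T i)) ≡ ΣFⁿ n g
  ΣFⁿ-translate n g g-dep T = ΣFⁿ-permute n (translation ∘ T) g g-dep

  ΣFⁿ-scale : ∀ n (g : Series → ℕ) → DependsOnFirst n g → ∀ x → ¬ (x ≈ 0#) →
    ΣFⁿ n (λ X → g (λ i → x *F X i)) ≡ ΣFⁿ n g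
  ΣFⁿ-scale n g g-dep x x≉0 = ΣFⁿ-permute n (λ _ → scaling x x≉0) g g-dep

  q-1 : ℕ
  q-1 = ℕ.pred q

  q≢0 : q ≢ 0
  q≢0 q≡0 with ≡.subst Fin q≡0 (from 0#)
  ... | ()

  q≡1+[q-1] : q ≡ suc q-1
  q≡1+[q-1] = sym (NP.suc-pred q ⦃ ℕ.≢-nonZero q≢0 ⦄)

  q-1≢0 : q-1 ≢ 0
  q-1≢0 q-1≡0 = 0≉1 (R.trans (R.sym (strictlyInverseˡ 0#)) (R.trans (R.reflexive (cong to from0≡from1)) (strictlyInverseˡ 1#)))
    where
    Fin1-unique : ∀ {n} → n ≡ 1 → (i j : Fin n) → i ≡ j
    Fin1-unique ≡.refl Fin.zero Fin.zero = ≡.refl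
    from0≡from1 : from 0# ≡ from 1#
    from0≡from1 = Fin1-unique (trans q≡1+[q-1] (cong suc q-1≡0)) (from 0#) (from 1#)

  ΣF-ifNonzero : ∀ k → ΣF (λ x → ifNonzero x k) ≡ q-1 * k
  ΣF-ifNonzero k = NP.+-cancelʳ-≡ k _ _ (trans (ΣF-ifNonzero+k k) (trans (cong (_* k) q≡1+[q-1]) (NP.+-comm k (q-1 * k))))

  ΣF-isZero : ΣF (λ x → bool→ℕ (isZero x)) ≡ 1
  ΣF-isZero = trans (ΣF-cong bool→ℕ-isZero) (ΣF-ifZero (λ _ → 1) (λ _ → ≡.refl))

  affine : ∀ (r a : Carrier) → ¬ (a ≈ 0#) → Inverse setoid setoid
  affine r a a≉0 = mkFieldPermutation (λ t → r +F a *F t) (λ u → a ⁻¹ *F (u +F (- r)))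
    (λ t≈t′ → R.+-congˡ (R.*-congˡ t≈t′)) (λ u≈u′ → R.*-congˡ (R.+-congʳ u≈u′))
    (r+a[a⁻¹[u-r]]≈u r a a≉0) (a⁻¹[[r+at]-r]≈t r a a≉0)

  ΣF-isZero-affine : ∀ (r a : Carrier) → ¬ (a ≈ 0#) → ΣF (λ t → bool→ℕ (isZero (r +F a *F t))) ≡ 1
  ΣF-isZero-affine r a a≉0 =
    trans (ΣF-permute (affine r a a≉0) (λ u → bool→ℕ (isZero u)) (λ u≈u′ → cong bool→ℕ (isZero-cong u≈u′))) ΣF-isZero

  bool→ℕ-isZero-≈0 : ∀ x → x ≈ 0# → bool→ℕ (isZero x) ≡ 1
  bool→ℕ-isZero-≈0 x x≈0 with x ≟ 0#
  ... | yes _   = ≡.refl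
  ... | no x≉0  = ⊥-elim (x≉0 x≈0)

  bool→ℕ-isZero-≉0 : ∀ x → ¬ (x ≈ 0#) → bool→ℕ (isZero x) ≡ 0
  bool→ℕ-isZero-≉0 x x≉0 with x ≟ 0#
  ... | yes x≈0 = ⊥-elim (x≉0 x≈0)
  ... | no _    = ≡.refl

  ifNonzero-≈0 : ∀ x k → x ≈ 0# → ifNonzero x k ≡ 0
  ifNonzero-≈0 x k x≈0 with x ≟ 0#
  ... | yes _   = ≡.refl
  ... | no x≉0  = ⊥-elim (x≉0 x≈0)

  ifNonzero-≉0 : ∀ x k → ¬ (x ≈ 0#) → ifNonzero x k ≡ k
  ifNonzero-≉0 x k x≉0 with x ≟ 0#
  ... | yes x≈0 = ⊥-elim (x≉0 x≈0)
  ... | no _    = ≡.refl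

  ΣFⁿ-ifNonzero+isZero : ∀ n (f : Series → Carrier) →
    ΣFⁿ n (λ X → ifNonzero (f X) 1) + ΣFⁿ n (λ X → bool→ℕ (isZero (f X))) ≡ q ^ n
  ΣFⁿ-ifNonzero+isZero n f = begin
    ΣFⁿ n (λ X → ifNonzero (f X) 1) + ΣFⁿ n (λ X → bool→ℕ (isZero (f X)))
      ≡⟨ ΣFⁿ-distrib-+ n (λ X → ifNonzero (f X) 1) (λ X → bool→ℕ (isZero (f X))) ⟨
    ΣFⁿ n (λ X → ifNonzero (f X) 1 + bool→ℕ (isZero (f X)))
      ≡⟨ ΣFⁿ-cong n (λ X → trans (cong (ifNonzero (f X) 1 +_) (bool→ℕ-isZero (f X)))
                                 (trans (NP.+-comm _ (ifZero (f X) 1)) (ifZero+ifNonzero (f X) 1))) ⟩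
    ΣFⁿ n (λ _ → 1)   ≡⟨ ΣFⁿ-const n 1 ⟩
    q ^ n * 1         ≡⟨ NP.*-identityʳ _ ⟩
    q ^ n             ∎


module RelationCount {c ℓ q} (F : Defs.FiniteField c ℓ q) where

  open import Data.Nat as ℕ using (ℕ; zero; suc; _≤_; _<_; z≤n; s≤s; _+_; _*_; _^_)
  import Data.Nat.Properties as NP
  open import Data.Sum using (inj₁; inj₂)
  open import Relation.Binary.PropositionalEquality as ≡ using (_≡_; cong; cong₂; trans; sym)
  open import Relation.Nullary using (¬_; yes; no; Dec)
  open import Data.Empty using (⊥-elim)
  open import Function using (_∘_)
  open import Data.Nat.Tactic.RingSolver using (solve-∀)

  open Defs.FiniteField F using (commRing; _≟_)
  private module R = CommutativeRing commRing
  open R using (Carrier; _≈_; 0#; 1#; -_) renaming (_+_ to _+F_; _*_ to _*F_)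
  open FieldLemmas F using (Series; isZero; _⁻¹; x⁻¹*x≈1; ⁻¹-≉0; 1≉0)
  open PadeRelations F using (hasRelation; euclidReduce; hasRelation-cong; hasRelation-step; hasRelation-swapStep; hasRelation-scale)
  open Counting F
  open ≡.≡-Reasoning

  relationIndicator : ℕ → ℕ → ℕ → Series → Series → ℕ
  relationIndicator n α β X Y = ifNonzero (Y 0) (bool→ℕ (hasRelation n α β X Y))

  relationCount : ℕ → ℕ → ℕ → ℕ
  relationCount n α β = ΣFⁿ n (λ X → ΣFⁿ n (λ Y → relationIndicator n α β X Y))

  relationIndicator-depˡ : ∀ n a β → suc a + β ≡ n → ∀ Y → DependsOnFirst n (λ X → relationIndicator n (suc a) β X Y)
  relationIndicator-depˡ n a β a+β+1≡n Y X≈X′ with Y 0 ≟ 0#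
  ... | yes _   = ≡.refl
  ... | no Y₀≉0 = cong bool→ℕ (hasRelation-cong n a β a+β+1≡n Y₀≉0 X≈X′ (λ i _ → R.refl))

  relationIndicator-depʳ : ∀ n a β → suc a + β ≡ n → ∀ X → DependsOnFirst n (λ Y → relationIndicator n (suc a) β X Y)
  relationIndicator-depʳ n a β a+β+1≡n X {Y} {Y′} Y≈Y′ with Y 0 ≟ 0# | Y′ 0 ≟ 0#
  ... | yes _    | yes _    = ≡.refl
  ... | yes Y₀≈0 | no Y′₀≉0 = ⊥-elim (Y′₀≉0 (R.trans (R.sym (Y≈Y′ 0 0<n)) Y₀≈0))
    where 0<n = ≡.subst (0 <_) a+β+1≡n (s≤s z≤n)
  ... | no Y₀≉0  | yes Y′₀≈0 = ⊥-elim (Y₀≉0 (R.trans (Y≈Y′ 0 0<n) Y′₀≈0))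
    where 0<n = ≡.subst (0 <_) a+β+1≡n (s≤s z≤n)
  ... | no Y₀≉0  | no _     = cong bool→ℕ (hasRelation-cong n a β a+β+1≡n Y₀≉0 (λ i _ → R.refl) Y≈Y′)

  ifNonzero-cong : ∀ x a b → (¬ (x ≈ 0#) → a ≡ b) → ifNonzero x a ≡ ifNonzero x b
  ifNonzero-cong x a b a≡b with x ≟ 0#
  ... | yes _   = ≡.refl
  ... | no x≉0  = a≡b x≉0

  relationCount-noOdd : ∀ m a → relationCount (suc m) (suc a) 0 ≡ q-1 * (q ^ m * q ^ m)
  relationCount-noOdd m a = begin
    ΣFⁿ (suc m) (λ X → ΣFⁿ (suc m) (λ Y → ifNonzero (Y 0) (bool→ℕ (isZero (X 0)))))
      ≡⟨ ΣFⁿ-cong (suc m) (λ X → countY (bool→ℕ (isZero (X 0)))) ⟩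
    ΣFⁿ (suc m) (λ X → q ^ m * (q-1 * bool→ℕ (isZero (X 0))))
      ≡⟨ ΣFⁿ-factorˡ (suc m) (q ^ m) (λ X → q-1 * bool→ℕ (isZero (X 0))) ⟩
    q ^ m * ΣFⁿ (suc m) (λ X → q-1 * bool→ℕ (isZero (X 0)))
      ≡⟨ cong (q ^ m *_) (ΣFⁿ-factorˡ (suc m) q-1 (λ X → bool→ℕ (isZero (X 0)))) ⟩
    q ^ m * (q-1 * ΣF (λ x → ΣFⁿ m (λ _ → bool→ℕ (isZero x))))
      ≡⟨ cong (λ z → q ^ m * (q-1 * z)) (ΣF-cong (λ x → ΣFⁿ-const m (bool→ℕ (isZero x)))) ⟩
    q ^ m * (q-1 * ΣF (λ x → q ^ m * bool→ℕ (isZero x)))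
      ≡⟨ cong (λ z → q ^ m * (q-1 * z)) (trans (ΣF-factorˡ (q ^ m) (λ x → bool→ℕ (isZero x))) (cong (q ^ m *_) ΣF-isZero)) ⟩
    q ^ m * (q-1 * (q ^ m * 1))
      ≡⟨ rearrange q-1 (q ^ m) ⟩
    q-1 * (q ^ m * q ^ m) ∎
    where
    rearrange : ∀ p x → x * (p * (x * 1)) ≡ p * (x * x)
    rearrange = solve-∀
    countY : ∀ k → ΣFⁿ (suc m) (λ Y → ifNonzero (Y 0) k) ≡ q ^ m * (q-1 * k)
    countY k = begin
      ΣF (λ y → ΣFⁿ m (λ _ → ifNonzero y k))  ≡⟨ ΣF-cong (λ y → ΣFⁿ-const m (ifNonzero y k)) ⟩
      ΣF (λ y → q ^ m * ifNonzero y k)        ≡⟨ ΣF-factorˡ (q ^ m) (λ y → ifNonzero y k) ⟩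
      q ^ m * ΣF (λ y → ifNonzero y k)        ≡⟨ cong (q ^ m *_) (ΣF-ifNonzero k) ⟩
      q ^ m * (q-1 * k)                       ∎

  ΣFⁿ-euclidReduce : ∀ m a b → suc a + b ≡ m → ∀ Y →
    ΣFⁿ (suc m) (λ X → relationIndicator m (suc a) b (euclidReduce X Y) Y) ≡ q * ΣFⁿ m (λ W → relationIndicator m (suc a) b W Y)
  ΣFⁿ-euclidReduce m a b a+b+1≡m Y = begin
    ΣF (λ x₀ → ΣFⁿ m (λ X′ → relationIndicator m (suc a) b (λ i → X′ i +F (- (x₀ *F Y 0 ⁻¹)) *F Y (suc i)) Y))
      ≡⟨ ΣF-cong (λ x₀ → ΣFⁿ-translate m (λ W → relationIndicator m (suc a) b W Y) (relationIndicator-depˡ m a b a+b+1≡m Y)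
                                                   (λ i → (- (x₀ *F Y 0 ⁻¹)) *F Y (suc i))) ⟩
    ΣF (λ x₀ → ΣFⁿ m (λ W → relationIndicator m (suc a) b W Y))
      ≡⟨ ΣF-const _ ⟩
    q * ΣFⁿ m (λ W → relationIndicator m (suc a) b W Y) ∎

  ΣFⁿ-extraY : ∀ m a b → suc a + b ≡ m →
    ΣFⁿ (suc m) (λ Y → ΣFⁿ m (λ W → relationIndicator m (suc a) b W Y)) ≡ q * relationCount m (suc a) b
  ΣFⁿ-extraY m a b a+b+1≡m = begin
    ΣFⁿ (suc m) (λ Y → ΣFⁿ m (λ W → relationIndicator m (suc a) b W Y))
      ≡⟨ ΣFⁿ-comm (suc m) m (λ Y W → relationIndicator m (suc a) b W Y) ⟩
    ΣFⁿ m (λ W → ΣFⁿ (suc m) (λ Y → relationIndicator m (suc a) b W Y))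
      ≡⟨ ΣFⁿ-cong m (λ W → ΣFⁿ-unusedCoordinate m _ (relationIndicator-depʳ m a b a+b+1≡m W)) ⟩
    ΣFⁿ m (λ W → q * ΣFⁿ m (λ Y → relationIndicator m (suc a) b W Y))
      ≡⟨ ΣFⁿ-factorˡ m q _ ⟩
    q * relationCount m (suc a) b ∎

  relationCount-reduce : ∀ m a b → suc a + b ≡ m → suc a ≤ suc b →
    relationCount (suc m) (suc a) (suc b) ≡ q * (q * relationCount m (suc a) b)
  relationCount-reduce m a b a+b+1≡m a≤b = begin
    ΣFⁿ (suc m) (λ X → ΣFⁿ (suc m) (λ Y → relationIndicator (suc m) (suc a) (suc b) X Y))
      ≡⟨ ΣFⁿ-cong (suc m) (λ X → ΣFⁿ-cong (suc m) (λ Y →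
           cong (ifNonzero (Y 0) ∘ bool→ℕ) (hasRelation-step m (suc a) b X Y (inj₁ a≤b)))) ⟩
    ΣFⁿ (suc m) (λ X → ΣFⁿ (suc m) (λ Y → relationIndicator m (suc a) b (euclidReduce X Y) Y))
      ≡⟨ ΣFⁿ-comm (suc m) (suc m) (λ X Y → relationIndicator m (suc a) b (euclidReduce X Y) Y) ⟩
    ΣFⁿ (suc m) (λ Y → ΣFⁿ (suc m) (λ X → relationIndicator m (suc a) b (euclidReduce X Y) Y))
      ≡⟨ ΣFⁿ-cong (suc m) (ΣFⁿ-euclidReduce m a b a+b+1≡m) ⟩
    ΣFⁿ (suc m) (λ Y → q * ΣFⁿ m (λ W → relationIndicator m (suc a) b W Y))
      ≡⟨ ΣFⁿ-factorˡ (suc m) q (λ Y → ΣFⁿ m (λ W → relationIndicator m (suc a) b W Y)) ⟩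
    q * ΣFⁿ (suc m) (λ Y → ΣFⁿ m (λ W → relationIndicator m (suc a) b W Y))
      ≡⟨ cong (q *_) (ΣFⁿ-extraY m a b a+b+1≡m) ⟩
    q * (q * relationCount m (suc a) b) ∎

  -- When α > β + 1 the pairs with X(0) = 0 are counted as in relationCount-reduce, and those
  -- with X(0) ≠ 0 are counted with the roles of X and Y exchanged.
  module SwapCase (m a b : ℕ) (a+b+1≡m : suc a + b ≡ m) (b+a+1≡m : suc b + a ≡ m) (a≰b : ¬ (suc a ≤ suc b)) where

    countY : Series → ℕ
    countY X = ΣFⁿ (suc m) (λ Y → relationIndicator (suc m) (suc a) (suc b) X Y)

    countY-dep : DependsOnFirst (suc m) countY
    countY-dep X≈X′ = ΣFⁿ-cong (suc m) (λ Y →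
      relationIndicator-depˡ (suc m) a (suc b) (trans (NP.+-suc (suc a) b) (cong suc a+b+1≡m)) Y X≈X′)

    countWithHead : Carrier → ℕ
    countWithHead x₀ = ΣFⁿ m (λ X′ → countY (x₀ ∷ₛ X′))

    countWithHead-0 : countWithHead 0# ≡ q * relationCount m (suc a) b
    countWithHead-0 = begin
      ΣFⁿ m (λ X′ → ΣFⁿ (suc m) (λ Y → relationIndicator (suc m) (suc a) (suc b) (0# ∷ₛ X′) Y))
        ≡⟨ ΣFⁿ-cong m (λ X′ → ΣFⁿ-cong (suc m) (λ Y →
             cong (ifNonzero (Y 0) ∘ bool→ℕ) (hasRelation-step m (suc a) b (0# ∷ₛ X′) Y (inj₂ R.refl)))) ⟩
      ΣFⁿ m (λ X′ → ΣFⁿ (suc m) (λ Y → relationIndicator m (suc a) b (euclidReduce (0# ∷ₛ X′) Y) Y))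
        ≡⟨ ΣFⁿ-comm m (suc m) (λ X′ Y → relationIndicator m (suc a) b (euclidReduce (0# ∷ₛ X′) Y) Y) ⟩
      ΣFⁿ (suc m) (λ Y → ΣFⁿ m (λ X′ → relationIndicator m (suc a) b (λ i → X′ i +F (- (0# *F Y 0 ⁻¹)) *F Y (suc i)) Y))
        ≡⟨ ΣFⁿ-cong (suc m) (λ Y → ΣFⁿ-translate m (λ W → relationIndicator m (suc a) b W Y)
                                     (relationIndicator-depˡ m a b a+b+1≡m Y) (λ i → (- (0# *F Y 0 ⁻¹)) *F Y (suc i))) ⟩
      ΣFⁿ (suc m) (λ Y → ΣFⁿ m (λ W → relationIndicator m (suc a) b W Y))
        ≡⟨ ΣFⁿ-extraY m a b a+b+1≡m ⟩
      q * relationCount m (suc a) b ∎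

    relationsWith : Series → ℕ
    relationsWith X = ΣFⁿ m (λ V → bool→ℕ (hasRelation m (suc b) a V X))

    countY-swap : ∀ x₀ → ¬ (x₀ ≈ 0#) → ∀ X′ → countY (x₀ ∷ₛ X′) ≡ ΣF (λ y₀ → ifNonzero y₀ (relationsWith (x₀ ∷ₛ X′)))
    countY-swap x₀ x₀≉0 X′ = begin
      ΣF (λ y₀ → ΣFⁿ m (λ Y′ → relationIndicator (suc m) (suc a) (suc b) (x₀ ∷ₛ X′) (y₀ ∷ₛ Y′)))
        ≡⟨ ΣF-cong (λ y₀ → ΣFⁿ-cong m (λ Y′ →
             cong (ifNonzero y₀ ∘ bool→ℕ) (hasRelation-swapStep m (suc a) b (x₀ ∷ₛ X′) (y₀ ∷ₛ Y′) a≰b x₀≉0))) ⟩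
      ΣF (λ y₀ → ΣFⁿ m (λ Y′ → ifNonzero y₀ (bool→ℕ (hasRelation m (suc b) a (λ i → Y′ i +F (- (y₀ *F x₀ ⁻¹)) *F X′ i) (x₀ ∷ₛ X′)))))
        ≡⟨ ΣF-cong (λ y₀ → ΣFⁿ-translate m (λ V → ifNonzero y₀ (bool→ℕ (hasRelation m (suc b) a V (x₀ ∷ₛ X′))))
              (λ V≈V′ → cong (ifNonzero y₀ ∘ bool→ℕ) (hasRelation-cong m b a b+a+1≡m x₀≉0 V≈V′ (λ i _ → R.refl)))
              (λ i → (- (y₀ *F x₀ ⁻¹)) *F X′ i)) ⟩
      ΣF (λ y₀ → ΣFⁿ m (λ V → ifNonzero y₀ (bool→ℕ (hasRelation m (suc b) a V (x₀ ∷ₛ X′)))))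
        ≡⟨ ΣF-cong (λ y₀ → ΣFⁿ-ifNonzero m y₀ (λ V → bool→ℕ (hasRelation m (suc b) a V (x₀ ∷ₛ X′)))) ⟩
      ΣF (λ y₀ → ifNonzero y₀ (relationsWith (x₀ ∷ₛ X′))) ∎

    unitHeadCount : ℕ
    unitHeadCount = ΣF (λ x₀ → ifNonzero x₀ (ΣFⁿ m (λ X′ → relationsWith (x₀ ∷ₛ X′))))

    unitHeadCount≡ : unitHeadCount ≡ q * relationCount m (suc b) a
    unitHeadCount≡ = begin
      ΣF (λ x₀ → ifNonzero x₀ (ΣFⁿ m (λ X′ → relationsWith (x₀ ∷ₛ X′))))
        ≡⟨ ΣF-cong (λ x₀ → trans (sym (ΣFⁿ-ifNonzero m x₀ (λ X′ → relationsWith (x₀ ∷ₛ X′))))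
                      (ΣFⁿ-cong m (λ X′ → sym (ΣFⁿ-ifNonzero m x₀ (λ V → bool→ℕ (hasRelation m (suc b) a V (x₀ ∷ₛ X′))))))) ⟩
      ΣFⁿ (suc m) (λ X → ΣFⁿ m (λ V → relationIndicator m (suc b) a V X))
        ≡⟨ ΣFⁿ-extraY m b a b+a+1≡m ⟩
      q * relationCount m (suc b) a ∎

    nonzeroHeadCount : ℕ
    nonzeroHeadCount = ΣF (λ x₀ → ifNonzero x₀ (countWithHead x₀))

    nonzeroHeadCount+unitHeadCount : nonzeroHeadCount + unitHeadCount ≡ q * unitHeadCount
    nonzeroHeadCount+unitHeadCount = begin
      ΣF (λ x₀ → ifNonzero x₀ (countWithHead x₀)) + unitHeadCount
        ≡⟨ cong (_+ unitHeadCount) (ΣF-cong (λ x₀ → ifNonzero-cong x₀ _ _ (λ x₀≉0 → ΣFⁿ-cong m (countY-swap x₀ x₀≉0)))) ⟩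
      ΣF (λ x₀ → ifNonzero x₀ (ΣFⁿ m (λ X′ → ΣF (λ y₀ → ifNonzero y₀ (K x₀ X′))))) + unitHeadCount
        ≡⟨ ΣF-distrib-+ (λ x₀ → ifNonzero x₀ (ΣFⁿ m (λ X′ → ΣF (λ y₀ → ifNonzero y₀ (K x₀ X′))))) (λ x₀ → ifNonzero x₀ (ΣFⁿ m (K x₀))) ⟨
      ΣF (λ x₀ → ifNonzero x₀ (ΣFⁿ m (λ X′ → ΣF (λ y₀ → ifNonzero y₀ (K x₀ X′)))) + ifNonzero x₀ (ΣFⁿ m (K x₀)))
        ≡⟨ ΣF-cong perHead ⟩
      ΣF (λ x₀ → q * ifNonzero x₀ (ΣFⁿ m (K x₀)))
        ≡⟨ ΣF-factorˡ q (λ x₀ → ifNonzero x₀ (ΣFⁿ m (K x₀))) ⟩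
      q * unitHeadCount ∎
      where
      K : Carrier → Series → ℕ
      K x₀ X′ = relationsWith (x₀ ∷ₛ X′)
      perHead : ∀ x₀ → ifNonzero x₀ (ΣFⁿ m (λ X′ → ΣF (λ y₀ → ifNonzero y₀ (K x₀ X′)))) + ifNonzero x₀ (ΣFⁿ m (K x₀))
                       ≡ q * ifNonzero x₀ (ΣFⁿ m (K x₀))
      perHead x₀ = begin
        ifNonzero x₀ (ΣFⁿ m (λ X′ → ΣF (λ y₀ → ifNonzero y₀ (K x₀ X′)))) + ifNonzero x₀ (ΣFⁿ m (K x₀))
          ≡⟨ ifNonzero-+ x₀ _ _ ⟩
        ifNonzero x₀ (ΣFⁿ m (λ X′ → ΣF (λ y₀ → ifNonzero y₀ (K x₀ X′))) + ΣFⁿ m (K x₀))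
          ≡⟨ cong (ifNonzero x₀) (sym (ΣFⁿ-distrib-+ m (λ X′ → ΣF (λ y₀ → ifNonzero y₀ (K x₀ X′))) (K x₀))) ⟩
        ifNonzero x₀ (ΣFⁿ m (λ X′ → ΣF (λ y₀ → ifNonzero y₀ (K x₀ X′)) + K x₀ X′))
          ≡⟨ cong (ifNonzero x₀) (ΣFⁿ-cong m (λ X′ → ΣF-ifNonzero+k (K x₀ X′))) ⟩
        ifNonzero x₀ (ΣFⁿ m (λ X′ → q * K x₀ X′))
          ≡⟨ cong (ifNonzero x₀) (ΣFⁿ-factorˡ m q (K x₀)) ⟩
        ifNonzero x₀ (q * ΣFⁿ m (K x₀))
          ≡⟨ ifNonzero-* x₀ q _ ⟩
        q * ifNonzero x₀ (ΣFⁿ m (K x₀)) ∎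

    relationCount-split : relationCount (suc m) (suc a) (suc b) ≡ q * relationCount m (suc a) b + nonzeroHeadCount
    relationCount-split = trans (ΣF-split0 countWithHead (ΣFⁿ-respects-head m countY countY-dep))
                                (cong (_+ nonzeroHeadCount) countWithHead-0)

  relationCount-swapReduce : ∀ m a b → suc a + b ≡ m → suc b + a ≡ m → ¬ (suc a ≤ suc b) →
    relationCount (suc m) (suc a) (suc b) + q * relationCount m (suc b) a
      ≡ q * relationCount m (suc a) b + q * (q * relationCount m (suc b) a)
  relationCount-swapReduce m a b a+b+1≡m b+a+1≡m a≰b = begin
    relationCount (suc m) (suc a) (suc b) + q * relationCount m (suc b) a
      ≡⟨ cong₂ _+_ relationCount-split (sym unitHeadCount≡) ⟩
    (q * relationCount m (suc a) b + nonzeroHeadCount) + unitHeadCount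
      ≡⟨ NP.+-assoc _ nonzeroHeadCount unitHeadCount ⟩
    q * relationCount m (suc a) b + (nonzeroHeadCount + unitHeadCount)
      ≡⟨ cong (q * relationCount m (suc a) b +_) (trans nonzeroHeadCount+unitHeadCount (cong (q *_) unitHeadCount≡)) ⟩
    q * relationCount m (suc a) b + q * (q * relationCount m (suc b) a) ∎
    where
    open SwapCase m a b a+b+1≡m b+a+1≡m a≰b

  relationCount-formula : ∀ m a β → suc a + β ≡ suc m → relationCount (suc m) (suc a) β ≡ q-1 * (q ^ m * q ^ m)
  relationCount-formula m a zero _ = relationCount-noOdd m a
  relationCount-formula zero a (suc b) a+b+2≡1 with trans (sym (NP.+-suc (suc a) b)) a+b+2≡1
  ... | ()
  relationCount-formula (suc m) a (suc b) a+b+2≡m+2 = byComparison (suc a ℕ.≤? suc b)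
    where
    C C′ Q : ℕ
    C = relationCount (suc m) (suc a) b
    C′ = relationCount (suc m) (suc b) a
    Q = q-1 * (q ^ m * q ^ m)
    a+b+1≡m+1 : suc a + b ≡ suc m
    a+b+1≡m+1 = NP.suc-injective (trans (sym (NP.+-suc (suc a) b)) a+b+2≡m+2)
    b+a+1≡m+1 : suc b + a ≡ suc m
    b+a+1≡m+1 = trans (NP.+-comm (suc b) a) (NP.suc-injective a+b+2≡m+2)
    rearrange : ∀ q p x → q * (q * (p * (x * x))) ≡ p * ((q * x) * (q * x))
    rearrange = solve-∀
    byComparison : Dec (suc a ≤ suc b) → relationCount (suc (suc m)) (suc a) (suc b) ≡ q-1 * (q ^ suc m * q ^ suc m)
    byComparison (yes a≤b) = begin
      relationCount (suc (suc m)) (suc a) (suc b)  ≡⟨ relationCount-reduce (suc m) a b a+b+1≡m+1 a≤b ⟩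
      q * (q * C)                                  ≡⟨ cong (λ z → q * (q * z)) (relationCount-formula m a b a+b+1≡m+1) ⟩
      q * (q * Q)                                  ≡⟨ rearrange q q-1 (q ^ m) ⟩
      q-1 * (q ^ suc m * q ^ suc m)                ∎
    byComparison (no a≰b) = NP.+-cancelʳ-≡ _ _ _ (begin
      relationCount (suc (suc m)) (suc a) (suc b) + q * C′
        ≡⟨ relationCount-swapReduce (suc m) a b a+b+1≡m+1 b+a+1≡m+1 a≰b ⟩
      q * C + q * (q * C′)
        ≡⟨ cong₂ (λ x y → q * x + q * (q * y)) (relationCount-formula m a b a+b+1≡m+1) (relationCount-formula m b a b+a+1≡m+1) ⟩
      q * Q + q * (q * Q)
        ≡⟨ NP.+-comm (q * Q) _ ⟩
      q * (q * Q) + q * Q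
        ≡⟨ cong (_+ q * Q) (rearrange q q-1 (q ^ m)) ⟩
      q-1 * (q ^ suc m * q ^ suc m) + q * Q
        ≡⟨ cong (λ z → q-1 * (q ^ suc m * q ^ suc m) + q * z) (relationCount-formula m b a b+a+1≡m+1) ⟨
      q-1 * (q ^ suc m * q ^ suc m) + q * C′ ∎)

  monicRelationCount : ℕ → ℕ → ℕ → ℕ
  monicRelationCount m α β = ΣFⁿ (suc m) (λ X → ΣFⁿ m (λ Y′ → bool→ℕ (hasRelation (suc m) α β X (1# ∷ₛ Y′))))

  module Normalise (m a β : ℕ) (a+β+1≡m+1 : suc a + β ≡ suc m) where

    hasRelation-depˡ : DependsOnFirst (suc m) (λ X → ΣFⁿ m (λ Y′ → bool→ℕ (hasRelation (suc m) (suc a) β X (1# ∷ₛ Y′))))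
    hasRelation-depˡ X≈X′ = ΣFⁿ-cong m (λ Y′ → cong bool→ℕ (hasRelation-cong (suc m) a β a+β+1≡m+1 1≉0 X≈X′ (λ i _ → R.refl)))

    hasRelation-depʳ : ∀ X → DependsOnFirst m (λ Y′ → bool→ℕ (hasRelation (suc m) (suc a) β X (1# ∷ₛ Y′)))
    hasRelation-depʳ X Y≈Y′ = cong bool→ℕ (hasRelation-cong (suc m) a β a+β+1≡m+1 1≉0 (λ i _ → R.refl)
                                             λ { zero _ → R.refl ; (suc i) (s≤s i<m) → Y≈Y′ i i<m })

    -- Scaling X and Y by y₀⁻¹ turns Y(0) = y₀ into 1 without changing the existence of a relation.
    fibre : ∀ y₀ → ¬ (y₀ ≈ 0#) →
      ΣFⁿ (suc m) (λ X → ΣFⁿ m (λ Y′ → bool→ℕ (hasRelation (suc m) (suc a) β X (y₀ ∷ₛ Y′)))) ≡ monicRelationCount m (suc a) β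
    fibre y₀ y₀≉0 = begin
      ΣFⁿ (suc m) (λ X → ΣFⁿ m (λ Y′ → bool→ℕ (hasRelation (suc m) (suc a) β X (y₀ ∷ₛ Y′))))
        ≡⟨ ΣFⁿ-cong (suc m) (λ X → ΣFⁿ-cong m (λ Y′ → cong bool→ℕ (normalise X Y′))) ⟩
      ΣFⁿ (suc m) (λ X → ΣFⁿ m (λ Y′ → bool→ℕ (hasRelation (suc m) (suc a) β (λ i → y₀ ⁻¹ *F X i) (1# ∷ₛ (λ i → y₀ ⁻¹ *F Y′ i)))))
        ≡⟨ ΣFⁿ-cong (suc m) (λ X → ΣFⁿ-scale m (λ Z → bool→ℕ (hasRelation (suc m) (suc a) β (λ i → y₀ ⁻¹ *F X i) (1# ∷ₛ Z)))
                                      (hasRelation-depʳ _) (y₀ ⁻¹) (⁻¹-≉0 y₀ y₀≉0)) ⟩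
      ΣFⁿ (suc m) (λ X → ΣFⁿ m (λ Y′ → bool→ℕ (hasRelation (suc m) (suc a) β (λ i → y₀ ⁻¹ *F X i) (1# ∷ₛ Y′))))
        ≡⟨ ΣFⁿ-scale (suc m) (λ X → ΣFⁿ m (λ Y′ → bool→ℕ (hasRelation (suc m) (suc a) β X (1# ∷ₛ Y′)))) hasRelation-depˡ
                     (y₀ ⁻¹) (⁻¹-≉0 y₀ y₀≉0) ⟩
      monicRelationCount m (suc a) β ∎
      where
      normalise : ∀ X Y′ → hasRelation (suc m) (suc a) β X (y₀ ∷ₛ Y′)
                         ≡ hasRelation (suc m) (suc a) β (λ i → y₀ ⁻¹ *F X i) (1# ∷ₛ (λ i → y₀ ⁻¹ *F Y′ i))
      normalise X Y′ = trans (sym (hasRelation-scale (suc m) a β (y₀ ⁻¹) {X} {y₀ ∷ₛ Y′} a+β+1≡m+1 y₀≉0 (⁻¹-≉0 y₀ y₀≉0)))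
        (hasRelation-cong (suc m) a β a+β+1≡m+1 (λ y₀⁻¹y₀≈0 → 1≉0 (R.trans (R.sym (x⁻¹*x≈1 y₀ y₀≉0)) y₀⁻¹y₀≈0))
          (λ i _ → R.refl) (λ { zero _ → x⁻¹*x≈1 y₀ y₀≉0 ; (suc i) _ → R.refl }))

    relationCount≡q-1*monic : relationCount (suc m) (suc a) β ≡ q-1 * monicRelationCount m (suc a) β
    relationCount≡q-1*monic = begin
      ΣFⁿ (suc m) (λ X → ΣF (λ y₀ → ΣFⁿ m (λ Y′ → ifNonzero y₀ (H X y₀ Y′))))
        ≡⟨ sym (ΣF-ΣFⁿ-comm (suc m) (λ y₀ X → ΣFⁿ m (λ Y′ → ifNonzero y₀ (H X y₀ Y′)))) ⟩
      ΣF (λ y₀ → ΣFⁿ (suc m) (λ X → ΣFⁿ m (λ Y′ → ifNonzero y₀ (H X y₀ Y′))))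
        ≡⟨ ΣF-cong (λ y₀ → trans (ΣFⁿ-cong (suc m) (λ X → ΣFⁿ-ifNonzero m y₀ (H X y₀)))
                                 (ΣFⁿ-ifNonzero (suc m) y₀ (λ X → ΣFⁿ m (H X y₀)))) ⟩
      ΣF (λ y₀ → ifNonzero y₀ (ΣFⁿ (suc m) (λ X → ΣFⁿ m (H X y₀))))
        ≡⟨ ΣF-cong (λ y₀ → ifNonzero-cong y₀ _ _ (fibre y₀)) ⟩
      ΣF (λ y₀ → ifNonzero y₀ (monicRelationCount m (suc a) β))
        ≡⟨ ΣF-ifNonzero _ ⟩
      q-1 * monicRelationCount m (suc a) β ∎
      where
      H : Series → Carrier → Series → ℕ
      H X y₀ Y′ = bool→ℕ (hasRelation (suc m) (suc a) β X (y₀ ∷ₛ Y′))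

  monicRelationCount-formula : ∀ m a β → suc a + β ≡ suc m → monicRelationCount m (suc a) β ≡ q ^ m * q ^ m
  monicRelationCount-formula m a β a+β+1≡m+1 =
    NP.*-cancelˡ-≡ (monicRelationCount m (suc a) β) (q ^ m * q ^ m) q-1 ⦃ ℕ.≢-nonZero q-1≢0 ⦄
      (trans (sym (Normalise.relationCount≡q-1*monic m a β a+β+1≡m+1)) (relationCount-formula m a β a+β+1≡m+1))


module StaircaseIndices where

  open import Data.Nat using (ℕ; zero; suc; _≤_; _<_; z≤n; s≤s; _∸_; _+_; ⌊_/2⌋; ⌈_/2⌉)
  import Data.Nat.Properties as NP
  open import Data.Product using (∃; _,_)
  open import Data.Sum using (_⊎_; inj₁; inj₂)
  open import Relation.Binary.PropositionalEquality as ≡ using (_≡_)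
  open import Function using (_∘_)
  open ≡.≡-Reasoning

  twice : ℕ → ℕ
  twice zero = zero
  twice (suc e) = suc (suc (twice e))

  twice≡e+e : ∀ e → twice e ≡ e + e
  twice≡e+e zero = ≡.refl
  twice≡e+e (suc e) = ≡.cong suc (≡.trans (≡.cong suc (twice≡e+e e)) (≡.sym (NP.+-suc e e)))

  ⌈k/2⌉+⌊k/2⌋≡k : ∀ k → ⌈ k /2⌉ + ⌊ k /2⌋ ≡ k
  ⌈k/2⌉+⌊k/2⌋≡k k = ≡.trans (NP.+-comm ⌈ k /2⌉ ⌊ k /2⌋) (NP.⌊n/2⌋+⌈n/2⌉≡n k)

  twice-<⌈/2⌉ : ∀ k e → e < ⌈ k /2⌉ → twice e < k
  1+twice-<⌊/2⌋ : ∀ k e → e < ⌊ k /2⌋ → suc (twice e) < k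
  twice-<⌈/2⌉ (suc k) zero _ = s≤s z≤n
  twice-<⌈/2⌉ (suc k) (suc e) (s≤s e<) = s≤s (1+twice-<⌊/2⌋ k e e<)
  1+twice-<⌊/2⌋ (suc k) e e< = s≤s (twice-<⌈/2⌉ k e e<)

  ⌈/2⌉≤⇒≤twice : ∀ k e → ⌈ k /2⌉ ≤ e → k ≤ twice e
  ⌊/2⌋≤⇒≤1+twice : ∀ k e → ⌊ k /2⌋ ≤ e → k ≤ suc (twice e)
  ⌈/2⌉≤⇒≤twice zero e _ = z≤n
  ⌈/2⌉≤⇒≤twice (suc k) (suc e) (s≤s ≤e) = s≤s (⌊/2⌋≤⇒≤1+twice k e ≤e)
  ⌊/2⌋≤⇒≤1+twice zero e _ = z≤n
  ⌊/2⌋≤⇒≤1+twice (suc k) e ≤e = s≤s (⌈/2⌉≤⇒≤twice k e ≤e)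

  parity : ∀ d → (∃ λ e → d ≡ twice e) ⊎ (∃ λ e → d ≡ suc (twice e))
  parity zero = inj₁ (0 , ≡.refl)
  parity (suc zero) = inj₂ (0 , ≡.refl)
  parity (suc (suc d)) with parity d
  ... | inj₁ (e , d≡2e)   = inj₁ (suc e , ≡.cong (suc ∘ suc) d≡2e)
  ... | inj₂ (e , d≡2e+1) = inj₂ (suc e , ≡.cong (suc ∘ suc) d≡2e+1)

  k∸d≡1+k∸[1+d] : ∀ k d → d < k → k ∸ d ≡ suc (k ∸ suc d)
  k∸d≡1+k∸[1+d] (suc k) zero _ = ≡.refl
  k∸d≡1+k∸[1+d] (suc k) (suc d) (s≤s d<k) = k∸d≡1+k∸[1+d] k d d<k

  reflect-< : ∀ k d → d < k → k ∸ suc d < k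
  reflect-< (suc k) d _ = s≤s (NP.m∸n≤m k d)

  reflect-involutive : ∀ k d → d < k → k ∸ suc (k ∸ suc d) ≡ d
  reflect-involutive (suc k) d (s≤s d≤k) = NP.m∸[m∸n]≡n d≤k

  reflected-index : ∀ k s d → s ≤ k → d ≤ k → (suc k ∸ (k ∸ s)) + (k ∸ d) + d ≡ suc (twice s) + (k ∸ s)
  reflected-index k s d s≤k d≤k = begin
    (suc k ∸ (k ∸ s)) + (k ∸ d) + d   ≡⟨ ≡.cong (λ z → z + (k ∸ d) + d)
                                           (≡.trans (NP.+-∸-assoc 1 (NP.m∸n≤m k s)) (≡.cong suc (NP.m∸[m∸n]≡n s≤k))) ⟩
    suc s + (k ∸ d) + d               ≡⟨ NP.+-assoc (suc s) (k ∸ d) d ⟩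
    suc s + ((k ∸ d) + d)             ≡⟨ ≡.cong (suc s +_) (NP.m∸n+n≡m d≤k) ⟩
    suc s + k                         ≡⟨ ≡.cong (suc s +_) (≡.sym (NP.m+[n∸m]≡n s≤k)) ⟩
    suc s + (s + (k ∸ s))             ≡⟨ ≡.cong suc (≡.sym (NP.+-assoc s s (k ∸ s))) ⟩
    suc (s + s + (k ∸ s))             ≡⟨ ≡.cong (λ z → suc (z + (k ∸ s))) (≡.sym (twice≡e+e s)) ⟩
    suc (twice s) + (k ∸ s)           ∎


module JacobiTrudi {c ℓ q} (F : Defs.FiniteField c ℓ q) where

  open import Data.Nat as ℕ using (ℕ; zero; suc; _≤_; _<_; z≤n; s≤s; _∸_; ⌊_/2⌋; ⌈_/2⌉)
  import Data.Nat.Properties as NP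
  open import Data.Fin as Fin using (Fin; toℕ; fromℕ<; fromℕ; inject₁)
  import Data.Fin.Properties as FP
  open import Data.Product using (_,_)
  open import Data.Sum using (_⊎_; inj₁; inj₂)
  open import Relation.Binary.PropositionalEquality as ≡ using (_≡_)
  open import Relation.Nullary using (¬_; yes; no)
  open import Data.Empty using (⊥-elim)
  open import Function using (_∘_)

  open Defs.FiniteField F using (commRing)
  open StaircaseIndices
  open CommutativeRing commRing hiding (zero)
  open Defs.Det commRing using (det; Σ; alt)
  open Determinant commRing using (Matrix; Σ-suc; minor; det-cong; det-unitLastRow; topLeft; punchIn-fromℕ; det-linear-corner)
  open Kernel F using (NonzeroVec; Annihilates; det≈0⇒kernel; kernel⇒det≈0)
  open FieldLemmas F using (Series)
  open PadeRelations F using (sumBelow; sumBelow-cong; coeffOfShift; productCoeff; productCoeff-cong; PadeRelation; NonzeroBelow)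
  open import Relation.Binary.Reasoning.Setoid setoid
  open import Algebra.Solver.Ring.NaturalCoefficients.Default commutativeSemiring

  sumBelow-last : ∀ k (g : ℕ → Carrier) → sumBelow (suc k) g ≈ sumBelow k g + g k
  sumBelow-last zero g = trans (+-identityʳ _) (sym (+-identityˡ _))
  sumBelow-last (suc k) g = trans (+-congˡ (sumBelow-last k (g ∘ suc))) (sym (+-assoc _ _ _))

  sumBelow-reflect : ∀ k (f : ℕ → Carrier) → sumBelow k f ≈ sumBelow k (λ d → f (k ∸ suc d))
  sumBelow-reflect zero f = refl
  sumBelow-reflect (suc k) f = begin
    f 0 + sumBelow k (f ∘ suc)                         ≈⟨ +-congˡ (sumBelow-reflect k (f ∘ suc)) ⟩
    f 0 + sumBelow k (λ d → f (suc (k ∸ suc d)))       ≈⟨ +-comm _ _ ⟩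
    sumBelow k (λ d → f (suc (k ∸ suc d))) + f 0
      ≈⟨ +-cong (sumBelow-cong k (λ d d<k → reflexive (≡.cong f (≡.sym (k∸d≡1+k∸[1+d] k d d<k)))))
                (reflexive (≡.cong f (≡.sym (NP.n∸n≡0 k)))) ⟩
    sumBelow k (λ d → f (k ∸ d)) + f (k ∸ k)           ≈⟨ sumBelow-last k (λ d → f (k ∸ d)) ⟨
    sumBelow (suc k) (λ d → f (suc k ∸ suc d))         ∎

  sumBelow-parity : ∀ k (g : ℕ → Carrier) →
    sumBelow k g ≈ sumBelow ⌈ k /2⌉ (g ∘ twice) + sumBelow ⌊ k /2⌋ (g ∘ suc ∘ twice)
  sumBelow-parity zero g = sym (+-identityˡ 0#)
  sumBelow-parity (suc k) g = trans (+-congˡ (sumBelow-parity k (g ∘ suc))) (rearrange _ _ _)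
    where
    rearrange : ∀ a x y → a + (x + y) ≈ (a + y) + x
    rearrange = solve 3 (λ a x y → a :+ (x :+ y) := (a :+ y) :+ x) refl

  -- A series h encodes h₁, h₂, … as h 0, h 1, …; withH₀ prepends h₀ = 1 and hDiff h a b = h_(a-b)
  -- (0 when a < b).
  withH₀ : Series → Series
  withH₀ h zero = 1#
  withH₀ h (suc m) = h m

  hDiff : Series → ℕ → ℕ → Carrier
  hDiff h a zero = withH₀ h a
  hDiff h zero (suc b) = 0#
  hDiff h (suc a) (suc b) = hDiff h a b

  hDiff-shift : ∀ h t a b → hDiff h (t ℕ.+ a) (t ℕ.+ b) ≡ hDiff h a b
  hDiff-shift h zero a b = ≡.refl
  hDiff-shift h (suc t) a b = hDiff-shift h t a b

  hDiff-cong-diff : ∀ h a b c d → a ℕ.+ d ≡ c ℕ.+ b → hDiff h a b ≡ hDiff h c d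
  hDiff-cong-diff h a b c d a+d≡c+b = ≡.trans (≡.sym (hDiff-shift h d a b))
    (≡.trans (≡.cong₂ (hDiff h) (≡.trans (NP.+-comm d a) (≡.trans a+d≡c+b (NP.+-comm c b))) (NP.+-comm d b))
             (hDiff-shift h b c d))

  hDiff-cong : ∀ a b {h h′ : Series} → (∀ m → m < a → h m ≈ h′ m) → hDiff h a b ≈ hDiff h′ a b
  hDiff-cong zero zero _ = refl
  hDiff-cong (suc a) zero h≈h′ = h≈h′ a NP.≤-refl
  hDiff-cong zero (suc b) _ = refl
  hDiff-cong (suc a) (suc b) h≈h′ = hDiff-cong a b (λ m m<a → h≈h′ m (NP.m<n⇒m<1+n m<a))

  hDiff-diag : ∀ h a → hDiff h a a ≡ 1#
  hDiff-diag h zero = ≡.refl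
  hDiff-diag h (suc a) = hDiff-diag h a

  hDiff-< : ∀ h a b → a < b → hDiff h a b ≡ 0#
  hDiff-< h zero (suc b) _ = ≡.refl
  hDiff-< h (suc a) (suc b) (s≤s a<b) = hDiff-< h a b a<b

  jtEntry : ℕ → Series → ℕ → ℕ → Carrier
  jtEntry k h i j = hDiff h ((k ∸ i) ℕ.+ j) i

  jacobiTrudi : ∀ k → Series → Matrix k
  jacobiTrudi k h i j = jtEntry k h (toℕ i) (toℕ j)

  staircaseSchur : ℕ → Series → Carrier
  staircaseSchur k h = det k (jacobiTrudi k h)

  oddH evenH : Series → Series
  oddH h e = h (twice e)
  evenH h e = withH₀ h (twice e)

  coeffOfShift-oddH : ∀ h s e → hDiff h (suc (twice s)) (twice e) ≡ coeffOfShift (oddH h) s e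
  coeffOfShift-oddH h s zero = ≡.refl
  coeffOfShift-oddH h zero (suc e) = ≡.refl
  coeffOfShift-oddH h (suc s) (suc e) = coeffOfShift-oddH h s e

  coeffOfShift-evenH : ∀ h s e → hDiff h (suc (twice s)) (suc (twice e)) ≡ coeffOfShift (evenH h) s e
  coeffOfShift-evenH h s zero = ≡.refl
  coeffOfShift-evenH h zero (suc e) = ≡.refl
  coeffOfShift-evenH h (suc s) (suc e) = coeffOfShift-evenH h s e

  jtEntry-reflected : ∀ k h s d → s < k → d < k → jtEntry k h (k ∸ suc s) (k ∸ suc d) ≡ hDiff h (suc (twice s)) d
  jtEntry-reflected (suc k) h s d (s≤s s≤k) (s≤s d≤k) =
    hDiff-cong-diff h ((suc k ∸ (k ∸ s)) ℕ.+ (k ∸ d)) (k ∸ s) (suc (twice s)) d (reflected-index k s d s≤k d≤k)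

  padVec : ∀ {k} → (Fin k → Carrier) → Series
  padVec {k} v j with j ℕ.<? k
  ... | yes j<k = v (fromℕ< j<k)
  ... | no _    = 0#

  padVec-< : ∀ {k} (v : Fin k → Carrier) j (j<k : j < k) → padVec v j ≈ v (fromℕ< j<k)
  padVec-< {k} v j j<k with j ℕ.<? k
  ... | yes _   = refl
  ... | no j≮k  = ⊥-elim (j≮k j<k)

  padVec-toℕ : ∀ {k} (v : Fin k → Carrier) i → padVec v (toℕ i) ≈ v i
  padVec-toℕ v i = trans (padVec-< v (toℕ i) (FP.toℕ<n i)) (reflexive (≡.cong v (FP.fromℕ<-toℕ i (FP.toℕ<n i))))

  Σ≈sumBelow : ∀ k (f : ℕ → Carrier) (v : Fin k → Carrier) → Σ (λ j → f (toℕ j) * v j) ≈ sumBelow k (λ j → f j * padVec v j)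
  Σ≈sumBelow zero f v = refl
  Σ≈sumBelow (suc k) f v = begin
    Σ (λ j → f (toℕ j) * v j)
      ≈⟨ Σ-suc (λ j → f (toℕ j) * v j) ⟩
    f 0 * v Fin.zero + Σ (λ j → f (suc (toℕ j)) * v (Fin.suc j))
      ≈⟨ +-cong (*-congˡ (sym (padVec-< v 0 (s≤s z≤n)))) (Σ≈sumBelow k (f ∘ suc) (v ∘ Fin.suc)) ⟩
    f 0 * padVec v 0 + sumBelow k (λ j → f (suc j) * padVec (v ∘ Fin.suc) j)
      ≈⟨ +-congˡ (sumBelow-cong k (λ j j<k → *-congˡ (padVec-suc j j<k))) ⟩
    sumBelow (suc k) (λ j → f j * padVec v j) ∎
    where
    padVec-suc : ∀ j → j < k → padVec (v ∘ Fin.suc) j ≈ padVec v (suc j)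
    padVec-suc j j<k = trans (padVec-< (v ∘ Fin.suc) j j<k) (sym (padVec-< v (suc j) (s≤s j<k)))

  reflectBelow : ℕ → Series → Series
  reflectBelow k w d with d ℕ.<? k
  ... | yes _ = w (k ∸ suc d)
  ... | no _  = 0#

  reflectBelow-≥ : ∀ k w d → k ≤ d → reflectBelow k w d ≈ 0#
  reflectBelow-≥ k w d k≤d with d ℕ.<? k
  ... | yes d<k = ⊥-elim (NP.<-irrefl ≡.refl (NP.<-≤-trans d<k k≤d))
  ... | no _    = refl

  reflectBelow-< : ∀ k w d → d < k → reflectBelow k w d ≈ w (k ∸ suc d)
  reflectBelow-< k w d d<k with d ℕ.<? k
  ... | yes _   = refl
  ... | no d≮k  = ⊥-elim (d≮k d<k)

  interleave : Series → Series → Series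
  interleave E O zero = E 0
  interleave E O (suc d) = interleave O (E ∘ suc) d

  interleave-even : ∀ E O e → interleave E O (twice e) ≡ E e
  interleave-even E O zero = ≡.refl
  interleave-even E O (suc e) = interleave-even (E ∘ suc) (O ∘ suc) e

  interleave-odd : ∀ E O e → interleave E O (suc (twice e)) ≡ O e
  interleave-odd E O zero = ≡.refl
  interleave-odd E O (suc e) = interleave-odd (E ∘ suc) (O ∘ suc) e

  jacobiTrudi-row≈relationEquation : ∀ k h (u : Series) s → s < k →
    sumBelow k (λ j → jtEntry k h (k ∸ suc s) j * u (k ∸ suc j)) ≈
    productCoeff ⌈ k /2⌉ s (oddH h) (u ∘ twice) + productCoeff ⌊ k /2⌋ s (evenH h) (u ∘ suc ∘ twice)
  jacobiTrudi-row≈relationEquation k h u s s<k = begin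
    sumBelow k (λ j → jtEntry k h (k ∸ suc s) j * u (k ∸ suc j))
      ≈⟨ sumBelow-reflect k _ ⟩
    sumBelow k (λ d → jtEntry k h (k ∸ suc s) (k ∸ suc d) * u (k ∸ suc (k ∸ suc d)))
      ≈⟨ sumBelow-cong k (λ d d<k → reflexive (≡.cong₂ _*_ (jtEntry-reflected k h s d s<k d<k) (≡.cong u (reflect-involutive k d d<k)))) ⟩
    sumBelow k (λ d → hDiff h (suc (twice s)) d * u d)
      ≈⟨ sumBelow-parity k _ ⟩
    sumBelow ⌈ k /2⌉ (λ e → hDiff h (suc (twice s)) (twice e) * u (twice e))
      + sumBelow ⌊ k /2⌋ (λ e → hDiff h (suc (twice s)) (suc (twice e)) * u (suc (twice e)))
      ≈⟨ +-cong (sumBelow-cong ⌈ k /2⌉ (λ e _ → reflexive (≡.cong (_* u (twice e)) (coeffOfShift-oddH h s e))))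
                (sumBelow-cong ⌊ k /2⌋ (λ e _ → reflexive (≡.cong (_* u (suc (twice e))) (coeffOfShift-evenH h s e)))) ⟩
    productCoeff ⌈ k /2⌉ s (oddH h) (u ∘ twice) + productCoeff ⌊ k /2⌋ s (evenH h) (u ∘ suc ∘ twice) ∎

  kernel⇒relationEquations : ∀ k h (v : Fin k → Carrier) → Annihilates (jacobiTrudi k h) v → ∀ s → s < k →
    productCoeff ⌈ k /2⌉ s (oddH h) (reflectBelow k (padVec v) ∘ twice)
      + productCoeff ⌊ k /2⌋ s (evenH h) (reflectBelow k (padVec v) ∘ suc ∘ twice) ≈ 0#
  kernel⇒relationEquations k h v Mv≈0 s s<k = begin
    productCoeff ⌈ k /2⌉ s (oddH h) (u ∘ twice) + productCoeff ⌊ k /2⌋ s (evenH h) (u ∘ suc ∘ twice)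
      ≈⟨ jacobiTrudi-row≈relationEquation k h u s s<k ⟨
    sumBelow k (λ j → jtEntry k h (k ∸ suc s) j * u (k ∸ suc j))
      ≈⟨ sumBelow-cong k (λ j j<k → *-cong (reflexive (≡.cong (λ z → jtEntry k h z j) (≡.sym toℕi≡)))
            (trans (reflectBelow-< k (padVec v) (k ∸ suc j) (reflect-< k j j<k)) (reflexive (≡.cong (padVec v) (reflect-involutive k j j<k))))) ⟩
    sumBelow k (λ j → jtEntry k h (toℕ i) j * padVec v j)
      ≈⟨ Σ≈sumBelow k (jtEntry k h (toℕ i)) v ⟨
    Σ (λ j → jacobiTrudi k h i j * v j)
      ≈⟨ Mv≈0 i ⟩
    0# ∎
    where
    u : Series
    u = reflectBelow k (padVec v)
    i : Fin k
    i = fromℕ< (reflect-< k s s<k)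
    toℕi≡ : toℕ i ≡ k ∸ suc s
    toℕi≡ = FP.toℕ-fromℕ< (reflect-< k s s<k)

  staircaseSchur≈0⇒relation : ∀ k h → staircaseSchur k h ≈ 0# → PadeRelation ⌈ k /2⌉ ⌊ k /2⌋ (oddH h) (evenH h)
  staircaseSchur≈0⇒relation k h det≈0 with det≈0⇒kernel k (jacobiTrudi k h) det≈0
  ... | v , (j , vj≉0) , Mv≈0 = record
    { E = u ∘ twice ; O = u ∘ suc ∘ twice
    ; E-degree = λ e ≤e → reflectBelow-≥ k (padVec v) (twice e) (⌈/2⌉≤⇒≤twice k e ≤e)
    ; O-degree = λ e ≤e → reflectBelow-≥ k (padVec v) (suc (twice e)) (⌊/2⌋≤⇒≤1+twice k e ≤e)
    ; nontrivial = nontrivial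
    ; vanishes = λ s s< → kernel⇒relationEquations k h v Mv≈0 s (≡.subst (s <_) (⌈k/2⌉+⌊k/2⌋≡k k) s<) }
    where
    u : Series
    u = reflectBelow k (padVec v)
    d : ℕ
    d = k ∸ suc (toℕ j)
    d<k : d < k
    d<k = reflect-< k (toℕ j) (FP.toℕ<n j)
    ud≉0 : ¬ (u d ≈ 0#)
    ud≉0 ud≈0 = vj≉0 (trans (sym (trans (reflectBelow-< k (padVec v) d d<k)
      (trans (reflexive (≡.cong (padVec v) (reflect-involutive k (toℕ j) (FP.toℕ<n j)))) (padVec-toℕ v j)))) ud≈0)
    nontrivial : NonzeroBelow ⌈ k /2⌉ (u ∘ twice) ⊎ NonzeroBelow ⌊ k /2⌋ (u ∘ suc ∘ twice)
    nontrivial with parity d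
    ... | inj₁ (e , d≡2e) = inj₁ (e , NP.≰⇒> (λ ≤e → NP.<-irrefl ≡.refl (NP.<-≤-trans (≡.subst (_< k) d≡2e d<k) (⌈/2⌉≤⇒≤twice k e ≤e))) ,
                                   λ u2e≈0 → ud≉0 (trans (reflexive (≡.cong u d≡2e)) u2e≈0))
    ... | inj₂ (e , d≡2e+1) = inj₂ (e , NP.≰⇒> (λ ≤e → NP.<-irrefl ≡.refl (NP.<-≤-trans (≡.subst (_< k) d≡2e+1 d<k) (⌊/2⌋≤⇒≤1+twice k e ≤e))) ,
                                     λ u2e+1≈0 → ud≉0 (trans (reflexive (≡.cong u d≡2e+1)) u2e+1≈0))

  relation⇒staircaseSchur≈0 : ∀ k h → PadeRelation ⌈ k /2⌉ ⌊ k /2⌋ (oddH h) (evenH h) → staircaseSchur k h ≈ 0#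
  relation⇒staircaseSchur≈0 k h rel = kernel⇒det≈0 k (jacobiTrudi k h) v v≉0 Mv≈0
    where
    open PadeRelation rel
    u : Series
    u = interleave E O
    v : Fin k → Carrier
    v j = u (k ∸ suc (toℕ j))
    v-reflected : ∀ d (d<k : d < k) → v (fromℕ< (reflect-< k d d<k)) ≡ u d
    v-reflected d d<k = ≡.trans (≡.cong (λ z → u (k ∸ suc z)) (FP.toℕ-fromℕ< (reflect-< k d d<k))) (≡.cong u (reflect-involutive k d d<k))
    v≉0 : NonzeroVec v
    v≉0 with nontrivial
    ... | inj₁ (e , e< , Ee≉0) = fromℕ< (reflect-< k (twice e) (twice-<⌈/2⌉ k e e<)) ,
            λ v≈0 → Ee≉0 (trans (reflexive (≡.sym (≡.trans (v-reflected (twice e) (twice-<⌈/2⌉ k e e<)) (interleave-even E O e)))) v≈0)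
    ... | inj₂ (e , e< , Oe≉0) = fromℕ< (reflect-< k (suc (twice e)) (1+twice-<⌊/2⌋ k e e<)) ,
            λ v≈0 → Oe≉0 (trans (reflexive (≡.sym (≡.trans (v-reflected (suc (twice e)) (1+twice-<⌊/2⌋ k e e<)) (interleave-odd E O e)))) v≈0)
    Mv≈0 : Annihilates (jacobiTrudi k h) v
    Mv≈0 i = begin
      Σ (λ j → jacobiTrudi k h i j * v j)
        ≈⟨ Σ≈sumBelow k (jtEntry k h (toℕ i)) v ⟩
      sumBelow k (λ j → jtEntry k h (toℕ i) j * padVec v j)
        ≈⟨ sumBelow-cong k (λ j j<k → *-cong (reflexive (≡.cong (λ z → jtEntry k h z j) toℕi≡))
              (trans (padVec-< v j j<k) (reflexive (≡.cong (λ z → u (k ∸ suc z)) (FP.toℕ-fromℕ< j<k))))) ⟩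
      sumBelow k (λ j → jtEntry k h (k ∸ suc s) j * u (k ∸ suc j))
        ≈⟨ jacobiTrudi-row≈relationEquation k h u s s<k ⟩
      productCoeff ⌈ k /2⌉ s (oddH h) (u ∘ twice) + productCoeff ⌊ k /2⌋ s (evenH h) (u ∘ suc ∘ twice)
        ≈⟨ +-cong (productCoeff-cong ⌈ k /2⌉ s (λ _ _ → refl) (λ e _ → reflexive (interleave-even E O e)))
                  (productCoeff-cong ⌊ k /2⌋ s (λ _ _ → refl) (λ e _ → reflexive (interleave-odd E O e))) ⟩
      productCoeff ⌈ k /2⌉ s (oddH h) E + productCoeff ⌊ k /2⌋ s (evenH h) O
        ≈⟨ vanishes s (≡.subst (s <_) (≡.sym (⌈k/2⌉+⌊k/2⌋≡k k)) s<k) ⟩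
      0# ∎
      where
      s : ℕ
      s = k ∸ suc (toℕ i)
      s<k : s < k
      s<k = reflect-< k (toℕ i) (FP.toℕ<n i)
      toℕi≡ : toℕ i ≡ k ∸ suc s
      toℕi≡ = ≡.sym (reflect-involutive k (toℕ i) (FP.toℕ<n i))

  staircaseSchur-cong : ∀ k M → k ℕ.+ k ≤ suc M → ∀ {h h′ : Series} → (∀ i → i < M → h i ≈ h′ i) →
    staircaseSchur k h ≈ staircaseSchur k h′
  staircaseSchur-cong k M 2k≤M+1 h≈h′ = det-cong k (λ a b → hDiff-cong _ (toℕ a) (λ i i< → h≈h′ i (NP.<-≤-trans i< (bound a b))))
    where
    bound : ∀ (a b : Fin k) → (k ∸ toℕ a) ℕ.+ toℕ b ≤ M
    bound a b = NP.≤-pred (NP.≤-trans (s≤s (NP.+-monoˡ-≤ (toℕ b) (NP.m∸n≤m k (toℕ a))))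
                  (NP.≤-trans (≡.subst (_≤ k ℕ.+ k) (NP.+-suc k (toℕ b)) (NP.+-monoʳ-≤ k (FP.toℕ<n b))) 2k≤M+1))

  -- Deleting the first row and the last column of the matrix for δ_(j+2) leaves a matrix whose
  -- last row is (0, …, 0, 1) and whose remaining block is the matrix for δ_j.
  staircaseSchur-cornerMinor : ∀ j h → det (suc j) (minor (jacobiTrudi (suc (suc j)) h) (fromℕ (suc j))) ≈ staircaseSchur j h
  staircaseSchur-cornerMinor j h = begin
    det (suc j) M            ≈⟨ det-unitLastRow j M lastRow-corner lastRow-other ⟩
    det j (topLeft M)        ≈⟨ det-cong j (λ a b → reflexive (topLeft≡ a b)) ⟩
    staircaseSchur j h       ∎
    where
    M : Matrix (suc j)
    M = minor (jacobiTrudi (suc (suc j)) h) (fromℕ (suc j))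
    [1+m]∸m≡1 : ∀ m → suc m ∸ m ≡ 1
    [1+m]∸m≡1 zero = ≡.refl
    [1+m]∸m≡1 (suc m) = [1+m]∸m≡1 m
    lastRow : ∀ b → M (fromℕ j) b ≡ hDiff h (toℕ b) j
    lastRow b = ≡.trans (≡.cong₂ (jtEntry (suc (suc j)) h) (≡.cong suc (FP.toℕ-fromℕ j))
                          (≡.trans (≡.cong toℕ (punchIn-fromℕ b)) (FP.toℕ-inject₁ b)))
                        (≡.cong (λ z → hDiff h (z ℕ.+ toℕ b) (suc j)) ([1+m]∸m≡1 (suc j)))
    lastRow-corner : M (fromℕ j) (fromℕ j) ≈ 1#
    lastRow-corner = reflexive (≡.trans (lastRow (fromℕ j)) (≡.trans (≡.cong (λ z → hDiff h z j) (FP.toℕ-fromℕ j)) (hDiff-diag h j)))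
    lastRow-other : ∀ b → toℕ b < j → M (fromℕ j) b ≈ 0#
    lastRow-other b b<j = reflexive (≡.trans (lastRow b) (hDiff-< h (toℕ b) j b<j))
    topLeft≡ : ∀ a b → topLeft M a b ≡ jacobiTrudi j h a b
    topLeft≡ a b = ≡.trans (≡.cong₂ (jtEntry (suc (suc j)) h) (≡.cong suc (FP.toℕ-inject₁ a))
                             (≡.trans (≡.cong toℕ (punchIn-fromℕ (inject₁ b))) (≡.trans (FP.toℕ-inject₁ (inject₁ b)) (FP.toℕ-inject₁ b))))
                           (≡.cong (λ z → hDiff h (z ℕ.+ toℕ b) (suc (toℕ a))) (NP.+-∸-assoc 1 (NP.<⇒≤ (FP.toℕ<n a))))

  -- h_(2k-1) (stored at index 2k-2 = (j+1)+(j+1) for k = j+2) occurs only in the top-right corner.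
  staircaseSchur-expandCorner : ∀ j (h h′ : Series) → (∀ i → i < suc j ℕ.+ suc j → h i ≈ h′ i) → h′ (suc j ℕ.+ suc j) ≈ 0# →
    staircaseSchur (suc (suc j)) h ≈ staircaseSchur (suc (suc j)) h′ + (alt (suc j) * h (suc j ℕ.+ suc j)) * staircaseSchur j h
  staircaseSchur-expandCorner j h h′ h≈h′ h′2m≈0 = begin
    staircaseSchur (suc m) h
      ≈⟨ det-linear-corner m (jacobiTrudi (suc m) h) (jacobiTrudi (suc m) h′) row0≈ rows≈ corner′≈0 ⟩
    staircaseSchur (suc m) h′ + (alt m * jacobiTrudi (suc m) h Fin.zero (fromℕ m)) * det m (minor (jacobiTrudi (suc m) h) (fromℕ m))
      ≈⟨ +-congˡ (*-cong (*-congˡ (reflexive (corner h))) (staircaseSchur-cornerMinor j h)) ⟩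
    staircaseSchur (suc m) h′ + (alt m * h (m ℕ.+ m)) * staircaseSchur j h ∎
    where
    m : ℕ
    m = suc j
    corner : ∀ g → jacobiTrudi (suc m) g Fin.zero (fromℕ m) ≡ g (m ℕ.+ m)
    corner g = ≡.cong (λ z → hDiff g (suc m ℕ.+ z) 0) (FP.toℕ-fromℕ m)
    corner′≈0 : jacobiTrudi (suc m) h′ Fin.zero (fromℕ m) ≈ 0#
    corner′≈0 = trans (reflexive (corner h′)) h′2m≈0
    row0≈ : ∀ b → jacobiTrudi (suc m) h Fin.zero (inject₁ b) ≈ jacobiTrudi (suc m) h′ Fin.zero (inject₁ b)
    row0≈ b = hDiff-cong _ 0 (λ i i< → h≈h′ i (NP.<-≤-trans i< bound))
      where
      bound : suc m ℕ.+ toℕ (inject₁ b) ≤ m ℕ.+ m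
      bound = ≡.subst (λ z → suc m ℕ.+ z ≤ m ℕ.+ m) (≡.sym (FP.toℕ-inject₁ b))
                (≡.subst (_≤ m ℕ.+ m) (NP.+-suc m (toℕ b)) (NP.+-monoʳ-≤ m (FP.toℕ<n b)))
    rows≈ : ∀ a b → jacobiTrudi (suc m) h (Fin.suc a) b ≈ jacobiTrudi (suc m) h′ (Fin.suc a) b
    rows≈ a b = hDiff-cong _ (suc (toℕ a)) (λ i i< → h≈h′ i (NP.<-≤-trans i< bound))
      where
      bound : (m ∸ toℕ a) ℕ.+ toℕ b ≤ m ℕ.+ m
      bound = NP.+-mono-≤ (NP.m∸n≤m m (toℕ a)) (NP.≤-pred (FP.toℕ<n b))


module StaircaseZeroCount {c ℓ q} (F : Defs.FiniteField c ℓ q) where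

  open import Data.Nat using (ℕ; zero; suc; _≤_; _+_; _*_; _^_; ⌊_/2⌋; ⌈_/2⌉)
  import Data.Nat.Properties as NP
  open import Relation.Binary.PropositionalEquality as ≡ using (_≡_)
  open import Data.Bool using (true)
  open import Data.Bool.Properties using (⇔→≡)
  open import Function.Bundles using (Equivalence; _⇔_; mk⇔)

  open Defs.FiniteField F using (commRing)
  open CommutativeRing commRing using (_≈_; 1#; refl; sym; reflexive)
  open FieldLemmas F using (Series; isZero; 1≉0)
  open PadeRelations F using (PadeRelation; hasRelation; hasRelation-correct; relation-cong; isZero-true; isZero-true⁻¹)
  open Counting F
  open RelationCount F using (monicRelationCount; monicRelationCount-formula)
  open StaircaseIndices using (twice; twice≡e+e; ⌈k/2⌉+⌊k/2⌋≡k)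
  open JacobiTrudi F
  open ≡.≡-Reasoning

  schurVanishes : ℕ → Series → ℕ
  schurVanishes k h = bool→ℕ (isZero (staircaseSchur k h))

  schurVanishes-dep : ∀ k M → k + k ≤ suc M → DependsOnFirst M (schurVanishes k)
  schurVanishes-dep k M 2k≤M+1 h≈h′ = ≡.cong bool→ℕ (isZero-cong (staircaseSchur-cong k M 2k≤M+1 h≈h′))

  interleave-0ₛ : ∀ i → interleave 0ₛ 0ₛ i ≈ 0ₛ i
  interleave-0ₛ zero = refl
  interleave-0ₛ (suc i) = interleave-0ₛ i

  ΣFⁿ-interleave : ∀ m (g : Series → ℕ) → DependsOnFirst (suc (twice m)) g →
    ΣFⁿ (suc (twice m)) g ≡ ΣFⁿ (suc m) (λ B → ΣFⁿ m (λ A′ → g (interleave B A′)))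
  ΣFⁿ-interleave zero g g-dep =
    ΣF-cong (λ a → g-dep {a ∷ₛ 0ₛ} {interleave (a ∷ₛ 0ₛ) 0ₛ} λ { zero _ → refl ; (suc i) _ → sym (interleave-0ₛ i) })
  ΣFⁿ-interleave (suc m) g g-dep = begin
    ΣF (λ a → ΣF (λ b → ΣFⁿ (suc (twice m)) (λ X → g (a ∷ₛ (b ∷ₛ X)))))
      ≡⟨ ΣF-cong (λ a → ΣF-cong (λ b → ΣFⁿ-interleave m (λ X → g (a ∷ₛ (b ∷ₛ X)))
            (DependsOnFirst-∷ _ _ (DependsOnFirst-∷ _ g g-dep a) b))) ⟩
    ΣF (λ a → ΣF (λ b → ΣFⁿ (suc m) (λ B → ΣFⁿ m (λ A′ → g (a ∷ₛ (b ∷ₛ interleave B A′))))))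
      ≡⟨ ΣF-cong (λ a → ΣF-ΣFⁿ-comm (suc m) (λ b B → ΣFⁿ m (λ A′ → g (a ∷ₛ (b ∷ₛ interleave B A′))))) ⟩
    ΣF (λ a → ΣFⁿ (suc m) (λ B → ΣF (λ b → ΣFⁿ m (λ A′ → g (a ∷ₛ (b ∷ₛ interleave B A′))))))
      ≡⟨ ΣF-cong (λ a → ΣFⁿ-cong (suc m) (λ B → ΣF-cong (λ b → ΣFⁿ-cong m (λ A′ →
            g-dep {a ∷ₛ (b ∷ₛ interleave B A′)} {interleave (a ∷ₛ B) (b ∷ₛ A′)}
                  λ { zero _ → refl ; (suc zero) _ → refl ; (suc (suc i)) _ → refl })))) ⟩
    ΣFⁿ (suc (suc m)) (λ B → ΣFⁿ (suc m) (λ A′ → g (interleave B A′))) ∎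

  -- For h = interleave B A′ the odd h's are B and the even h's are 1 ∷ₛ A′.
  schurVanishes≡hasRelation : ∀ m B A′ →
    isZero (staircaseSchur (suc m) (interleave B A′)) ≡ hasRelation (suc m) (suc ⌊ m /2⌋) ⌈ m /2⌉ B (1# ∷ₛ A′)
  schurVanishes≡hasRelation m B A′ = ⇔→≡ (mk⇔
    (λ eq → Equivalence.to decides (relation-cong (λ i _ → oddH≈ i) (λ i _ → evenH≈ i)
             (staircaseSchur≈0⇒relation (suc m) (interleave B A′) (isZero-true⁻¹ _ eq))))
    (λ eq → isZero-true _ (relation⇒staircaseSchur≈0 (suc m) (interleave B A′)
             (relation-cong (λ i _ → sym (oddH≈ i)) (λ i _ → sym (evenH≈ i)) (Equivalence.from decides eq)))))
    where
    decides : PadeRelation (suc ⌊ m /2⌋) ⌈ m /2⌉ B (1# ∷ₛ A′) ⇔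
              (hasRelation (suc m) (suc ⌊ m /2⌋) ⌈ m /2⌉ B (1# ∷ₛ A′) ≡ true)
    decides = hasRelation-correct (suc m) ⌊ m /2⌋ ⌈ m /2⌉ B (1# ∷ₛ A′) (⌈k/2⌉+⌊k/2⌋≡k (suc m)) 1≉0
    oddH≈ : ∀ i → oddH (interleave B A′) i ≈ B i
    oddH≈ i = reflexive (interleave-even B A′ i)
    evenH≈ : ∀ i → evenH (interleave B A′) i ≈ (1# ∷ₛ A′) i
    evenH≈ zero = refl
    evenH≈ (suc e) = reflexive (interleave-odd B A′ e)

  2[m+1]≤2m+2 : ∀ m → suc m + suc m ≤ suc (suc (twice m))
  2[m+1]≤2m+2 m = NP.≤-reflexive (≡.cong suc (≡.trans (NP.+-suc m m) (≡.cong suc (≡.sym (twice≡e+e m)))))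

  staircaseSchur-zeroCount : ∀ m → ΣFⁿ (suc (twice m)) (schurVanishes (suc m)) ≡ q ^ m * q ^ m
  staircaseSchur-zeroCount m = begin
    ΣFⁿ (suc (twice m)) (schurVanishes (suc m))
      ≡⟨ ΣFⁿ-interleave m (schurVanishes (suc m)) (schurVanishes-dep (suc m) (suc (twice m)) (2[m+1]≤2m+2 m)) ⟩
    ΣFⁿ (suc m) (λ B → ΣFⁿ m (λ A′ → schurVanishes (suc m) (interleave B A′)))
      ≡⟨ ΣFⁿ-cong (suc m) (λ B → ΣFⁿ-cong m (λ A′ → ≡.cong bool→ℕ (schurVanishes≡hasRelation m B A′))) ⟩
    monicRelationCount m (suc ⌊ m /2⌋) ⌈ m /2⌉
      ≡⟨ monicRelationCount-formula m ⌊ m /2⌋ ⌈ m /2⌉ (⌈k/2⌉+⌊k/2⌋≡k (suc m)) ⟩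
    q ^ m * q ^ m ∎

  staircaseSchur-zeroCount-padded : ∀ m d → ΣFⁿ (suc (twice m) + d) (schurVanishes (suc m)) ≡ q ^ d * (q ^ m * q ^ m)
  staircaseSchur-zeroCount-padded m d = begin
    ΣFⁿ (suc (twice m) + d) (schurVanishes (suc m))
      ≡⟨ ΣFⁿ-unusedCoordinates (suc (twice m)) d (schurVanishes (suc m)) (schurVanishes-dep (suc m) (suc (twice m)) (2[m+1]≤2m+2 m)) ⟩
    q ^ d * ΣFⁿ (suc (twice m)) (schurVanishes (suc m))
      ≡⟨ ≡.cong (q ^ d *_) (staircaseSchur-zeroCount m) ⟩
    q ^ d * (q ^ m * q ^ m) ∎


module ListCount {c ℓ q} (F : Defs.FiniteField c ℓ q) where

  open import Level using (Level)
  open import Data.Nat as ℕ using (ℕ; zero; suc; _<_; s≤s; z≤n; _+_)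
  import Data.Nat.Properties as NP
  open import Data.Fin as Fin using (Fin; fromℕ<)
  open import Data.List using (List; []; _∷_; _++_; map; length; filter; concatMap)
  open import Data.Nat.ListAction using () renaming (sum to sumˡ)
  import Data.List.Properties as LP
  open import Relation.Binary.PropositionalEquality as ≡ using (_≡_; cong; trans; sym)
  open import Relation.Nullary using (yes; no; does)
  open import Relation.Unary using (Pred; Decidable)
  open import Function using (_∘_)
  open import Function.Bundles using (Inverse)
  open import Data.Empty using (⊥-elim)

  open Defs.FiniteField F using (commRing; enum)
  open Inverse enum using (to)
  private module R = CommutativeRing commRing
  open R using (_≈_; 0#)
  open FieldLemmas F using (Series)
  open Counting F using (ΣFⁿ; DependsOnFirst; DependsOnFirst-∷; _∷ₛ_; bool→ℕ)
  open import Algebra.Properties.Semiring.Sum NP.+-*-semiring using (sum; sum-cong-≗)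
  open ≡.≡-Reasoning

  module _ {a p : Level} {A : Set a} {P : Pred A p} (P? : Decidable P) where

    length-filter-∷ : ∀ x xs → length (filter P? (x ∷ xs)) ≡ bool→ℕ (does (P? x)) + length (filter P? xs)
    length-filter-∷ x xs with P? x
    ... | yes _ = ≡.refl
    ... | no _  = ≡.refl

    length-filter-++ : ∀ xs ys → length (filter P? (xs ++ ys)) ≡ length (filter P? xs) + length (filter P? ys)
    length-filter-++ xs ys = trans (cong length (LP.filter-++ P? xs ys)) (LP.length-++ (filter P? xs))

  length-filter-concatMap : ∀ {a b p} {A : Set a} {B : Set b} {P : Pred B p} (P? : Decidable P) (f : A → List B) xs →
    length (filter P? (concatMap f xs)) ≡ sumˡ (map (λ x → length (filter P? (f x))) xs)
  length-filter-concatMap P? f [] = ≡.refl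
  length-filter-concatMap P? f (x ∷ xs) =
    trans (length-filter-++ P? (f x) (concatMap f xs)) (cong (length (filter P? (f x)) +_) (length-filter-concatMap P? f xs))

  length-filter-map : ∀ {a b p} {A : Set a} {B : Set b} {P : Pred B p} (P? : Decidable P) (f : A → B) ys →
    length (filter P? (map f ys)) ≡ length (filter (P? ∘ f) ys)
  length-filter-map P? f [] = ≡.refl
  length-filter-map P? f (y ∷ ys) = trans (length-filter-∷ P? (f y) (map f ys))
    (trans (cong (bool→ℕ (does (P? (f y))) +_) (length-filter-map P? f ys)) (sym (length-filter-∷ (P? ∘ f) y ys)))

  sum-map-allFin : ∀ n (f : Fin n → ℕ) → sumˡ (map f (Defs.allFin n)) ≡ sum f
  sum-map-allFin zero f = ≡.refl
  sum-map-allFin (suc n) f =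
    cong (f Fin.zero +_) (trans (cong sumˡ (sym (LP.map-∘ (Defs.allFin n)))) (sum-map-allFin n (f ∘ Fin.suc)))

  toSeries : ∀ {N} → (Fin N → Fin q) → Series
  toSeries {N} x m with m ℕ.<? N
  ... | yes m<N = to (x (fromℕ< m<N))
  ... | no _    = 0#

  -- cons is the pattern lambda of Defs.allVecs; it is left abstract and pinned down by unification.
  module _ {N : ℕ} (cons : Fin q → (Fin N → Fin q) → Fin (suc N) → Fin q)
           (cons-zero : ∀ a f → cons a f Fin.zero ≡ a) (cons-suc : ∀ a f i → cons a f (Fin.suc i) ≡ f i) where

    toSeries-cons : ∀ a (f : Fin N → Fin q) i → i < suc N → toSeries (cons a f) i ≈ (to a ∷ₛ toSeries f) i
    toSeries-cons a f zero _ with 0 ℕ.<? suc N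
    ... | yes _ = R.reflexive (cong to (cons-zero a f))
    ... | no 0≮ = ⊥-elim (0≮ (s≤s z≤n))
    toSeries-cons a f (suc i) i< with suc i ℕ.<? suc N | i ℕ.<? N
    ... | yes _   | yes _  = R.reflexive (cong to (cons-suc a f _))
    ... | no i≮   | _      = ⊥-elim (i≮ i<)
    ... | yes _   | no i≮  = ⊥-elim (i≮ (ℕ.s<s⁻¹ i<))

    count-cons : ∀ {p} (P : Pred (Fin (suc N) → Fin q) p) (P? : Decidable P) (g : Series → ℕ) →
      (∀ x → g (toSeries x) ≡ bool→ℕ (does (P? x))) → DependsOnFirst (suc N) g →
      (∀ {p′} (P′ : Pred (Fin N → Fin q) p′) (P′? : Decidable P′) (g′ : Series → ℕ) →
         (∀ x → g′ (toSeries x) ≡ bool→ℕ (does (P′? x))) → DependsOnFirst N g′ → Defs.count P′ P′? (Defs.allVecs q N) ≡ ΣFⁿ N g′) →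
      length (filter P? (concatMap (λ a → map (cons a) (Defs.allVecs q N)) (Defs.allFin q))) ≡ ΣFⁿ (suc N) g
    count-cons P P? g g≡ g-dep count-N = begin
      length (filter P? (concatMap (λ a → map (cons a) (Defs.allVecs q N)) (Defs.allFin q)))
        ≡⟨ length-filter-concatMap P? (λ a → map (cons a) (Defs.allVecs q N)) (Defs.allFin q) ⟩
      sumˡ (map (λ a → length (filter P? (map (cons a) (Defs.allVecs q N)))) (Defs.allFin q))
        ≡⟨ sum-map-allFin q _ ⟩
      sum (λ a → length (filter P? (map (cons a) (Defs.allVecs q N))))
        ≡⟨ sum-cong-≗ (λ a → trans (length-filter-map P? (cons a) (Defs.allVecs q N))
             (count-N _ (P? ∘ cons a) (λ X → g (to a ∷ₛ X))
                (λ f → trans (g-dep (λ i i< → R.sym (toSeries-cons a f i i<))) (g≡ (cons a f)))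
                (DependsOnFirst-∷ N g g-dep (to a)))) ⟩
      ΣFⁿ (suc N) g ∎

  count≡ΣFⁿ : ∀ N {p} (P : Pred (Fin N → Fin q) p) (P? : Decidable P) (g : Series → ℕ) →
    (∀ x → g (toSeries x) ≡ bool→ℕ (does (P? x))) → DependsOnFirst N g → Defs.count P P? (Defs.allVecs q N) ≡ ΣFⁿ N g
  count≡ΣFⁿ zero P P? g g≡ g-dep =
    trans (trans (length-filter-∷ P? (λ ()) []) (NP.+-identityʳ _)) (trans (sym (g≡ (λ ()))) (g-dep (λ i ())))
  count≡ΣFⁿ (suc N) P P? g g≡ g-dep = count-cons _ (λ a f → ≡.refl) (λ a f i → ≡.refl) P P? g g≡ g-dep (count≡ΣFⁿ N)


module Proposition {c ℓ q} (F : Defs.FiniteField c ℓ q) where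

  open import Data.Nat as ℕ using (ℕ; zero; suc; _≤_; _<_; _∸_; _+_; _*_; _^_)
  import Data.Nat.Properties as NP
  open import Data.Integer as ℤ using (_⊖_)
  import Data.Integer.Properties as ℤP
  open import Data.Fin using (Fin; toℕ)
  open import Data.Vec using (lookup)
  import Data.Vec.Properties as VecP
  open import Data.Product using (_×_; _,_)
  open import Relation.Binary.PropositionalEquality as ≡ using (_≡_; _≢_)
  open import Relation.Nullary using (¬_; yes; no; Dec; does)
  open import Data.Nat.Tactic.RingSolver using (solve-∀)

  open Defs.FiniteField F using (commRing; _≟_)
  private module R = CommutativeRing commRing
  open R using (_≈_; 0#)
  open Defs using (staircase; allVecs; count)
  open Defs.Events F using (vals; Vanish; Vanish?; Both; Both?)
  open Defs.Det commRing using (hval; schur; alt)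
  open FieldLemmas F using (Series; isZero; *-cancelˡ-≈0; 1≉0)
  open Counting F
  open StaircaseIndices using (twice; twice≡e+e)
  open JacobiTrudi F
  open StaircaseZeroCount F
  open ListCount F using (toSeries; count≡ΣFⁿ)
  open ≡.≡-Reasoning

  hval≈hDiff : ∀ {N} (x : Fin N → Fin q) a b → hval (vals x) (a ⊖ b) ≈ hDiff (toSeries x) a b
  hval≈hDiff x zero zero = R.refl
  hval≈hDiff {N} x (suc m) zero with m ℕ.<? N
  ... | yes _ = R.refl
  ... | no _  = R.refl
  hval≈hDiff x zero (suc b) = R.refl
  hval≈hDiff x (suc a) (suc b) = R.trans (R.reflexive (≡.cong (hval (vals x)) (ℤP.[1+m]⊖[1+n]≡m⊖n a b))) (hval≈hDiff x a b)

  schur≈staircaseSchur : ∀ N k (x : Fin N → Fin q) → schur (vals x) (staircase k) ≈ staircaseSchur k (toSeries x)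
  schur≈staircaseSchur N k x =
    det-cong k (λ i j → R.trans (R.reflexive (≡.cong (hval (vals x)) (index i j))) (hval≈hDiff x ((k ∸ toℕ i) + toℕ j) (toℕ i)))
    where
    open Determinant commRing using (det-cong)
    open ℤ using (+_)
    index : ∀ (i j : Fin k) → (+ lookup (staircase k) i ℤ.- + toℕ i) ℤ.+ + toℕ j ≡ ((k ∸ toℕ i) + toℕ j) ⊖ toℕ i
    index i j = ≡.trans (≡.cong (λ z → (+ z ℤ.- + toℕ i) ℤ.+ + toℕ j) (VecP.lookup∘tabulate (λ i → k ∸ toℕ i) i))
                (≡.trans (≡.cong (ℤ._+ + toℕ j) (ℤP.[+m]-[+n]≡m⊖n (k ∸ toℕ i) (toℕ i)))
                         (ℤP.distribˡ-⊖-+-pos (toℕ j) (k ∸ toℕ i) (toℕ i)))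

  Vanish-indicator : ∀ N k (x : Fin N → Fin q) → schurVanishes k (toSeries x) ≡ bool→ℕ (does (Vanish? N k x))
  Vanish-indicator N k x = ≡.cong bool→ℕ (isZero-cong (R.sym (schur≈staircaseSchur N k x)))

  Both-indicator : ∀ N k (x : Fin N → Fin q) →
    bool→ℕ (does (Vanish? N k x)) * bool→ℕ (does (Vanish? N (k ∸ 2) x)) ≡ bool→ℕ (does (Both? N k x))
  Both-indicator N k x with Vanish? N k x | Vanish? N (k ∸ 2) x
  ... | yes _ | yes _ = ≡.refl
  ... | yes _ | no _  = ≡.refl
  ... | no _  | _     = ≡.refl

  alt≉0 : ∀ m → ¬ (alt m ≈ 0#)
  alt≉0 m alt≈0 = 1≉0 (R.trans (R.sym (alt*alt≈1 m)) (R.trans (R.*-congʳ alt≈0) (R.zeroˡ _)))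
    where open Determinant commRing using (alt*alt≈1)

  -- Throughout, k = j + 2 = m + 1 and h_(2k-1) is the coefficient with index n = 2m of the series.
  module LastCoefficient (j : ℕ) where

    m n : ℕ
    m = suc j
    n = m + m

    bothVanish : Series → ℕ
    bothVanish h = schurVanishes (suc m) h * schurVanishes j h

    schurVanishes-k-dep : DependsOnFirst (suc n) (schurVanishes (suc m))
    schurVanishes-k-dep = schurVanishes-dep (suc m) (suc n) (NP.≤-reflexive (≡.cong suc (NP.+-suc m m)))

    schurVanishes-j-dep : ∀ M → n ≤ M → DependsOnFirst M (schurVanishes j)
    schurVanishes-j-dep M n≤M = schurVanishes-dep j M (NP.≤-trans (NP.+-mono-≤ (NP.n≤1+n j) (NP.n≤1+n j)) (NP.m≤n⇒m≤1+n n≤M))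

    bothVanish-dep : DependsOnFirst (suc n) bothVanish
    bothVanish-dep h≈h′ = ≡.cong₂ _*_ (schurVanishes-k-dep h≈h′) (schurVanishes-j-dep (suc n) (NP.n≤1+n n) h≈h′)

    setCoeff-agrees : ∀ X t t′ i → i < n → setCoeff X n t i ≈ setCoeff X n t′ i
    setCoeff-agrees X t t′ i i<n = R.reflexive (≡.trans (setCoeff-≢ X n t i i≢n) (≡.sym (setCoeff-≢ X n t′ i i≢n)))
      where
      i≢n : i ≢ n
      i≢n i≡n = NP.<-irrefl i≡n i<n

    schur-j-setCoeff : ∀ X t → staircaseSchur j (setCoeff X n t) ≈ staircaseSchur j X
    schur-j-setCoeff X t = staircaseSchur-cong j n (NP.≤-trans (NP.+-mono-≤ (NP.n≤1+n j) (NP.n≤1+n j)) (NP.n≤1+n n))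
      (λ i i<n → R.reflexive (setCoeff-≢ X n t i (λ i≡n → NP.<-irrefl i≡n i<n)))

    schur-k-setCoeff : ∀ X t → staircaseSchur (suc m) (setCoeff X n t)
                                 ≈ staircaseSchur (suc m) (setCoeff X n 0#) R.+ (alt m R.* staircaseSchur j X) R.* t
    schur-k-setCoeff X t = R.trans
      (staircaseSchur-expandCorner j (setCoeff X n t) (setCoeff X n 0#) (setCoeff-agrees X t 0#) (R.reflexive (setCoeff-≡ X n 0#)))
      (R.+-congˡ (R.trans (R.*-cong (R.*-congˡ (R.reflexive (setCoeff-≡ X n t))) (schur-j-setCoeff X t)) (swap23 _ _ _)))
      where
      swap23 : ∀ a t s → (a R.* t) R.* s ≈ (a R.* s) R.* t
      swap23 a t s = R.trans (R.*-assoc _ _ _) (R.trans (R.*-congˡ (R.*-comm t s)) (R.sym (R.*-assoc _ _ _)))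

    -- Summing over the value t of h_(2k-1): if s_(δ_(k-2)) ≠ 0 then s_(δ_k) is a nonconstant affine
    -- function of t, otherwise both events reduce to s_(δ_k) = 0.
    fibre : ∀ X → ΣF (λ t → schurVanishes (suc m) (setCoeff X n t))
                  ≡ ifNonzero (staircaseSchur j X) 1 + ΣF (λ t → bothVanish (setCoeff X n t))
    fibre X = byCases (staircaseSchur j X ≟ 0#)
      where
      byCases : Dec (staircaseSchur j X ≈ 0#) → ΣF (λ t → schurVanishes (suc m) (setCoeff X n t))
                  ≡ ifNonzero (staircaseSchur j X) 1 + ΣF (λ t → bothVanish (setCoeff X n t))
      byCases (yes Sj≈0) = ≡.sym (≡.cong₂ _+_ (ifNonzero-≈0 _ 1 Sj≈0)
        (ΣF-cong {λ t → bothVanish (setCoeff X n t)} {λ t → schurVanishes (suc m) (setCoeff X n t)} (λ t → ≡.trans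
          (≡.cong (schurVanishes (suc m) (setCoeff X n t) *_) (bool→ℕ-isZero-≈0 _ (R.trans (schur-j-setCoeff X t) Sj≈0)))
          (NP.*-identityʳ _))))
      byCases (no Sj≉0) = begin
        ΣF (λ t → schurVanishes (suc m) (setCoeff X n t))
          ≡⟨ ΣF-cong (λ t → ≡.cong bool→ℕ (isZero-cong (schur-k-setCoeff X t))) ⟩
        ΣF (λ t → bool→ℕ (isZero (staircaseSchur (suc m) (setCoeff X n 0#) R.+ (alt m R.* staircaseSchur j X) R.* t)))
          ≡⟨ ΣF-isZero-affine _ _ (λ a·Sj≈0 → Sj≉0 (*-cancelˡ-≈0 (alt m) _ (alt≉0 m) a·Sj≈0)) ⟩
        1
          ≡⟨ ≡.cong₂ _+_ (≡.sym (ifNonzero-≉0 _ 1 Sj≉0)) (≡.sym both≡0) ⟩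
        ifNonzero (staircaseSchur j X) 1 + ΣF (λ t → bothVanish (setCoeff X n t)) ∎
        where
        both≡0 : ΣF (λ t → bothVanish (setCoeff X n t)) ≡ 0
        both≡0 = ≡.trans (ΣF-cong (λ t → ≡.trans (≡.cong (schurVanishes (suc m) (setCoeff X n t) *_)
                   (bool→ℕ-isZero-≉0 _ (λ Sj′≈0 → Sj≉0 (R.trans (R.sym (schur-j-setCoeff X t)) Sj′≈0)))) (NP.*-zeroʳ (schurVanishes (suc m) (setCoeff X n t)))))
                 (≡.trans (ΣF-const 0) (NP.*-zeroʳ q))

    vanishCount-split : ΣFⁿ (suc n) (schurVanishes (suc m))
                          ≡ ΣFⁿ n (λ X → ifNonzero (staircaseSchur j X) 1) + ΣFⁿ (suc n) bothVanish
    vanishCount-split = begin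
      ΣFⁿ (suc n) (schurVanishes (suc m))
        ≡⟨ ΣFⁿ-split-last n (schurVanishes (suc m)) schurVanishes-k-dep ⟩
      ΣFⁿ n (λ X → ΣF (λ t → schurVanishes (suc m) (setCoeff X n t)))
        ≡⟨ ΣFⁿ-cong n fibre ⟩
      ΣFⁿ n (λ X → ifNonzero (staircaseSchur j X) 1 + ΣF (λ t → bothVanish (setCoeff X n t)))
        ≡⟨ ΣFⁿ-distrib-+ n (λ X → ifNonzero (staircaseSchur j X) 1) (λ X → ΣF (λ t → bothVanish (setCoeff X n t))) ⟩
      ΣFⁿ n (λ X → ifNonzero (staircaseSchur j X) 1) + ΣFⁿ n (λ X → ΣF (λ t → bothVanish (setCoeff X n t)))
        ≡⟨ ≡.cong (ΣFⁿ n (λ X → ifNonzero (staircaseSchur j X) 1) +_) (≡.sym (ΣFⁿ-split-last n bothVanish bothVanish-dep)) ⟩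
      ΣFⁿ n (λ X → ifNonzero (staircaseSchur j X) 1) + ΣFⁿ (suc n) bothVanish ∎

  module Counts (k₀ : ℕ) where

    j : ℕ
    j = suc k₀

    open LastCoefficient j public

    Q : ℕ
    Q = q ^ k₀ * q ^ k₀

    n≡2k₀+1+3 : n ≡ suc (twice k₀) + 3
    n≡2k₀+1+3 = ≡.trans (rearrange k₀) (≡.cong (λ z → suc z + 3) (≡.sym (twice≡e+e k₀)))
      where
      rearrange : ∀ x → suc (suc x) + suc (suc x) ≡ suc (x + x) + 3
      rearrange = solve-∀

    conditionCount : ∀ d → ΣFⁿ (n + d) (schurVanishes j) ≡ q ^ (3 + d) * Q
    conditionCount d = begin
      ΣFⁿ (n + d) (schurVanishes j)                 ≡⟨ ≡.cong (λ z → ΣFⁿ (z + d) (schurVanishes j)) n≡2k₀+1+3 ⟩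
      ΣFⁿ (suc (twice k₀) + 3 + d) (schurVanishes j) ≡⟨ ≡.cong (λ z → ΣFⁿ z (schurVanishes j)) (NP.+-assoc (suc (twice k₀)) 3 d) ⟩
      ΣFⁿ (suc (twice k₀) + (3 + d)) (schurVanishes j) ≡⟨ staircaseSchur-zeroCount-padded k₀ (3 + d) ⟩
      q ^ (3 + d) * Q                               ∎

    bothCount : ΣFⁿ (suc n) bothVanish ≡ q ^ 3 * Q
    bothCount = NP.+-cancelˡ-≡ nonvanishing _ _ (begin
      nonvanishing + ΣFⁿ (suc n) bothVanish       ≡⟨ ≡.sym vanishCount-split ⟩
      ΣFⁿ (suc n) (schurVanishes (suc m))         ≡⟨ ≡.cong (λ z → ΣFⁿ (suc z) (schurVanishes (suc m))) (≡.sym (twice≡e+e m)) ⟩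
      ΣFⁿ (suc (twice m)) (schurVanishes (suc m)) ≡⟨ staircaseSchur-zeroCount m ⟩
      q ^ m * q ^ m                               ≡⟨ NP.^-distribˡ-+-* q m m ⟨
      q ^ n                                       ≡⟨ ΣFⁿ-ifNonzero+isZero n (staircaseSchur j) ⟨
      nonvanishing + ΣFⁿ n (schurVanishes j)      ≡⟨ ≡.cong (λ z → nonvanishing + ΣFⁿ z (schurVanishes j)) (NP.+-identityʳ n) ⟨
      nonvanishing + ΣFⁿ (n + 0) (schurVanishes j) ≡⟨ ≡.cong (nonvanishing +_) (conditionCount 0) ⟩
      nonvanishing + q ^ 3 * Q                    ∎)
      where
      nonvanishing : ℕ
      nonvanishing = ΣFⁿ n (λ X → ifNonzero (staircaseSchur j X) 1)

    condition-positive : 0 < q ^ 4 * Q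
    condition-positive = ℕ.>-nonZero⁻¹ _ ⦃ NP.m*n≢0 _ _ ⦃ NP.m^n≢0 q 4 ⦄ ⦃ NP.m*n≢0 _ _ ⦃ NP.m^n≢0 q k₀ ⦄ ⦃ NP.m^n≢0 q k₀ ⦄ ⦄ ⦄
      where instance
      q-nonZero : ℕ.NonZero q
      q-nonZero = ℕ.≢-nonZero q≢0

  CountIdentity : ℕ → ℕ → Set
  CountIdentity N k = (0 < count (Vanish N (k ∸ 2)) (Vanish? N (k ∸ 2)) (allVecs q N))
                    × (count (Both N k) (Both? N k) (allVecs q N) * q ≡ count (Vanish N (k ∸ 2)) (Vanish? N (k ∸ 2)) (allVecs q N))

  countIdentity : ∀ k₀ → CountIdentity ((3 + k₀) + (2 + k₀)) (3 + k₀)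
  countIdentity k₀ = ≡.subst (0 <_) (≡.sym conditionCount-N) condition-positive , (begin
    count (Both N k) (Both? N k) (allVecs q N) * q  ≡⟨ ≡.cong (_* q) bothCount-N ⟩
    q ^ 3 * Q * q                                    ≡⟨ rearrange q Q ⟩
    q ^ 4 * Q                                        ≡⟨ conditionCount-N ⟨
    count (Vanish N j) (Vanish? N j) (allVecs q N)   ∎)
    where
    open Counts k₀
    k N : ℕ
    k = suc m
    N = suc n
    conditionCount-N : count (Vanish N j) (Vanish? N j) (allVecs q N) ≡ q ^ 4 * Q
    conditionCount-N = ≡.trans (count≡ΣFⁿ N (Vanish N j) (Vanish? N j) (schurVanishes j) (Vanish-indicator N j) (schurVanishes-j-dep N (NP.n≤1+n n)))
                               (≡.trans (≡.cong (λ z → ΣFⁿ z (schurVanishes j)) (NP.+-comm 1 n)) (conditionCount 1))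
    bothCount-N : count (Both N k) (Both? N k) (allVecs q N) ≡ q ^ 3 * Q
    bothCount-N = ≡.trans (count≡ΣFⁿ N (Both N k) (Both? N k) bothVanish
                            (λ x → ≡.trans (≡.cong₂ _*_ (Vanish-indicator N k x) (Vanish-indicator N j x)) (Both-indicator N k x))
                            bothVanish-dep)
                          bothCount
    rearrange : ∀ q Q → q * (q * (q * 1)) * Q * q ≡ q * (q * (q * (q * 1))) * Q
    rearrange = solve-∀


open import Defs
open import Level using (Level)
open import Data.Nat using (ℕ; _≤_; _<_; _*_; _∸_)
open import Data.Product using (_×_)
open import Relation.Binary.PropositionalEquality using (_≡_)
open import Data.Nat using (suc; s≤s; z≤n; _+_)
open import Data.Nat.Properties using (+-identityʳ; +-suc)
open import Relation.Binary.PropositionalEquality using (subst; sym; trans; cong)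

2k∸1≡k+[k-1] : ∀ x → 2 * suc x ∸ 1 ≡ suc x + x
2k∸1≡k+[k-1] x = trans (cong (x +_) (+-identityʳ (suc x))) (+-suc x x)

proposition8p4 : ∀ {c ℓ : Level} (q : ℕ) (F : FiniteField c ℓ q) (k : ℕ) → 3 ≤ k →
    let open Events F
        N = 2 * k ∸ 1
        B = count (Vanish N (k ∸ 2)) (Vanish? N (k ∸ 2)) (allVecs q N)
        AB = count (Both N k) (Both? N k) (allVecs q N)
    in (0 < B) × (AB * q ≡ B)
proposition8p4 q F (suc (suc (suc k₀))) (s≤s (s≤s (s≤s z≤n))) =
  subst (λ N → CountIdentity N (3 + k₀)) (sym (2k∸1≡k+[k-1] (2 + k₀))) (countIdentity k₀)
  where open Proposition F using (CountIdentity; countIdentity)
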